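{- Let $P$ be an $n$-dimensional Gorenstein lattice polytope in $\mathbb{R}^n$ of degree $d$. Then $P$ decomposes as a Cayley sum of lattice polytopes in $\mathbb{R}^q$ for some $q\le 2d-1$.
   Context: For an $n$-dimensional lattice polytope $P\subset\mathbb{R}^n$, write $\sum_{m\ge0}|mP\cap\mathbb{Z}^n|t^m = h^*_P(t)/(1-t)^{n+1}$ with $h^*_P(t)=h^*_0+\dots+h^*_dt^d$ a polynomial of degree $d$, the degree of $P$. $P$ is Gorenstein if $h^*_i=h^*_{d-i}$ for $0\le i\le d$. If $P_0,\dots,P_s$ are lattice polytopes in $\mathbb{R}^q$, their Cayley sum $P_0*\cdots*P_s$ is the convex hull of $(P_0\times 0)\cup(P_1\times e_1)\cup\cdots\cup(P_s\times e_s)$ in $\mathbb{R}^q\times\mathbb{R}^s$ ($e_i$ the standard basis). $P$ decomposes as a Cayley sum of lattice polytopes in $\mathbb{R}^q$ if some affine isomorphism $\mathbb{R}^n\cong\mathbb{R}^q\times\mathbb{R}^s$ mapping $\mathbb{Z}^n$ onto $\mathbb{Z}^{q}\times\mathbb{Z}^s$ identifies $P$ with $P_0*\cdots*P_s$ for some lattice polytopes $P_0,\dots,P_s\subset\mathbb{R}^q$.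
   Formalization: For degree d = 0 (for example the segment [0,1]) the bound q ≤ 2d−1 = −1 cannot hold; there the statement proved has q ≤ 0 instead, that is q ≤ max(2d−1, 0); for d ≥ 1 the bound is unchanged. -}

module Defs where

open import Algebra.Apartness.Bundles using (HeytingCommutativeRing; HeytingField)
open import Algebra.Bundles using (CommutativeRing)
import Algebra.Definitions.RawMonoid as RawMonoid
open import Data.Bool.Base using (if_then_else_)
open import Data.Fin.Base using (Fin; zero; suc; toℕ)
open import Data.Fin.Properties using (_≟_)
open import Data.Integer.Base as ℤ using (ℤ; +_; -[1+_])
import Data.Integer.Properties as ℤ
open import Data.List.Base using (List; length)
open import Data.List.Membership.Propositional using (_∈_)
open import Data.List.NonEmpty.Base using (List⁺; toList)
open import Data.List.Relation.Unary.Unique.Propositional using (Unique)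
open import Data.Nat.Base as ℕ using (ℕ; zero; suc; _∸_)
open import Data.Product.Base using (Σ; ∃₂; ∃-syntax; _×_)
open import Data.Sum.Base using (_⊎_)
open import Data.Vec.Base using (Vec; lookup)
open import Data.Vec.Functional using (Vector; _++_)
import Data.Vec.Functional.Relation.Binary.Equality.Setoid as VecEq
open import Function.Base using (_∘_)
open import Function.Bundles using (_⇔_; Inverse)
open import Level using (0ℓ)
open import Relation.Binary.Core using (Rel)
open import Relation.Binary.PropositionalEquality.Core using (_≡_; _≢_)
open import Relation.Binary.Structures using (IsStrictPartialOrder)
open import Relation.Nullary.Decidable.Core using (does)
open import Relation.Nullary.Negation.Core using (¬_)
open import Relation.Unary using (Pred; _≐_)

-- The real numbers, given axiomatically: a complete Archimedean ordered field.
-- The axioms are the constructive ones (classically x # y is just x ≢ y, and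
-- they say exactly "complete ordered field"); the Cauchy reals are a model.

record RealNumbers : Set₁ where
  infix 4 _<_ _≤_
  field
    heytingField : HeytingField 0ℓ 0ℓ 0ℓ

  open HeytingField heytingField public

  field
    _<_                  : Rel Carrier 0ℓ
    isStrictPartialOrder : IsStrictPartialOrder _≈_ _<_
    #⇔<⊎>                : ∀ {x y} → x # y ⇔ (x < y ⊎ y < x)
    +-monoˡ-<            : ∀ z {x y} → x < y → x + z < y + z
    *-pos                : ∀ {x y} → 0# < x → 0# < y → 0# < x * y

  open HeytingCommutativeRing heytingCommutativeRing public using (commutativeRing)
  open CommutativeRing commutativeRing public using (+-rawMonoid)

  _≤_ : Rel Carrier 0ℓ
  x ≤ y = ¬ (y < x)

  fromℕ : ℕ → Carrier
  fromℕ n = RawMonoid._×_ +-rawMonoid n 1#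

  -- ∣ x - y ∣ < ε
  Within : Carrier → Rel Carrier 0ℓ
  Within ε x y = (x < y + ε) × (y < x + ε)

  field
    archimedean : ∀ x → ∃[ n ] x < fromℕ n
    complete    :
      (f : ℕ → Carrier) →
      (∀ ε → 0# < ε → ∃[ N ] ∀ i j → N ℕ.≤ i → N ℕ.≤ j → Within ε (f i) (f j)) →
      ∃[ l ] ∀ ε → 0# < ε → ∃[ N ] ∀ i → N ℕ.≤ i → Within ε (f i) l

  fromℤ : ℤ → Carrier
  fromℤ (+ n)    = fromℕ n
  fromℤ -[1+ n ] = - fromℕ (suc n)

-- Formal power series over ℤ, as coefficient sequences.

PowerSeries : Set
PowerSeries = ℕ → ℤ

infixl 7 _⊛_
_⊛_ : PowerSeries → PowerSeries → PowerSeries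
(f ⊛ g) k = RawMonoid.sum ℤ.+-0-rawMonoid {suc k} λ i → f (toℕ i) ℤ.* g (k ∸ toℕ i)

one : PowerSeries
one zero    = + 1
one (suc _) = + 0

1-t : PowerSeries
1-t zero          = + 1
1-t (suc zero)    = -[1+ 0 ]
1-t (suc (suc _)) = + 0

infixr 8 _^ˢ_
_^ˢ_ : PowerSeries → ℕ → PowerSeries
f ^ˢ zero  = one
f ^ˢ suc k = f ⊛ (f ^ˢ k)

IsPolynomialOfDegree : PowerSeries → ℕ → Set
IsPolynomialOfDegree h d = h d ≢ + 0 × (∀ i → d ℕ.< i → h i ≡ + 0)

HasCardinality : {A : Set} → Pred A 0ℓ → ℕ → Set
HasCardinality {A} S k =
  ∃[ xs ] Unique {A = A} xs × (∀ x → x ∈ xs ⇔ S x) × length xs ≡ k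

module Polytopes (ℝ : RealNumbers) where

  open RealNumbers ℝ
  open VecEq setoid using (_≋_; ≋-setoid) public

  sum : ∀ {n} → Vector Carrier n → Carrier
  sum = RawMonoid.sum +-rawMonoid

  -- ℝⁿ; equality of points is _≋_.
  Point : ℕ → Set
  Point n = Vector Carrier n

  Subset : ℕ → Set₁
  Subset n = Pred (Point n) 0ℓ

  ι : ∀ {n} → Vec ℤ n → Point n
  ι v j = fromℤ (lookup v j)

  Lattice : ∀ n → Subset n
  Lattice n x = ∃[ v ] x ≋ ι {n} v

  combination : ∀ {k n} → Vector Carrier k → (Fin k → Point n) → Point n
  combination c p j = sum λ i → c i * p i j

  aff : ∀ {n} → Subset n → Subset n
  aff {n} S x = ∃[ k ] Σ (Vector Carrier k) λ c → Σ (Fin k → Point n) λ p →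
    (∀ i → S (p i)) × sum c ≈ 1# × x ≋ combination c p

  conv : ∀ {n} → Subset n → Subset n
  conv {n} S x = ∃[ k ] Σ (Vector Carrier k) λ c → Σ (Fin k → Point n) λ p →
    (∀ i → S (p i)) × (∀ i → 0# ≤ c i) × sum c ≈ 1# × x ≋ combination c p

  IsLatticePolytope : ∀ {n} → Subset n → Set
  IsLatticePolytope {n} P = Σ (List⁺ (Vec ℤ n)) λ V →
    P ≐ conv (λ x → ∃[ v ] v ∈ toList V × x ≋ ι v)

  IsFullDimensional : ∀ {n} → Subset n → Set
  IsFullDimensional P = ∀ x → aff P x

  dilate : ∀ {n} → ℕ → Subset n → Subset n
  dilate m P y = ∃[ x ] P x × y ≋ (λ j → fromℕ m * x j)

  IsEhrhartFunction : ∀ {n} → Subset n → (ℕ → ℕ) → Set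
  IsEhrhartFunction P L = ∀ m → HasCardinality (λ v → dilate m P (ι v)) (L m)

  -- For full-dimensional P ⊂ ℝⁿ:  Σ L(m) tᵐ = h(t) / (1-t)ⁿ⁺¹, with the
  -- denominator cleared.
  IsHStar : ∀ {n} → Subset n → PowerSeries → Set
  IsHStar {n} P h = ∃[ L ] IsEhrhartFunction P L ×
    (∀ k → ((1-t ^ˢ suc n) ⊛ (+_ ∘ L)) k ≡ h k)

  record IsGorensteinOfDegree {n} (P : Subset n) (d : ℕ) : Set where
    field
      h*        : PowerSeries
      isHStar   : IsHStar P h*
      degree    : IsPolynomialOfDegree h* d
      symmetric : ∀ i → i ℕ.≤ d → h* i ≡ h* (d ∸ i)

  -- 0 , e₁ , … , eₛ
  vertex : ∀ {s} → Fin (suc s) → Point s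
  vertex zero    j = 0#
  vertex (suc i) j = if does (i ≟ j) then 1# else 0#

  -- ℝ^q × ℝ^s is identified with ℝ^(q + s) by concatenating coordinates.
  CayleySum : ∀ {q s} → (Fin (suc s) → Subset q) → Subset (q ℕ.+ s)
  CayleySum P = conv λ y → ∃₂ λ i x → P i x × y ≋ (x ++ vertex i)

  record AffineIsomorphism (m n : ℕ) : Set where
    field
      inverse : Inverse (≋-setoid m) (≋-setoid n)

    open Inverse inverse public using (to; from)

    field
      affine : ∀ {k} (c : Vector Carrier k) (p : Fin k → Point m) → sum c ≈ 1# →
               to (combination c p) ≋ combination c (to ∘ p)

    image : Subset m → Subset n
    image S y = ∃[ x ] S x × y ≋ to x

  record DecomposesAsCayleySum {n} (P : Subset n) (q : ℕ) : Set₁ where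
    field
      s                   : ℕ
      summand             : Fin (suc s) → Subset q
      isLatticePolytope   : ∀ i → IsLatticePolytope (summand i)
      φ                   : AffineIsomorphism n (q ℕ.+ s)

    open AffineIsomorphism φ using (image)

    field
      lattice-onto : image (Lattice n) ≐ Lattice (q ℕ.+ s)
      cayley       : image P ≐ CayleySum summand

module Submission where

-- Over the cone C of P, with N = n + 1 and facet normals f, Gorenstein symmetry is turned into a lattice point û of height
-- r = N − d in the interior such that every interior lattice point lies in û + C. The needed Ehrhart reciprocity is
-- proved without a triangulation: if all f are positive at a common point, then ∏ [f < 0] and (−1)ᴺ ∏ [f ≥ 0] agree up to
-- functions killed by products of operators 1 − tᵃ. For fewer than N functionals both products are invariant under a
-- translation; for N of them expand [f < 0] = 1 − [f ≥ 0]; for more, a linear dependency makes a mixed product vanish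
-- and so expresses the full product through products with fewer functionals. Summing over heights removes
-- the ambiguity and counts the interior points, hence û, and û has lattice distance 1 from all facets.
--
-- By Carathéodory the height functional is h = Σ λᵢ gᵢ with λᵢ > 0 and at most N primitive facet normals gᵢ. Put φ = Σ {λᵢ} gᵢ.
-- The functional Σ gᵢ − φ is integral and positive on P, so it is at least h there, and evaluating at û gives
-- φ(û) ≤ N − r = d. Thus h is a sum of Σ ⌊λᵢ⌋ = r − φ(û) ≥ n + 1 − 2d facet normals, and of φ if φ ≠ 0. These
-- functionals take only the values 0 and 1 on the vertices and extend to a lattice basis: they are Cayley coordinates.

open import Data.Nat.Base as ℕ using (ℕ; zero; suc; s≤s; z≤n; _∸_)
import Data.Nat.Properties as ℕ
import Data.Nat.DivMod as ℕ
open import Data.Integer.Base as ℤ using (ℤ; +_; -[1+_]; +[1+_]; +0; 0ℤ; 1ℤ; +≤+; +<+; -<+; -≤+)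
import Data.Integer.Properties as ℤ
open import Data.Integer.Tactic.RingSolver using (solve-∀)
open import Data.Fin.Base as Fin using (Fin; toℕ; _↑ˡ_; _↑ʳ_; splitAt)
import Data.Fin.Properties as Fin
open import Data.Vec.Base as Vec using (Vec; []; _∷_; lookup; tabulate)
import Data.Vec.Properties as Vec
open import Data.List.Base as List using (List; []; _∷_; _++_; length; filter)
import Data.List.Properties as List
open import Data.List.NonEmpty.Base as List⁺ using (List⁺; _∷_; toList)
open import Data.List.Relation.Unary.All as All using (All; []; _∷_)
import Data.List.Relation.Unary.All.Properties as All
open import Data.List.Relation.Unary.Any using (here; there)
open import Data.List.Relation.Unary.Unique.Propositional using (Unique; []; _∷_)
import Data.List.Relation.Unary.Unique.Propositional.Properties as Unique
open import Data.List.Membership.Propositional using (_∈_)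
open import Data.List.Membership.Propositional.Properties
  using (∈-++⁺ˡ; ∈-++⁺ʳ; ∈-++⁻; ∈-map⁺; ∈-map⁻; ∈-filter⁺; ∈-filter⁻; ∈-deduplicate⁺; ∈-lookup)
open import Data.Product.Base using (_×_; _,_; proj₁; proj₂; ∃-syntax)
open import Data.Sum.Base using (_⊎_; inj₁; inj₂; [_,_]′)
open import Data.Empty using (⊥; ⊥-elim)
open import Function.Base using (_∘_)
open import Function.Bundles using (Equivalence; mk⇔)
open import Relation.Binary.PropositionalEquality as ≡ using (_≡_; _≢_; refl)
open import Relation.Nullary using (Dec; ¬_; yes; no)

-- A function on the lattice is handled as a formal series on which tᵃ acts by translation. Working
-- modulo functions killed by some ∏ (1 - tᵃ), a ≠ 0, gives a translation-invariant function the
-- value 0, as the theory of rational generating functions does, without ever forming a fraction.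
-- The ambiguity is harmless on heights: after multiplication by (1 - t)ᴺ both sides of reciprocity
-- vanish at large exponents, and a sequence that vanishes there and is killed by such a product is
-- zero.
--
-- All combinatorics takes place over ℤ, where signs are decidable. Order and equality of reals are
-- not, so real points enter only to identify the dilates of P with slices of an integral cone, and
-- to carry out the final change of coordinates.
--
-- The bound arises as follows: s + 1 Cayley coordinates leave q = n - s. If φ ≠ 0, then s = r -
-- φ(û), hence q = d + φ(û) - 1 ≤ 2d - 1; if φ = 0, then s + 1 = r and q = d.

module LatticeCones where

  open import Defs using (PowerSeries; HasCardinality; IsPolynomialOfDegree; _⊛_; 1-t; _^ˢ_; one)
  import Algebra.Definitions.RawMonoid as RawMonoid
  open import Data.Bool.Base using (Bool; true; false; not)
  open import Data.Integer.Base using (_+_; _*_; _-_; -_; _≤_; _<_; ∣_∣)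
  open import Data.Integer.DivMod using (_/_; _%_; a≡a%n+[a/n]*n; n%d<d; a≡a%ℕn+[a/ℕn]*n)
  open import Data.List.Base using (deduplicate)
  import Data.List.Membership.DecPropositional as DecMembership
  import Data.List.Relation.Unary.Unique.DecPropositional.Properties as Dedup
  open import Data.Vec.Base using (zipWith; map; replicate; head; tail)
  open import Relation.Binary.Definitions using (tri<; tri≈; tri>)
  open import Relation.Binary.PropositionalEquality using (sym; trans; cong; cong₂; subst; subst₂)

  -- Integer vectors

  _<⊎≤_ : ∀ a b → a < b ⊎ b ≤ a
  a <⊎≤ b with a ℤ.<? b
  ... | yes p = inj₁ p
  ... | no p = inj₂ (ℤ.≮⇒≥ p)

  0≤+ : ∀ {a b} → 0ℤ ≤ a → 0ℤ ≤ b → 0ℤ ≤ a + b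
  0≤+ p q = ℤ.+-mono-≤ p q

  0<+ˡ : ∀ {a b} → 0ℤ < a → 0ℤ ≤ b → 0ℤ < a + b
  0<+ˡ p q = ℤ.+-mono-<-≤ p q

  0<+ʳ : ∀ {a b} → 0ℤ ≤ a → 0ℤ < b → 0ℤ < a + b
  0<+ʳ p q = ℤ.+-mono-≤-< p q

  0≤* : ∀ {a b} → 0ℤ ≤ a → 0ℤ ≤ b → 0ℤ ≤ a * b
  0≤* {+ a} {+ b} _ _ = subst (0ℤ ≤_) (ℤ.pos-* a b) (+≤+ z≤n)

  0<* : ∀ {a b} → 0ℤ < a → 0ℤ < b → 0ℤ < a * b
  0<* {+[1+ a ]} {+[1+ b ]} _ _ = +<+ (s≤s z≤n)
  0<* {+ 0} (+<+ ()) _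
  0<* {+[1+ a ]} {+ 0} _ (+<+ ())

  0≤-cancel : ∀ {a b} → 0ℤ < a → 0ℤ ≤ a * b → 0ℤ ≤ b
  0≤-cancel {a} {b} p q with b <⊎≤ 0ℤ
  ... | inj₂ r = r
  ... | inj₁ b<0 = ⊥-elim (ℤ.<⇒≱ (0<* p (ℤ.neg-mono-< b<0)) (subst (_≤ 0ℤ) (lem a b) (ℤ.neg-mono-≤ q)))
    where
    lem : ∀ a b → - (a * b) ≡ a * - b
    lem = solve-∀

  0<-cancel : ∀ {a b} → 0ℤ < a → 0ℤ < a * b → 0ℤ < b
  0<-cancel {a} {b} p q with 0ℤ <⊎≤ b
  ... | inj₁ r = r
  ... | inj₂ b≤0 = ⊥-elim (ℤ.<⇒≱ q (subst (_≤ 0ℤ) (lem a b) (ℤ.neg-mono-≤ (0≤* (ℤ.<⇒≤ p) (ℤ.neg-mono-≤ b≤0)))))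
    where
    lem : ∀ a b → - (a * - b) ≡ a * b
    lem = solve-∀

  0<1 : 0ℤ < 1ℤ
  0<1 = +<+ (s≤s z≤n)

  ≤∣∣ : ∀ z → z ≤ + ℤ.∣ z ∣
  ≤∣∣ (+ k) = ℤ.≤-refl
  ≤∣∣ -[1+ k ] = ℤ.-≤+

  zero-combination : ∀ c d → c * 0ℤ + d * 0ℤ ≡ 0ℤ
  zero-combination = solve-∀

  minus-combination : ∀ a b → a - b ≡ 1ℤ * a + - 1ℤ * b
  minus-combination = solve-∀

  infixl 6 _⊕_ _⊖_
  infixr 7 _⊙_
  infix 9 _∙_

  _⊕_ _⊖_ : ∀ {n} → Vec ℤ n → Vec ℤ n → Vec ℤ n
  _⊕_ = zipWith _+_
  _⊖_ = zipWith _-_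

  _⊙_ : ∀ {n} → ℤ → Vec ℤ n → Vec ℤ n
  c ⊙ v = map (c *_) v

  𝟎 : ∀ {n} → Vec ℤ n
  𝟎 = replicate _ 0ℤ

  ⊟_ : ∀ {n} → Vec ℤ n → Vec ℤ n
  ⊟_ = map (λ a → - a)

  _∙_ : ∀ {n} → Vec ℤ n → Vec ℤ n → ℤ
  [] ∙ [] = 0ℤ
  (a ∷ f) ∙ (b ∷ x) = a * b + f ∙ x

  +-congˡ : ∀ a {b c : ℤ} → b ≡ c → a + b ≡ a + c
  +-congˡ a refl = refl

  ∙-comm : ∀ {n} (f x : Vec ℤ n) → f ∙ x ≡ x ∙ f
  ∙-comm [] [] = refl
  ∙-comm (a ∷ f) (b ∷ x) = cong₂ _+_ (ℤ.*-comm a b) (∙-comm f x)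

  ∙-⊕ : ∀ {n} (f x y : Vec ℤ n) → f ∙ (x ⊕ y) ≡ f ∙ x + f ∙ y
  ∙-⊕ [] [] [] = refl
  ∙-⊕ (a ∷ f) (b ∷ x) (c ∷ y) = trans (+-congˡ (a * (b + c)) (∙-⊕ f x y)) (lem a b c (f ∙ x) (f ∙ y))
    where
    lem : ∀ a b c p q → a * (b + c) + (p + q) ≡ (a * b + p) + (a * c + q)
    lem = solve-∀

  ∙-⊖ : ∀ {n} (f x y : Vec ℤ n) → f ∙ (x ⊖ y) ≡ f ∙ x - f ∙ y
  ∙-⊖ [] [] [] = refl
  ∙-⊖ (a ∷ f) (b ∷ x) (c ∷ y) = trans (+-congˡ (a * (b - c)) (∙-⊖ f x y)) (lem a b c (f ∙ x) (f ∙ y))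
    where
    lem : ∀ a b c p q → a * (b - c) + (p - q) ≡ (a * b + p) - (a * c + q)
    lem = solve-∀

  ∙-⊙ : ∀ {n} (f : Vec ℤ n) c x → f ∙ (c ⊙ x) ≡ c * (f ∙ x)
  ∙-⊙ [] c [] = sym (ℤ.*-zeroʳ c)
  ∙-⊙ (a ∷ f) c (b ∷ x) = trans (+-congˡ (a * (c * b)) (∙-⊙ f c x)) (lem a b c (f ∙ x))
    where
    lem : ∀ a b c p → a * (c * b) + c * p ≡ c * (a * b + p)
    lem = solve-∀

  ∙-⊟ : ∀ {n} (f x : Vec ℤ n) → f ∙ (⊟ x) ≡ - (f ∙ x)
  ∙-⊟ [] [] = refl
  ∙-⊟ (a ∷ f) (b ∷ x) = trans (+-congˡ (a * - b) (∙-⊟ f x)) (lem a b (f ∙ x))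
    where
    lem : ∀ a b p → a * - b + - p ≡ - (a * b + p)
    lem = solve-∀

  ∙-𝟎 : ∀ {n} (f : Vec ℤ n) → f ∙ 𝟎 ≡ 0ℤ
  ∙-𝟎 [] = refl
  ∙-𝟎 (a ∷ f) = trans (cong₂ _+_ (ℤ.*-zeroʳ a) (∙-𝟎 f)) refl

  ⊕-∙ : ∀ {n} (x y f : Vec ℤ n) → (x ⊕ y) ∙ f ≡ x ∙ f + y ∙ f
  ⊕-∙ x y f = trans (∙-comm (x ⊕ y) f) (trans (∙-⊕ f x y) (cong₂ _+_ (∙-comm f x) (∙-comm f y)))

  ⊖-∙ : ∀ {n} (x y f : Vec ℤ n) → (x ⊖ y) ∙ f ≡ x ∙ f - y ∙ f
  ⊖-∙ x y f = trans (∙-comm (x ⊖ y) f) (trans (∙-⊖ f x y) (cong₂ _-_ (∙-comm f x) (∙-comm f y)))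

  ⊙-∙ : ∀ {n} c (x f : Vec ℤ n) → (c ⊙ x) ∙ f ≡ c * (x ∙ f)
  ⊙-∙ c x f = trans (∙-comm (c ⊙ x) f) (trans (∙-⊙ f c x) (cong (c *_) (∙-comm f x)))

  𝟎-∙ : ∀ {n} (f : Vec ℤ n) → 𝟎 ∙ f ≡ 0ℤ
  𝟎-∙ f = trans (∙-comm 𝟎 f) (∙-𝟎 f)

  ⊖-⊕ : ∀ {n} (x a : Vec ℤ n) → x ⊖ a ⊕ a ≡ x
  ⊖-⊕ [] [] = refl
  ⊖-⊕ (x ∷ xs) (a ∷ as) = cong₂ _∷_ (lem x a) (⊖-⊕ xs as)
    where
    lem : ∀ x a → x - a + a ≡ x
    lem = solve-∀

  ⊕-⊖ : ∀ {n} (x a : Vec ℤ n) → x ⊕ a ⊖ a ≡ x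
  ⊕-⊖ [] [] = refl
  ⊕-⊖ (x ∷ xs) (a ∷ as) = cong₂ _∷_ (lem x a) (⊕-⊖ xs as)
    where
    lem : ∀ x a → x + a - a ≡ x
    lem = solve-∀

  -- Rational cones and their half-spaces

  -- The rational cone, one generator at a time: x is in the cone of v ∷ V when some K x − c v is in the cone of V.
  InCone : ∀ {n} → List (Vec ℤ n) → Vec ℤ n → Set
  InCone [] x = x ≡ 𝟎
  InCone (v ∷ V) x = ∃[ K ] ∃[ c ] 0ℤ < K × 0ℤ ≤ c × InCone V (K ⊙ x ⊖ c ⊙ v)

  Nonneg : ∀ {n} → List (Vec ℤ n) → Vec ℤ n → Set
  Nonneg F x = All (λ f → 0ℤ ≤ f ∙ x) F

  ∙-comb : ∀ {n} (f : Vec ℤ n) K x c v → f ∙ (K ⊙ x ⊖ c ⊙ v) ≡ K * (f ∙ x) - c * (f ∙ v)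
  ∙-comb f K x c v = trans (∙-⊖ f (K ⊙ x) (c ⊙ v)) (cong₂ _-_ (∙-⊙ f K x) (∙-⊙ f c v))

  InCone-nonneg : ∀ {n} (V : List (Vec ℤ n)) {x} f → All (λ v → 0ℤ ≤ f ∙ v) V → InCone V x → 0ℤ ≤ f ∙ x
  InCone-nonneg [] f [] refl = ℤ.≤-reflexive (sym (∙-𝟎 f))
  InCone-nonneg (v ∷ V) {x} f (p ∷ ps) (K , c , K>0 , c≥0 , r) =
    0≤-cancel K>0 (subst (0ℤ ≤_) (lem _ _) (0≤+ (subst (0ℤ ≤_) (∙-comb f K x c v) (InCone-nonneg V f ps r)) (0≤* c≥0 p)))
    where
    lem : ∀ a b → a - b + b ≡ a
    lem = solve-∀

  -- The half-spaces of the zero cone, the base case of `weyl`: each coordinate is bounded by 0 from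
  -- both sides.
  units : ∀ n → List (Vec ℤ n)
  units zero = []
  units (suc n) = (1ℤ ∷ 𝟎) ∷ (- 1ℤ ∷ 𝟎) ∷ List.map (0ℤ ∷_) (units n)

  units-separate : ∀ {n} (x : Vec ℤ n) → Nonneg (units n) x → x ≡ 𝟎
  units-separate [] _ = refl
  units-separate (a ∷ x) (p ∷ q ∷ r) = cong₂ _∷_ a≡0 (units-separate x (All.map
    (λ {f} → subst (0ℤ ≤_) (trans (cong (_+ f ∙ x) (ℤ.*-zeroˡ a)) (ℤ.+-identityˡ _))) (All.map⁻ r)))
    where
    e1 : 1ℤ * a + 𝟎 ∙ x ≡ a
    e1 = trans (cong₂ _+_ (ℤ.*-identityˡ a) (𝟎-∙ x)) (ℤ.+-identityʳ a)
    e2 : - 1ℤ * a + 𝟎 ∙ x ≡ - a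
    e2 = trans (cong₂ _+_ (ℤ.-1*i≡-i a) (𝟎-∙ x)) (ℤ.+-identityʳ (- a))
    a≡0 : a ≡ 0ℤ
    a≡0 = ℤ.≤-antisym (subst (_≤ 0ℤ) (ℤ.neg-involutive a) (ℤ.neg-mono-≤ (subst (0ℤ ≤_) e2 q))) (subst (0ℤ ≤_) e1 p)

  split : ∀ {n} (v : Vec ℤ n) (F : List (Vec ℤ n)) → ∃[ P ] ∃[ M ]
    All (λ f → 0ℤ ≤ f ∙ v) P × All (λ f → f ∙ v < 0ℤ) M × All (_∈ F) P × All (_∈ F) M × (∀ {f} → f ∈ F → f ∈ P ⊎ f ∈ M)
  split v [] = [] , [] , [] , [] , [] , [] , λ ()
  split v (f ∷ F) with split v F | (f ∙ v) <⊎≤ 0ℤ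
  ... | P , M , p , m , a , b , h | inj₁ q = P , f ∷ M , p , q ∷ m , All.map there a , here refl ∷ All.map there b ,
    λ { (here refl) → inj₂ (here refl) ; (there i) → [ (λ z → inj₁ z) , (λ z → inj₂ (there z)) ]′ (h i) }
  ... | P , M , p , m , a , b , h | inj₂ q = f ∷ P , M , q ∷ p , m , here refl ∷ All.map there a , All.map there b ,
    λ { (here refl) → inj₁ (here refl) ; (there i) → [ (λ z → inj₁ (there z)) , (λ z → inj₂ z) ]′ (h i) }

  -- The Fourier-Motzkin combination: when f ∙ v ≥ 0 > g ∙ v, both coefficients are nonnegative and
  -- the result vanishes at `v`.
  pairing : ∀ {n} → Vec ℤ n → Vec ℤ n → Vec ℤ n → Vec ℤ n
  pairing v f g = (- (g ∙ v)) ⊙ f ⊕ (f ∙ v) ⊙ g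

  ∙-pairing : ∀ {n} (v f g x : Vec ℤ n) → pairing v f g ∙ x ≡ - (g ∙ v) * (f ∙ x) + f ∙ v * (g ∙ x)
  ∙-pairing v f g x = trans (⊕-∙ (- (g ∙ v) ⊙ f) (f ∙ v ⊙ g) x) (cong₂ _+_ (⊙-∙ (- (g ∙ v)) f x) (⊙-∙ (f ∙ v) g x))

  -- The multiple of v to subtract is the largest lower bound g(y)/g(v) found so far.
  eliminate : ∀ {n} (v y : Vec ℤ n) (P M : List (Vec ℤ n)) → All (λ f → 0ℤ ≤ f ∙ v) P → All (λ g → g ∙ v < 0ℤ) M →
    Nonneg P y → All (λ g → All (λ f → 0ℤ ≤ pairing v f g ∙ y) P) M →
    ∃[ K ] ∃[ c ] 0ℤ < K × 0ℤ ≤ c × Nonneg P (K ⊙ y ⊖ c ⊙ v) × Nonneg M (K ⊙ y ⊖ c ⊙ v)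
  eliminate v y P [] p m a b = 1ℤ , 0ℤ , 0<1 , ℤ.≤-refl , All.map (λ {f} → subst (0ℤ ≤_)
    (sym (trans (∙-comb f 1ℤ y 0ℤ v) (lem (f ∙ y) (f ∙ v))))) a , []
    where
    lem : ∀ a b → 1ℤ * a - 0ℤ * b ≡ a
    lem = solve-∀
  eliminate v y P (g ∷ M) p (gv<0 ∷ m) a (b ∷ bs) with eliminate v y P M p m a bs
  ... | K , c , K>0 , c≥0 , rP , rM with (g ∙ (K ⊙ y ⊖ c ⊙ v)) <⊎≤ 0ℤ
  ... | inj₂ q = K , c , K>0 , c≥0 , rP , q ∷ rM
  -- The ratio c / K is too small for `g` and is raised to (g ∙ y) / (g ∙ v), where `g` vanishes.
  -- This only helps the other members of `M`, which are negative at `v`; those of `P` stay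
  -- nonnegative because their pairings with `g` are nonnegative at `y`.
  ... | inj₁ q = - (g ∙ v) , - (g ∙ y) , ℤ.neg-mono-< gv<0 , gy≤0 ,
      All.map (λ {f} → subst (0ℤ ≤_) (trans (∙-pairing v f g y) (trans (lem1 (g ∙ v) (f ∙ y) (f ∙ v) (g ∙ y))
        (sym (∙-comb f (- (g ∙ v)) y (- (g ∙ y)) v))))) b ,
      ℤ.≤-reflexive (sym (trans (∙-comb g (- (g ∙ v)) y (- (g ∙ y)) v) (lem2 (g ∙ v) (g ∙ y)))) ∷ All.zipWith
        (λ {f} → λ { (fv<0 , s) → step f fv<0 s }) (m , rM)
    where
    lem1 : ∀ gv fy fv gy → - gv * fy + fv * gy ≡ - gv * fy - - gy * fv
    lem1 = solve-∀
    lem2 : ∀ gv gy → - gv * gy - - gy * gv ≡ 0ℤ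
    lem2 = solve-∀
    lem3 : ∀ K c gy gv fy fv → - gv * (K * fy - c * fv) + (- (K * gy - c * gv)) * (- fv) ≡ K * (- gv * fy - - gy * fv)
    lem3 = solve-∀
    lem6 : ∀ K c gy gv → - (K * gy - c * gv) + c * - gv ≡ K * - gy
    lem6 = solve-∀
    q' = subst (_< 0ℤ) (∙-comb g K y c v) q
    gy≤0 : 0ℤ ≤ - (g ∙ y)
    gy≤0 = 0≤-cancel K>0 (subst (0ℤ ≤_) (lem6 K c (g ∙ y) (g ∙ v)) (0≤+ (ℤ.neg-mono-≤ (ℤ.<⇒≤ q')) (0≤* c≥0 (ℤ.neg-mono-≤ (ℤ.<⇒≤ gv<0)))))
    step : ∀ f → f ∙ v < 0ℤ → 0ℤ ≤ f ∙ (K ⊙ y ⊖ c ⊙ v) → 0ℤ ≤ f ∙ (- (g ∙ v) ⊙ y ⊖ - (g ∙ y) ⊙ v)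
    step f fv<0 s = subst (0ℤ ≤_) (sym (∙-comb f (- (g ∙ v)) y (- (g ∙ y)) v))
      (0≤-cancel K>0 (subst (0ℤ ≤_) (lem3 K c (g ∙ y) (g ∙ v) (f ∙ y) (f ∙ v))
      (0≤+ (0≤* (ℤ.neg-mono-≤ (ℤ.<⇒≤ gv<0)) (subst (0ℤ ≤_) (∙-comb f K y c v) s))
        (0≤* (ℤ.neg-mono-≤ (ℤ.<⇒≤ q')) (ℤ.neg-mono-≤ (ℤ.<⇒≤ fv<0))))))

  record HalfSpaces {n} (V : List (Vec ℤ n)) : Set where
    field
      facets : List (Vec ℤ n)
      nonneg : All (λ f → All (λ v → 0ℤ ≤ f ∙ v) V) facets
      complete : ∀ {x} → Nonneg facets x → InCone V x

    sound : ∀ {x} → InCone V x → Nonneg facets x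
    sound r = All.map (λ {f} p → InCone-nonneg V f p r) nonneg

  -- Fourier–Motzkin elimination of the coefficient of v.
  weyl : ∀ {n} (V : List (Vec ℤ n)) → HalfSpaces V
  weyl {n} [] = record { facets = units n ; nonneg = All.tabulate (λ _ → []) ; complete = units-separate _ }
  weyl {n} (v ∷ V) with weyl V
  ... | record { facets = F ; nonneg = nn ; complete = cmp } with split v F
  ... | P , M , p , m , P⊆ , M⊆ , cover = record
    { facets = P ++ List.concat (List.map (λ g → List.map (λ f → pairing v f g) P) M)
    ; nonneg = All.++⁺ (All.zipWith (λ { (a , b) → a ∷ All.lookup nn b }) (p , P⊆))
        (All.concat⁺ (All.map⁺ (All.zipWith (λ {g} → λ { (gv<0 , g∈) → All.map⁺ (All.zipWith (λ {f} → λ { (fv≥0 , f∈) →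
           ℤ.≤-reflexive (sym (trans (∙-pairing v f g v) (lem (g ∙ v) (f ∙ v)))) ∷
           All.zipWith (λ {w} → λ { (a , b) → subst (0ℤ ≤_) (sym (∙-pairing v f g w))
             (0≤+ (0≤* (ℤ.neg-mono-≤ (ℤ.<⇒≤ gv<0)) a) (0≤* fv≥0 b)) })
             (All.lookup nn f∈ , All.lookup nn g∈) }) (p , P⊆)) }) (m , M⊆))))
    ; complete = λ {x} r → let rP , rM = All.++⁻ P r
                               K , c , K>0 , c≥0 , sP , sM = eliminate v x P M p m rP (All.map All.map⁻ (All.map⁻ (All.concat⁻ rM)))
                           in K , c , K>0 , c≥0 , cmp (All.tabulate λ i → [ All.lookup sP , All.lookup sM ]′ (cover i)) }
    where
    lem : ∀ a b → - a * b + b * a ≡ 0ℤ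
    lem = solve-∀

  infix 4 _≼_
  _≼_ : ∀ {n} → List (Vec ℤ n) → List (Vec ℤ n) → Set
  F ≼ G = ∀ {x} → Nonneg F x → Nonneg G x

  nonneg? : ∀ {n} (F : List (Vec ℤ n)) x → Nonneg F x ⊎ ∃[ f ] f ∈ F × f ∙ x < 0ℤ
  nonneg? [] x = inj₁ []
  nonneg? (f ∷ F) x with (f ∙ x) <⊎≤ 0ℤ | nonneg? F x
  ... | inj₁ p | _ = inj₂ (f , here refl , p)
  ... | inj₂ _ | inj₂ (g , i , q) = inj₂ (g , there i , q)
  ... | inj₂ p | inj₁ ps = inj₁ (p ∷ ps)

  nonneg-sym : ∀ {n} {F : List (Vec ℤ n)} {x} → All (λ f → 0ℤ ≤ x ∙ f) F → Nonneg F x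
  nonneg-sym {x = x} = All.map λ {f} → subst (0ℤ ≤_) (∙-comm x f)

  -- `weyl` is applied in the dual space: a half-space of the cone spanned by the functionals `G` is
  -- a point at which all of `G` is nonnegative, and `r` lies in that cone unless one of these
  -- points separates it.
  farkas : ∀ {n} (G : List (Vec ℤ n)) r → InCone G r ⊎ ∃[ y ] r ∙ y < 0ℤ × Nonneg G y
  farkas G r with nonneg? (HalfSpaces.facets (weyl G)) r
  ... | inj₁ p = inj₁ (HalfSpaces.complete (weyl G) p)
  ... | inj₂ (y , y∈ , q) = inj₂ (y , subst (_< 0ℤ) (∙-comm y r) q , nonneg-sym (All.lookup (HalfSpaces.nonneg (weyl G)) y∈))

  -- The point `y` violates `f` alone. A segment from it to an interior point meets the boundary of
  -- the cone inside the facet of `f`, which is how `facet` uses it.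
  Irredundant : ∀ {n} → List (Vec ℤ n) → List (Vec ℤ n) → Set
  Irredundant K F = All (λ f → ∃[ y ] f ∙ y < 0ℤ × All (λ g → g ≡ f ⊎ 0ℤ ≤ g ∙ y) F) K

  irredundant : ∀ {n} (F : List (Vec ℤ n)) → ∃[ K ] K ≼ F × All (_∈ F) K × Irredundant K K
  irredundant {n} F with go [] F []
    where
    -- The kept functionals `K` are irredundant within everything not yet discarded, so their
    -- witnesses survive each later removal. Farkas decides whether the next `r` is implied by the
    -- others.
    go : ∀ K R → Irredundant K (K ++ R) → ∃[ K' ] K' ≼ K ++ R × All (_∈ K ++ R) K' × Irredundant K' K'
    go K [] ir = K , (λ p → All.++⁺ p []) , All.tabulate ∈-++⁺ˡ , All.map (λ { (y , p , q) → y , p , All.++⁻ˡ K q }) ir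
    go K (r ∷ R) ir with farkas (K ++ R) r
    ... | inj₁ red with go K R (All.map (λ { (y , p , q) → y , p , All.++⁺ (All.++⁻ˡ K q) (All.tail (All.++⁻ʳ K q)) }) ir)
    ...   | K' , le , sub , ir' = K' , (λ {x} p → let s = le p in All.++⁺ (All.++⁻ˡ K s) (subst (0ℤ ≤_) (∙-comm x r) (InCone-nonneg (K ++ R) x (All.map (λ {f} → subst (0ℤ ≤_) (∙-comm f x)) s) red) ∷ All.++⁻ʳ K s))
            , All.map (λ i → widen i) sub , ir'
      where
      widen : ∀ {f} → f ∈ K ++ R → f ∈ K ++ r ∷ R
      widen i with ∈-++⁻ K i
      ... | inj₁ j = ∈-++⁺ˡ j
      ... | inj₂ j = ∈-++⁺ʳ K (there j)
    go K (r ∷ R) ir | inj₂ (y , neg , q)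
      with go (r ∷ K) R ((y , neg , inj₁ refl ∷ All.map inj₂ q) ∷ All.map
        (λ { (z , a , b) → z , a , All.head (All.++⁻ʳ K b) ∷ All.++⁺ (All.++⁻ˡ K b) (All.tail (All.++⁻ʳ K b)) }) ir)
    ... | K' , le , sub , ir' = K' , (λ p → let s = le p in All.++⁺ (All.++⁻ˡ K (All.tail s)) (All.head s ∷ All.++⁻ʳ K (All.tail s))) , All.map widen sub , ir'
      where
      widen : ∀ {f} → f ∈ r ∷ K ++ R → f ∈ K ++ r ∷ R
      widen (here refl) = ∈-++⁺ʳ K (here refl)
      widen (there i) with ∈-++⁻ K i
      ... | inj₁ j = ∈-++⁺ˡ j
      ... | inj₂ j = ∈-++⁺ʳ K (there j)
  ... | K , le , sub , ir = K , le , sub , ir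

  -- Linear dependencies

  ⊙-cancel-𝟎 : ∀ {n} {c} (x : Vec ℤ n) → c ≢ 0ℤ → c ⊙ x ≡ 𝟎 → x ≡ 𝟎
  ⊙-cancel-𝟎 [] c≢0 e = refl
  ⊙-cancel-𝟎 {c = c} (a ∷ x) c≢0 e = cong₂ _∷_ (step (ℤ.i*j≡0⇒i≡0∨j≡0 c (cong head e))) (⊙-cancel-𝟎 x c≢0 (cong tail e))
    where
    step : c ≡ 0ℤ ⊎ a ≡ 0ℤ → a ≡ 0ℤ
    step (inj₁ p) = ⊥-elim (c≢0 p)
    step (inj₂ p) = p

  pivot : ∀ {n} (fs : List (Vec ℤ (suc n))) → All (λ f → head f ≡ 0ℤ) fs ⊎
    ∃[ f ] ∃[ rest ] head f ≢ 0ℤ × length fs ≡ suc (length rest) × (∀ {g} → g ∈ fs → g ≡ f ⊎ g ∈ rest)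
  pivot [] = inj₁ []
  pivot (f ∷ fs) with head f ℤ.≟ 0ℤ
  ... | no f≢0 = inj₂ (f , fs , f≢0 , refl , λ { (here e) → inj₁ e ; (there i) → inj₂ i })
  ... | yes f≡0 with pivot fs
  ...   | inj₁ r = inj₁ (f≡0 ∷ r)
  ...   | inj₂ (g , rest , g≢0 , len , cov) = inj₂ (g , f ∷ rest , g≢0 , cong suc len ,
    λ { (here e) → inj₂ (here e) ; (there i) → [ inj₁ , inj₂ ∘ there ]′ (cov i) })

  ∙-head-tail : ∀ {n} (f : Vec ℤ (suc n)) b x → f ∙ (b ∷ x) ≡ head f * b + tail f ∙ x
  ∙-head-tail (a ∷ f) b x = refl

  -- Gaussian elimination without fractions: a pivot removes the first coordinate from the other
  -- functionals by cross multiplication, so equations and unknowns both drop by one. Without a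
  -- pivot the first unit vector is a solution.
  kernel : ∀ {n} (fs : List (Vec ℤ n)) → length fs ℕ.< n → ∃[ a ] a ≢ 𝟎 × All (λ f → f ∙ a ≡ 0ℤ) fs
  kernel {suc n} fs lt with pivot fs
  ... | inj₁ zeros = 1ℤ ∷ 𝟎 , (λ ()) , All.map (λ {f} p → trans (∙-head-tail f 1ℤ 𝟎)
    (trans (cong₂ (λ a b → a * 1ℤ + b) p (∙-𝟎 (tail f))) refl)) zeros
  ... | inj₂ (f , rest , f≢0 , len , cov)
    with kernel (List.map (λ g → head f ⊙ tail g ⊖ head g ⊙ tail f) rest)
           (subst (ℕ._< n) (sym (List.length-map _ rest)) (ℕ.s≤s⁻¹ (subst (ℕ._< suc n) len lt)))
  ... | a , a≢0 , k = - (tail f ∙ a) ∷ head f ⊙ a , (λ e → a≢0 (⊙-cancel-𝟎 a f≢0 (cong tail e))) , All.tabulate (λ {g} i → value g (cov i))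
    where
    lem1 : ∀ a p → a * - p + a * p ≡ 0ℤ
    lem1 = solve-∀
    lem2 : ∀ a b p q → b * - p + a * q ≡ a * q - b * p
    lem2 = solve-∀
    value : ∀ g → g ≡ f ⊎ g ∈ rest → g ∙ (- (tail f ∙ a) ∷ head f ⊙ a) ≡ 0ℤ
    value g c = trans (∙-head-tail g _ _) (trans (+-congˡ (head g * - (tail f ∙ a)) (∙-⊙ (tail g) (head f) a)) (go c))
      where
      go : g ≡ f ⊎ g ∈ rest → head g * - (tail f ∙ a) + head f * (tail g ∙ a) ≡ 0ℤ
      go (inj₁ refl) = lem1 (head g) (tail g ∙ a)
      go (inj₂ i) = trans (lem2 (head f) (head g) (tail f ∙ a) (tail g ∙ a))
        (trans (sym (trans (⊖-∙ (head f ⊙ tail g) (head g ⊙ tail f) a) (cong₂ _-_ (⊙-∙ (head f) (tail g) a) (⊙-∙ (head g) (tail f) a))))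
        (All.lookup (All.map⁻ k) i))

  sumBy : {A : Set} → (A → ℤ) → List A → ℤ
  sumBy p [] = 0ℤ
  sumBy p (a ∷ as) = p a + sumBy p as

  module _ {A : Set} where

    sumBy-cong : ∀ {p q : A → ℤ} as → All (λ a → p a ≡ q a) as → sumBy p as ≡ sumBy q as
    sumBy-cong [] [] = refl
    sumBy-cong (a ∷ as) (e ∷ es) = cong₂ _+_ e (sumBy-cong as es)

    sumBy-linear : ∀ c d (p q : A → ℤ) as → sumBy (λ a → c * p a + d * q a) as ≡ c * sumBy p as + d * sumBy q as
    sumBy-linear c d p q [] = lem c d
      where
      lem : ∀ c d → 0ℤ ≡ c * 0ℤ + d * 0ℤ
      lem = solve-∀
    sumBy-linear c d p q (a ∷ as) = trans (+-congˡ (c * p a + d * q a) (sumBy-linear c d p q as))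
      (lem c d (p a) (q a) (sumBy p as) (sumBy q as))
      where
      lem : ∀ c d p q s t → c * p + d * q + (c * s + d * t) ≡ c * (p + s) + d * (q + t)
      lem = solve-∀

    sumBy-scale : ∀ c (p : A → ℤ) as → sumBy (λ a → c * p a) as ≡ c * sumBy p as
    sumBy-scale c p [] = sym (ℤ.*-zeroʳ c)
    sumBy-scale c p (a ∷ as) = trans (+-congˡ (c * p a) (sumBy-scale c p as)) (sym (ℤ.*-distribˡ-+ c (p a) (sumBy p as)))

    sumBy-nonneg : ∀ {p : A → ℤ} {as} → All (λ a → 0ℤ ≤ p a) as → 0ℤ ≤ sumBy p as
    sumBy-nonneg [] = ℤ.≤-refl
    sumBy-nonneg (q ∷ qs) = 0≤+ q (sumBy-nonneg qs)

    sumBy-zero : ∀ {p : A → ℤ} as → All (λ a → p a ≡ 0ℤ) as → sumBy p as ≡ 0ℤ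
    sumBy-zero [] [] = refl
    sumBy-zero (a ∷ as) (e ∷ es) = cong₂ _+_ e (sumBy-zero as es)

    sumBy-nonneg-zero : ∀ {p : A → ℤ} {as} → All (λ a → 0ℤ ≤ p a) as → sumBy p as ≡ 0ℤ → All (λ a → p a ≡ 0ℤ) as
    sumBy-nonneg-zero [] e = []
    sumBy-nonneg-zero {p} {a ∷ as} (q ∷ qs) e = pa≡0 ∷ sumBy-nonneg-zero qs
      (trans (sym (trans (cong (_+ sumBy p as) pa≡0) (ℤ.+-identityˡ _))) e)
      where
      pa≡0 : p a ≡ 0ℤ
      pa≡0 with 0ℤ <⊎≤ p a
      ... | inj₁ lt = ⊥-elim (ℤ.<-irrefl (sym e) (0<+ˡ lt (sumBy-nonneg qs)))
      ... | inj₂ le = ℤ.≤-antisym le q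

  module _ {A : Set} where

    attach : (as : List A) → Vec ℤ (length as) → List (ℤ × A)
    attach [] [] = []
    attach (a ∷ as) (c ∷ cs) = (c , a) ∷ attach as cs

    attach-proj₂ : ∀ as cs → List.map proj₂ (attach as cs) ≡ as
    attach-proj₂ [] [] = refl
    attach-proj₂ (a ∷ as) (c ∷ cs) = cong (a ∷_) (attach-proj₂ as cs)

    attach-zero : ∀ as cs → All (λ w → proj₁ w ≡ 0ℤ) (attach as cs) → cs ≡ 𝟎
    attach-zero [] [] [] = refl
    attach-zero (a ∷ as) (c ∷ cs) (p ∷ ps) = cong₂ _∷_ p (attach-zero as cs ps)

    sumBy-map : ∀ {B : Set} (f : B → A) (p : A → ℤ) bs → sumBy p (List.map f bs) ≡ sumBy (p ∘ f) bs
    sumBy-map f p [] = refl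
    sumBy-map f p (b ∷ bs) = +-congˡ (p (f b)) (sumBy-map f p bs)

    values : (A → ℤ) → (as : List A) → Vec ℤ (length as)
    values p [] = []
    values p (a ∷ as) = p a ∷ values p as

    values-∙ : ∀ (p : A → ℤ) as cs → values p as ∙ cs ≡ sumBy (λ w → proj₁ w * p (proj₂ w)) (attach as cs)
    values-∙ p [] [] = refl
    values-∙ p (a ∷ as) (c ∷ cs) = cong₂ _+_ (ℤ.*-comm (p a) c) (values-∙ p as cs)

    rows : ∀ {n} (g : A → Vec ℤ n) (as : List A) → List (Vec ℤ (length as))
    rows {zero} g as = []
    rows {suc n} g as = values (head ∘ g) as ∷ rows (tail ∘ g) as

    length-rows : ∀ {n} (g : A → Vec ℤ n) as → length (rows g as) ≡ n
    length-rows {zero} g as = refl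
    length-rows {suc n} g as = cong suc (length-rows (tail ∘ g) as)

    rows-∙ : ∀ {n} (g : A → Vec ℤ n) as cs → All (λ r → r ∙ cs ≡ 0ℤ) (rows g as) → ∀ x → sumBy (λ w → proj₁ w * (g (proj₂ w) ∙ x))
      (attach as cs) ≡ 0ℤ
    rows-∙ {zero} g as cs _ [] = sumBy-zero (attach as cs) (All.tabulate λ {w} _ → trans (cong (proj₁ w *_) (∙-𝟎 (g (proj₂ w))))
      (ℤ.*-zeroʳ (proj₁ w)))
    rows-∙ {suc n} g as cs (e ∷ es) (b ∷ x) =
      trans (sumBy-cong {p = λ w → proj₁ w * (g (proj₂ w) ∙ (b ∷ x))} {q = λ w → b * (proj₁ w * head (g (proj₂ w))) + 1ℤ *
        (proj₁ w * (tail (g (proj₂ w)) ∙ x))} (attach as cs)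
        (All.tabulate λ {w} _ → trans (cong (proj₁ w *_) (∙-head-tail (g (proj₂ w)) b x))
          (lem (proj₁ w) b (head (g (proj₂ w))) (tail (g (proj₂ w)) ∙ x))))
      (trans (sumBy-linear b 1ℤ (λ w → proj₁ w * head (g (proj₂ w))) (λ w → proj₁ w * (tail (g (proj₂ w)) ∙ x)) (attach as cs))
      (trans (cong₂ (λ p q → b * p + 1ℤ * q) (trans (sym (values-∙ (head ∘ g) as cs)) e) (rows-∙ (tail ∘ g) as cs es x)) (lem2 b)))
      where
      lem : ∀ c b h t → c * (h * b + t) ≡ b * (c * h) + 1ℤ * (c * t)
      lem = solve-∀
      lem2 : ∀ b → b * 0ℤ + 1ℤ * 0ℤ ≡ 0ℤ
      lem2 = solve-∀

    -- The coefficients solve n homogeneous equations, one per coordinate, in more than n unknowns.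
    dependency : ∀ {n} (g : A → Vec ℤ n) (as : List A) → n ℕ.< length as →
      ∃[ ws ] List.map proj₂ ws ≡ as × ¬ All (λ w → proj₁ w ≡ 0ℤ) ws × (∀ x → sumBy (λ w → proj₁ w * (g (proj₂ w) ∙ x)) ws ≡ 0ℤ)
    dependency g as lt with kernel (rows g as) (subst (ℕ._< length as) (sym (length-rows g as)) lt)
    ... | cs , cs≢0 , k = attach as cs , attach-proj₂ as cs , cs≢0 ∘ attach-zero as cs , rows-∙ g as cs k

  -- Reciprocity for indicator functions of cones

  Δ : ∀ {n} → Vec ℤ n → (Vec ℤ n → ℤ) → Vec ℤ n → ℤ
  Δ a G x = G x - G (x ⊖ a)

  Δ* : ∀ {n} → List (Vec ℤ n) → (Vec ℤ n → ℤ) → Vec ℤ n → ℤ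
  Δ* [] G = G
  Δ* (a ∷ as) G = Δ a (Δ* as G)

  ⊖-swap : ∀ {n} (x a b : Vec ℤ n) → x ⊖ a ⊖ b ≡ x ⊖ b ⊖ a
  ⊖-swap [] [] [] = refl
  ⊖-swap (x ∷ xs) (a ∷ as) (b ∷ bs) = cong₂ _∷_ (lem x a b) (⊖-swap xs as bs)
    where
    lem : ∀ x a b → x - a - b ≡ x - b - a
    lem = solve-∀

  module _ {n : ℕ} where

    Δ*-cong : ∀ as {G H : Vec ℤ n → ℤ} → (∀ x → G x ≡ H x) → ∀ x → Δ* as G x ≡ Δ* as H x
    Δ*-cong [] e x = e x
    Δ*-cong (a ∷ as) e x = cong₂ _-_ (Δ*-cong as e x) (Δ*-cong as e (x ⊖ a))

    Δ*-zero : ∀ as {G : Vec ℤ n → ℤ} → (∀ x → G x ≡ 0ℤ) → ∀ x → Δ* as G x ≡ 0ℤ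
    Δ*-zero [] e x = e x
    Δ*-zero (a ∷ as) e x = cong₂ _-_ (Δ*-zero as e x) (Δ*-zero as e (x ⊖ a))

    Δ*-linear : ∀ as c d (G H : Vec ℤ n → ℤ) x → Δ* as (λ y → c * G y + d * H y) x ≡ c * Δ* as G x + d * Δ* as H x
    Δ*-linear [] c d G H x = refl
    Δ*-linear (a ∷ as) c d G H x = trans (cong₂ _-_ (Δ*-linear as c d G H x) (Δ*-linear as c d G H (x ⊖ a))) (lem c d _ _ _ _)
      where
      lem : ∀ c d p q r s → c * p + d * q - (c * r + d * s) ≡ c * (p - r) + d * (q - s)
      lem = solve-∀

    Δ*-Δ : ∀ as a (G : Vec ℤ n → ℤ) x → Δ* as (Δ a G) x ≡ Δ a (Δ* as G) x
    Δ*-Δ [] a G x = refl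
    Δ*-Δ (b ∷ as) a G x = trans (cong₂ _-_ (Δ*-Δ as a G x) (Δ*-Δ as a G (x ⊖ b)))
      (trans (lem (Δ* as G x) (Δ* as G (x ⊖ a)) (Δ* as G (x ⊖ b)) (Δ* as G (x ⊖ b ⊖ a)))
        (cong (λ z → Δ* as G x - Δ* as G (x ⊖ b) - (Δ* as G (x ⊖ a) - Δ* as G z)) (⊖-swap x b a)))
      where
      lem : ∀ p q r s → p - q - (r - s) ≡ p - r - (q - s)
      lem = solve-∀

    Δ*-comm : ∀ as bs (G : Vec ℤ n → ℤ) x → Δ* as (Δ* bs G) x ≡ Δ* bs (Δ* as G) x
    Δ*-comm [] bs G x = refl
    Δ*-comm (a ∷ as) bs G x = trans (cong₂ _-_ (Δ*-comm as bs G x) (Δ*-comm as bs G (x ⊖ a))) (sym (Δ*-Δ bs a (Δ* as G) x))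

    Δ*-++ : ∀ as bs (G : Vec ℤ n → ℤ) x → Δ* (as ++ bs) G x ≡ Δ* as (Δ* bs G) x
    Δ*-++ [] bs G x = refl
    Δ*-++ (a ∷ as) bs G x = cong₂ _-_ (Δ*-++ as bs G x) (Δ*-++ as bs G (x ⊖ a))

    -- Torsion in the module of functions over the group ring of ℤⁿ: killed by a product of (1 − tᵃ) with a ≠ 0.
    Torsion : (Vec ℤ n → ℤ) → Set
    Torsion G = ∃[ as ] All (_≢ 𝟎) as × ∀ x → Δ* as G x ≡ 0ℤ

    torsion-zero : ∀ {G : Vec ℤ n → ℤ} → (∀ x → G x ≡ 0ℤ) → Torsion G
    torsion-zero e = [] , [] , e

    torsion-combine : ∀ c d {G H K : Vec ℤ n → ℤ} → Torsion G → Torsion H → (∀ x → K x ≡ c * G x + d * H x) → Torsion K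
    torsion-combine c d {G} {H} {K} (as , p , e) (bs , q , h) eq = as ++ bs , All.++⁺ p q , λ x →
      trans (Δ*-cong (as ++ bs) eq x) (trans (Δ*-linear (as ++ bs) c d G H x) (trans (cong₂ (λ a b → c * a + d * b)
        (trans (Δ*-++ as bs G x) (trans (Δ*-comm as bs G x) (Δ*-zero bs e x)))
        (trans (Δ*-++ as bs H x) (Δ*-zero as h x))) (zero-combination c d)))

    torsion-cong : ∀ {G K : Vec ℤ n → ℤ} → (∀ x → K x ≡ G x) → Torsion G → Torsion K
    torsion-cong eq (as , p , e) = as , p , λ x → trans (Δ*-cong as eq x) (e x)

  ⟦_⟧ : Bool → ℤ → ℤ
  ⟦ true ⟧ (+ _) = 1ℤ
  ⟦ true ⟧ -[1+ _ ] = 0ℤ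
  ⟦ false ⟧ (+ _) = 0ℤ
  ⟦ false ⟧ -[1+ _ ] = 1ℤ

  HasSign : Bool → ℤ → Set
  HasSign true z = 0ℤ ≤ z
  HasSign false z = z < 0ℤ

  sign : ℤ → Bool
  sign (+ _) = true
  sign -[1+ _ ] = false

  ⟦not⟧ : ∀ b z → ⟦ not b ⟧ z ≡ 1ℤ - ⟦ b ⟧ z
  ⟦not⟧ true (+ _) = refl
  ⟦not⟧ true -[1+ _ ] = refl
  ⟦not⟧ false (+ _) = refl
  ⟦not⟧ false -[1+ _ ] = refl

  -1^ : ℕ → ℤ
  -1^ zero = 1ℤ
  -1^ (suc k) = - (-1^ k)

  Signed : ℕ → Set
  Signed n = Bool × Vec ℤ n

  -- The indicator function of the intersection of the half-spaces f ≥ 0 (sign true) and f < 0 (sign false).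
  ∏ : ∀ {n} → List (Signed n) → Vec ℤ n → ℤ
  ∏ [] x = 1ℤ
  ∏ ((b , f) ∷ l) x = ⟦ b ⟧ (f ∙ x) * ∏ l x

  all : ∀ {n} → Bool → List (Vec ℤ n) → List (Signed n)
  all b = List.map (b ,_)

  ∏-mid : ∀ {n} (l : List (Signed n)) s r x → ∏ (l ++ s ∷ r) x ≡ ∏ (s ∷ l ++ r) x
  ∏-mid [] s r x = refl
  ∏-mid ((c , g) ∷ l) (b , f) r x = trans (cong (⟦ c ⟧ (g ∙ x) *_) (∏-mid l (b , f) r x))
    (lem (⟦ c ⟧ (g ∙ x)) (⟦ b ⟧ (f ∙ x)) (∏ (l ++ r) x))
    where
    lem : ∀ a b c → a * (b * c) ≡ b * (a * c)
    lem = solve-∀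

  ∏-not : ∀ {n} b f (l r : List (Signed n)) x → ∏ ((not b , f) ∷ l ++ r) x ≡ ∏ (l ++ r) x - ∏ (l ++ (b , f) ∷ r) x
  ∏-not b f l r x = trans (cong (_* ∏ (l ++ r) x) (⟦not⟧ b (f ∙ x))) (trans (lem (⟦ b ⟧ (f ∙ x)) (∏ (l ++ r) x))
    (cong (λ z → ∏ (l ++ r) x - z) (sym (∏-mid l (b , f) r x))))
    where
    lem : ∀ a p → (1ℤ - a) * p ≡ p - a * p
    lem = solve-∀

  ⟦⟧-value : ∀ b z → ⟦ b ⟧ z ≡ 0ℤ ⊎ HasSign b z
  ⟦⟧-value true (+ _) = inj₂ (+≤+ z≤n)
  ⟦⟧-value true -[1+ _ ] = inj₁ refl
  ⟦⟧-value false (+ _) = inj₁ refl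
  ⟦⟧-value false -[1+ _ ] = inj₂ -<+

  ∏-value : ∀ {n} (l : List (Signed n)) x → ∏ l x ≡ 0ℤ ⊎ All (λ s → HasSign (proj₁ s) (proj₂ s ∙ x)) l
  ∏-value [] x = inj₂ []
  ∏-value ((b , f) ∷ l) x with ⟦⟧-value b (f ∙ x) | ∏-value l x
  ... | inj₁ e | _ = inj₁ (cong (_* ∏ l x) e)
  ... | inj₂ _ | inj₁ e = inj₁ (trans (cong (⟦ b ⟧ (f ∙ x) *_) e) (ℤ.*-zeroʳ (⟦ b ⟧ (f ∙ x))))
  ... | inj₂ p | inj₂ q = inj₂ (p ∷ q)

  ∏-invariant : ∀ {n} (l : List (Signed n)) a → All (λ s → proj₂ s ∙ a ≡ 0ℤ) l → ∀ x → ∏ l (x ⊖ a) ≡ ∏ l x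
  ∏-invariant [] a [] x = refl
  ∏-invariant ((b , f) ∷ l) a (e ∷ es) x = cong₂ _*_ (cong ⟦ b ⟧ (trans (∙-⊖ f x a)
    (trans (cong (λ z → f ∙ x - z) e) (ℤ.+-identityʳ (f ∙ x))))) (∏-invariant l a es x)

  few-torsion : ∀ {n} (l : List (Signed n)) → length l ℕ.< n → Torsion (∏ l)
  few-torsion l lt with kernel (List.map proj₂ l) (subst (ℕ._< _) (sym (List.length-map proj₂ l)) lt)
  ... | a , a≢0 , k = a ∷ [] , a≢0 ∷ [] , λ x → trans (cong (λ z → ∏ l x - z) (∏-invariant l a (All.map⁻ k) x))
    (ℤ.i≡j⇒i-j≡0 (refl {x = ∏ l x}))

  -- `l` collects the factors already turned from negative to nonnegative. Turning one more costs a
  -- sign and a product of n - 1 factors, which is torsion by `few-torsion`.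
  square-torsion : ∀ {n} (fs : List (Vec ℤ n)) (l : List (Signed n)) → length fs ℕ.+ length l ≡ n →
    Torsion (λ x → ∏ (all false fs ++ l) x - -1^ (length fs) * ∏ (all true fs ++ l) x)
  square-torsion [] l e = torsion-zero λ x → lem (∏ l x)
    where
    lem : ∀ a → a - 1ℤ * a ≡ 0ℤ
    lem = solve-∀
  square-torsion (f ∷ fs) l e = torsion-combine 1ℤ (- 1ℤ)
    (few-torsion (all false fs ++ l) (ℕ.≤-reflexive (trans (cong suc (trans (List.length-++ (all false fs))
      (cong (ℕ._+ length l) (List.length-map _ fs)))) e)))
    (square-torsion fs ((true , f) ∷ l) (trans (ℕ.+-suc (length fs) (length l)) e))
    λ x → trans (cong₂ (λ p q → p - (- -1^ (length fs)) * q) (∏-not true f (all false fs) l x) (sym (∏-mid (all true fs) (true , f) l x)))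
      (lem (∏ (all false fs ++ l) x) (∏ (all false fs ++ (true , f) ∷ l) x) (-1^ (length fs)) (∏ (all true fs ++ (true , f) ∷ l) x))
    where
    lem : ∀ a b s c → a - b - - s * c ≡ 1ℤ * a + - 1ℤ * (b - s * c)
    lem = solve-∀

  module _ {n : ℕ} where

    difference : List (Signed n) → List (Signed n) → Vec ℤ n → ℤ
    difference k l x = ∏ k x - -1^ n * ∏ l x

    Weighted : Set
    Weighted = ℤ × Vec ℤ n

    along against : List Weighted → List (Signed n)
    along = List.map λ w → sign (proj₁ w) , proj₂ w
    against = List.map λ w → not (sign (proj₁ w)) , proj₂ w

    -- A dependency with coefficients ws makes both products in mixed vanish; expanding their factors of negative weight
    -- by ⟦not⟧ leaves plain of the whole list and terms with fewer functionals.
    mixed : List Weighted → List (Vec ℤ n) → Vec ℤ n → ℤ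
    mixed ws T = difference (against ws ++ all false T) (along ws ++ all true T)

    plain : List (Vec ℤ n) → List (Vec ℤ n) → Vec ℤ n → ℤ
    plain fs T = difference (all false fs ++ all false T) (all true fs ++ all true T)

    mixed-⁺ : ∀ k f ws T x → mixed ((+ k , f) ∷ ws) T x ≡ mixed ws (f ∷ T) x
    mixed-⁺ k f ws T x = sym (cong₂ (λ p q → p - -1^ n * q) (∏-mid (against ws) (false , f) (all false T) x)
      (∏-mid (along ws) (true , f) (all true T) x))

    mixed-⁻ : ∀ k f ws T x → mixed ((-[1+ k ] , f) ∷ ws) T x ≡ mixed ws T x - mixed ws (f ∷ T) x
    mixed-⁻ k f ws T x = trans (cong₂ (λ p q → p - -1^ n * q) (∏-not false f (against ws) (all false T) x)
      (∏-not true f (along ws) (all true T) x))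
      (lem (∏ (against ws ++ all false T) x) (∏ (against ws ++ (false , f) ∷ all false T) x) (∏ (along ws ++ all true T) x)
        (∏ (along ws ++ (true , f) ∷ all true T) x) (-1^ n))
      where
      lem : ∀ a b c d s → a - b - s * (c - d) ≡ a - s * c - (b - s * d)
      lem = solve-∀

    plain-∷ : ∀ f fs T x → plain (f ∷ fs) T x ≡ plain fs (f ∷ T) x
    plain-∷ f fs T x = sym (cong₂ (λ p q → p - -1^ n * q) (∏-mid (all false fs) (false , f) (all false T) x)
      (∏-mid (all true fs) (true , f) (all true T) x))

    Pos : Vec ℤ n → List (Vec ℤ n) → Set
    Pos w = All (λ f → 0ℤ < f ∙ w)

    -- Each expansion step either moves a functional from `ws` to `T` or drops it, so the total
    -- length never grows and every final term falls under the hypothesis for fewer than m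
    -- functionals.
    mixed-torsion : ∀ {w m} → (∀ T → length T ℕ.< m → Pos w T → Torsion (plain [] T)) →
      ∀ ws T → length ws ℕ.+ length T ℕ.< m → Pos w (List.map proj₂ ws) → Pos w T → Torsion (mixed ws T)
    mixed-torsion ih [] T lt _ p = ih T lt p
    mixed-torsion {m = m} ih ((+ k , f) ∷ ws) T lt (q ∷ qs) p =
      torsion-cong (mixed-⁺ k f ws T) (mixed-torsion ih ws (f ∷ T) (subst (ℕ._< m) (sym (ℕ.+-suc _ _)) lt) qs (q ∷ p))
    mixed-torsion {m = m} ih ((-[1+ k ] , f) ∷ ws) T lt (q ∷ qs) p = torsion-combine 1ℤ (- 1ℤ)
      (mixed-torsion ih ws T (ℕ.<-trans (ℕ.n<1+n _) lt) qs p)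
      (mixed-torsion ih ws (f ∷ T) (subst (ℕ._< m) (sym (ℕ.+-suc _ _)) lt) qs (q ∷ p))
      λ x → trans (mixed-⁻ k f ws T x) (minus-combination (mixed ws T x) (mixed ws (f ∷ T) x))

    -- The expansion solved for its one term of full length: at a negative weight `mixed-⁻` is
    -- rearranged so that the term keeping the functional is expressed by `mixed` of the whole list
    -- and a shorter term.
    plain-torsion : ∀ {w m} → (∀ T → length T ℕ.< m → Pos w T → Torsion (plain [] T)) →
      ∀ ws T → length ws ℕ.+ length T ≡ m → Pos w (List.map proj₂ ws) → Pos w T → Torsion (mixed ws T) → Torsion
        (plain (List.map proj₂ ws) T)
    plain-torsion ih [] T e _ p t = t
    plain-torsion {m = m} ih ((+ k , f) ∷ ws) T e (q ∷ qs) p t =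
      torsion-cong (plain-∷ f (List.map proj₂ ws) T) (plain-torsion ih ws (f ∷ T) (trans (ℕ.+-suc _ _) e) qs (q ∷ p)
        (torsion-cong (λ x → sym (mixed-⁺ k f ws T x)) t))
    plain-torsion {m = m} ih ((-[1+ k ] , f) ∷ ws) T e (q ∷ qs) p t =
      torsion-cong (plain-∷ f (List.map proj₂ ws) T) (plain-torsion ih ws (f ∷ T) (trans (ℕ.+-suc _ _) e) qs (q ∷ p)
        (torsion-combine 1ℤ (- 1ℤ) (mixed-torsion ih ws T (ℕ.≤-reflexive e) qs p) t
          λ x → trans (lem (mixed ws T x) (mixed ws (f ∷ T) x)) (cong (λ z → 1ℤ * mixed ws T x + - 1ℤ * z) (sym (mixed-⁻ k f ws T x)))))
      where
      lem : ∀ a b → b ≡ 1ℤ * a + - 1ℤ * (a - b)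
      lem = solve-∀

    term-nonneg : ∀ (w : Weighted) x → HasSign (sign (proj₁ w)) (proj₂ w ∙ x) → 0ℤ ≤ proj₁ w * (proj₂ w ∙ x)
    term-nonneg (+ k , f) x p = 0≤* {+ k} (+≤+ z≤n) p
    term-nonneg (-[1+ k ] , f) x p = ℤ.<⇒≤ (subst (0ℤ <_) (lem +[1+ k ] (f ∙ x)) (0<* {+[1+ k ]} (+<+ (s≤s z≤n)) (ℤ.neg-mono-< p)))
      where
      lem : ∀ k a → k * - a ≡ - k * a
      lem = solve-∀

    Balanced : List Weighted → Set
    Balanced ws = ∀ x → sumBy (λ w → proj₁ w * (proj₂ w ∙ x)) ws ≡ 0ℤ

    negate : List Weighted → List Weighted
    negate = List.map λ w → - proj₁ w , proj₂ w

    negate-balanced : ∀ ws → Balanced ws → Balanced (negate ws)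
    negate-balanced ws bal x = trans (sumBy-map _ _ ws) (trans (sumBy-cong ws (All.tabulate λ {w} _ → lem (proj₁ w) (proj₂ w ∙ x)))
      (trans (sumBy-scale (- 1ℤ) (λ w → proj₁ w * (proj₂ w ∙ x)) ws) (cong (- 1ℤ *_) (bal x))))
      where
      lem : ∀ a b → - a * b ≡ - 1ℤ * (a * b)
      lem = solve-∀

    -- Evaluation at `w₀` gives a vanishing sum of nonnegative terms with positive second factors.
    -- This is what the common point of positivity is for: a nontrivial dependency must have weights
    -- of both signs.
    nonneg-balanced : ∀ {w₀} ws → Balanced ws → Pos w₀ (List.map proj₂ ws) → All (λ w → 0ℤ ≤ proj₁ w) ws → All (λ w → proj₁ w ≡ 0ℤ) ws
    nonneg-balanced {w₀} ws bal pos nn = All.zipWith (λ { {c , f} (e , p) → [ (λ z → z) , (λ z → ⊥-elim (ℤ.<-irrefl (sym z) p)) ]′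
      (ℤ.i*j≡0⇒i≡0∨j≡0 c e) })
      (sumBy-nonneg-zero (All.zipWith (λ { {c , f} (a , b) → 0≤* a (ℤ.<⇒≤ b) }) (nn , All.map⁻ pos)) (bal w₀) , All.map⁻ pos)

    -- Where the product is nonzero, every term of the dependency is nonnegative, so every term is
    -- 0. A negative weight would meet a strictly negative value there, so all weights are
    -- nonnegative and hence 0.
    ∏-along-zero : ∀ {w₀} ws → Balanced ws → Pos w₀ (List.map proj₂ ws) → ¬ All (λ w → proj₁ w ≡ 0ℤ) ws → ∀ x → ∏ (along ws) x ≡ 0ℤ
    ∏-along-zero ws bal pos nz x with ∏-value (along ws) x
    ... | inj₁ e = e
    ... | inj₂ s = ⊥-elim (nz (nonneg-balanced ws bal pos (All.zipWith (λ { {w} (a , b) → step w a b })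
        (All.map⁻ s , sumBy-nonneg-zero (All.map (λ {w} → term-nonneg w x) (All.map⁻ s)) (bal x)))))
      where
      step : ∀ w → HasSign (sign (proj₁ w)) (proj₂ w ∙ x) → proj₁ w * (proj₂ w ∙ x) ≡ 0ℤ → 0ℤ ≤ proj₁ w
      step (+ k , f) _ _ = +≤+ z≤n
      step (-[1+ k ] , f) p e with ℤ.i*j≡0⇒i≡0∨j≡0 -[1+ k ] e
      ... | inj₂ z = ⊥-elim (ℤ.<-irrefl z p)

    -- The same argument for the negated dependency. Now the weights of sign `true`, zero included,
    -- are the ones that meet strictly negative values.
    ∏-against-zero : ∀ {w₀} ws → Balanced ws → Pos w₀ (List.map proj₂ ws) → ¬ All (λ w → proj₁ w ≡ 0ℤ) ws → ∀ x → ∏ (against ws) x ≡ 0ℤ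
    ∏-against-zero ws bal pos nz x with ∏-value (against ws) x
    ... | inj₁ e = e
    ... | inj₂ s = ⊥-elim (nz (All.map (λ {w} e → trans (sym (ℤ.neg-involutive (proj₁ w))) (cong -_ e)) (All.map⁻
        (nonneg-balanced (negate ws) (negate-balanced ws bal) (subst (Pos _) (trans (List.map-cong (λ _ → refl) ws) (List.map-∘ ws)) pos)
          (All.map⁺ (All.zipWith (λ { {w} (a , b) → step w a b })
            (All.map⁻ s , All.map⁻ (sumBy-nonneg-zero (All.map⁺ (All.map (λ {w} → term w) (All.map⁻ s))) (negate-balanced ws bal x)))))))))
      where
      term : ∀ w → HasSign (not (sign (proj₁ w))) (proj₂ w ∙ x) → 0ℤ ≤ - proj₁ w * (proj₂ w ∙ x)
      term (+ k , f) p = subst (0ℤ ≤_) (lem (+ k) (f ∙ x)) (0≤* {+ k} (+≤+ z≤n) (ℤ.<⇒≤ (ℤ.neg-mono-< p)))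
        where
        lem : ∀ k a → k * - a ≡ - k * a
        lem = solve-∀
      term (-[1+ k ] , f) p = 0≤* {+[1+ k ]} (+≤+ z≤n) p
      step : ∀ w → HasSign (not (sign (proj₁ w))) (proj₂ w ∙ x) → - proj₁ w * (proj₂ w ∙ x) ≡ 0ℤ → 0ℤ ≤ - proj₁ w
      step (-[1+ k ] , f) _ _ = +≤+ z≤n
      step (+ k , f) p e with ℤ.i*j≡0⇒i≡0∨j≡0 (- + k) e
      ... | inj₂ z = ⊥-elim (ℤ.<-irrefl z p)
      ... | inj₁ z = ℤ.≤-reflexive (sym z)

    reciprocity : ∀ {w₀} (fs : List (Vec ℤ n)) → Pos w₀ fs → Torsion (difference (all false fs) (all true fs))
    reciprocity {w₀} fs pos = go (suc (length fs)) fs ℕ.≤-refl pos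
      where
      go : ∀ m T → length T ℕ.< m → Pos w₀ T → Torsion (difference (all false T) (all true T))
      go (suc m) T lt p with ℕ.<-cmp (length T) n
      ... | tri< few _ _ = torsion-combine 1ℤ (- (-1^ n)) (few-torsion (all false T) (subst (ℕ._< n) (sym (List.length-map _ T)) few))
        (few-torsion (all true T) (subst (ℕ._< n) (sym (List.length-map _ T)) few)) λ x → lem (∏ (all false T) x) (∏ (all true T) x) (-1^ n)
        where
        lem : ∀ a b s → a - s * b ≡ 1ℤ * a + - s * b
        lem = solve-∀
      ... | tri≈ _ sq _ = torsion-cong (λ x → cong₂ (λ (a , b) s → ∏ a x - s * ∏ b x)
        (cong₂ _,_ (sym (List.++-identityʳ (all false T))) (sym (List.++-identityʳ (all true T)))) (cong -1^ (sym sq)))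
        (square-torsion T [] (trans (ℕ.+-identityʳ _) sq))
      ... | tri> _ _ many with dependency (λ f → f) T many
      ... | ws , refl , nz , bal = torsion-cong (unpad (all false T) (all true T))
        (plain-torsion (λ T' lt' p' → go m T' (ℕ.<-≤-trans lt' (ℕ.s≤s⁻¹ lt)) p') ws []
          (trans (ℕ.+-identityʳ _) (sym (List.length-map proj₂ ws))) p []
          (torsion-zero λ x → trans (sym (unpad (against ws) (along ws) x))
            (trans (cong₂ (λ a b → a - -1^ n * b) (∏-against-zero ws bal p nz x) (∏-along-zero ws bal p nz x)) (lem (-1^ n)))))
        where
        lem : ∀ s → 0ℤ - s * 0ℤ ≡ 0ℤ
        lem = solve-∀
        unpad : ∀ k l x → difference k l x ≡ difference (k ++ []) (l ++ []) x
        unpad k l x = cong₂ (λ a b → difference a b x) (sym (List.++-identityʳ k)) (sym (List.++-identityʳ l))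

  -- Push-forward to heights

  _≟ᵛ_ : ∀ {n} (x y : Vec ℤ n) → _
  _≟ᵛ_ = Vec.≡-dec ℤ._≟_


  dedup : ∀ {n} → List (Vec ℤ n) → List (Vec ℤ n)
  dedup = deduplicate _≟ᵛ_

  dedup-unique : ∀ {n} (X : List (Vec ℤ n)) → Unique (dedup X)
  dedup-unique = Dedup.deduplicate-! _≟ᵛ_

  ∈-dedup : ∀ {n} {X : List (Vec ℤ n)} {x} → x ∈ X → x ∈ dedup X
  ∈-dedup = ∈-deduplicate⁺ _≟ᵛ_

  ⊖-injective : ∀ {n} (a : Vec ℤ n) {x y} → x ⊖ a ≡ y ⊖ a → x ≡ y
  ⊖-injective a {x} {y} e = trans (sym (⊖-⊕ x a)) (trans (cong (_⊕ a) e) (⊖-⊕ y a))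

  module _ {A : Set} where

    remove : ∀ {x : A} {ys} → x ∈ ys → Unique ys → ∃[ zs ] Unique zs × All (x ≢_) zs × All (_∈ ys) zs ×
      (∀ {z} → z ∈ ys → z ≡ x ⊎ z ∈ zs) × (∀ g → sumBy g ys ≡ g x + sumBy g zs) × length ys ≡ suc (length zs)
    remove {ys = y ∷ ys} (here refl) (p ∷ u) = ys , u , p , All.tabulate there , (λ { (here e) → inj₁ e ; (there i) → inj₂ i }) ,
      (λ g → refl) , refl
    remove {x} {y ∷ ys} (there i) (p ∷ u) with remove i u
    ... | zs , u' , p' , sub , cov , total , len = y ∷ zs , All.map (All.lookup p) sub ∷ u' , (λ e → All.lookup p i (sym e)) ∷ p' , here
      refl ∷ All.map there sub ,
      (λ { (here e) → inj₂ (here e) ; (there j) → [ inj₁ , inj₂ ∘ there ]′ (cov j) }) ,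
      (λ g → trans (+-congˡ (g y) (total g)) (lem (g y) (g x) (sumBy g zs))) , cong suc len
      where
      lem : ∀ a b c → a + (b + c) ≡ b + (a + c)
      lem = solve-∀

    -- Makes the sum of a finitely supported function independent of the list that enumerates its
    -- support.
    sumBy-ext : (∀ (x y : A) → x ≡ y ⊎ x ≢ y) → ∀ (g : A → ℤ) xs ys → Unique xs → Unique ys →
      (∀ z → g z ≢ 0ℤ → z ∈ xs → z ∈ ys) → (∀ z → g z ≢ 0ℤ → z ∈ ys → z ∈ xs) → sumBy g xs ≡ sumBy g ys
    sumBy-ext dec g [] ys _ _ f b = sym (sumBy-zero ys (All.tabulate λ {y} i → vanish y i))
      where
      vanish : ∀ y → y ∈ ys → g y ≡ 0ℤ
      vanish y i with g y ℤ.≟ 0ℤ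
      ... | yes e = e
      ... | no ne with () ← b y ne i
    sumBy-ext dec g (x ∷ xs) ys (p ∷ u) v f b with g x ℤ.≟ 0ℤ
    ... | yes e = trans (cong (_+ sumBy g xs) e) (trans (ℤ.+-identityˡ _) (sumBy-ext dec g xs ys u v (λ z nz i → f z nz (there i)) back))
      where
      back : ∀ z → g z ≢ 0ℤ → z ∈ ys → z ∈ xs
      back z nz i with b z nz i
      ... | here refl = ⊥-elim (nz e)
      ... | there j = j
    ... | no ne with remove (f x ne (here refl)) v
    ... | zs , u' , p' , sub , cov , total , _ = trans (+-congˡ (g x) (sumBy-ext dec g xs zs u u' forth back)) (sym (total g))
      where
      forth : ∀ z → g z ≢ 0ℤ → z ∈ xs → z ∈ zs
      forth z nz i with cov (f z nz (there i))
      ... | inj₁ refl = ⊥-elim (All.lookup p i refl)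
      ... | inj₂ j = j
      back : ∀ z → g z ≢ 0ℤ → z ∈ zs → z ∈ xs
      back z nz i with b z nz (All.lookup sub i)
      ... | here refl = ⊥-elim (All.lookup p' i refl)
      ... | there j = j

  -- Iterating `s` leaves `g` unchanged and pushes the integer `p` below 0 after finitely many
  -- steps.
  descend : ∀ {A : Set} (g : A → ℤ) (s : A → A) (p : A → ℤ) → (∀ a → g a ≡ g (s a)) → (∀ a → p (s a) < p a) →
    (∀ a → p a < 0ℤ → g a ≡ 0ℤ) → ∀ a → g a ≡ 0ℤ
  descend g s p inv dec zero' a = go (suc (ℤ.∣ p a ∣)) a (ℤ.≤-<-trans (≤∣∣ (p a)) (+<+ ℕ.≤-refl))
    where
    go : ∀ k a → p a < + k → g a ≡ 0ℤ
    go zero a lt = zero' a lt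
    go (suc k) a lt = trans (inv a) (go k (s a) (ℤ.<-≤-trans (dec a) (ℤ.i<j⇒i≤pred[j] lt)))

  ∙-square : ∀ {n} (a : Vec ℤ n) → 0ℤ ≤ a ∙ a
  ∙-square [] = ℤ.≤-refl
  ∙-square (a ∷ as) = 0≤+ (sq a) (∙-square as)
    where
    sq : ∀ a → 0ℤ ≤ a * a
    sq (+ k) = 0≤* {+ k} {+ k} (+≤+ z≤n) (+≤+ z≤n)
    sq -[1+ k ] = +≤+ z≤n

  ∙-square-pos : ∀ {n} (a : Vec ℤ n) → a ≢ 𝟎 → 0ℤ < a ∙ a
  ∙-square-pos [] ne = ⊥-elim (ne refl)
  ∙-square-pos (+ 0 ∷ as) ne = 0<+ʳ (ℤ.≤-refl {0ℤ}) (∙-square-pos as λ e → ne (cong (0ℤ ∷_) e))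
  ∙-square-pos (+[1+ k ] ∷ as) ne = 0<+ˡ (+<+ (s≤s z≤n)) (∙-square as)
  ∙-square-pos (-[1+ k ] ∷ as) ne = 0<+ˡ (+<+ (s≤s z≤n)) (∙-square as)

  lowerBound : ∀ {n} (f : Vec ℤ n) X → ∃[ B ] All (λ v → B ≤ f ∙ v) X
  lowerBound f [] = 0ℤ , []
  lowerBound f (v ∷ X) with lowerBound f X
  ... | B , p with ℤ.≤-total B (f ∙ v)
  ... | inj₁ q = B , q ∷ p
  ... | inj₂ q = f ∙ v , ℤ.≤-refl ∷ All.map (ℤ.≤-trans q) p

  -- Sequences indexed by ℤ are functions on ℤ¹, so that `Δ*` and `Torsion` apply to them as they
  -- stand.
  Seq : Set
  Seq = Vec ℤ 1 → ℤ

  [_]ᵛ : ℤ → Vec ℤ 1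
  [ m ]ᵛ = m ∷ []

  -- Summation over the fibres of the height. `total` speaks of every duplicate-free list that
  -- covers the support, so that translates and combinations can be summed over a common list.
  record PushForward {n} (g : Vec ℤ (suc n) → ℤ) (ĝ : Seq) : Set where
    field
      support : ℤ → List (Vec ℤ n)
      finite : ∀ m v → g (m ∷ v) ≢ 0ℤ → v ∈ support m
      total : ∀ m X → Unique X → (∀ v → g (m ∷ v) ≢ 0ℤ → v ∈ X) → ĝ [ m ]ᵛ ≡ sumBy (λ v → g (m ∷ v)) X

  dec⊎ : ∀ {n} (x y : Vec ℤ n) → x ≡ y ⊎ x ≢ y
  dec⊎ x y with x ≟ᵛ y
  ... | yes e = inj₁ e
  ... | no ne = inj₂ ne

  module _ {n : ℕ} where
    open PushForward

    private
      difference-support : ∀ {a b} → a - b ≢ 0ℤ → a ≢ 0ℤ ⊎ b ≢ 0ℤ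
      difference-support {a} {b} ne with a ℤ.≟ 0ℤ | b ℤ.≟ 0ℤ
      ... | no p | _ = inj₁ p
      ... | yes _ | no q = inj₂ q
      ... | yes refl | yes refl = ⊥-elim (ne refl)

    push-Δ : ∀ {g : Vec ℤ (suc n) → ℤ} {ĝ} a → PushForward g ĝ → PushForward (Δ a g) (Δ [ head a ]ᵛ ĝ)
    push-Δ {g} {ĝ} (h ∷ a) P = record { support = X ; finite = fin ; total = tot }
      where
      X : ℤ → List (Vec ℤ n)
      X m = support P m ++ List.map (_⊕ a) (support P (m - h))
      fin₂ : ∀ m v → g (m - h ∷ v ⊖ a) ≢ 0ℤ → v ∈ List.map (_⊕ a) (support P (m - h))
      fin₂ m v ne = subst (_∈ _) (⊖-⊕ v a) (∈-map⁺ (_⊕ a) (finite P (m - h) (v ⊖ a) ne))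
      fin : ∀ m v → Δ (h ∷ a) g (m ∷ v) ≢ 0ℤ → v ∈ X m
      fin m v ne with difference-support {g (m ∷ v)} {g (m - h ∷ v ⊖ a)} ne
      ... | inj₁ p = ∈-++⁺ˡ (finite P m v p)
      ... | inj₂ q = ∈-++⁺ʳ (support P m) (fin₂ m v q)
      tot : ∀ m Y → Unique Y → (∀ v → Δ (h ∷ a) g (m ∷ v) ≢ 0ℤ → v ∈ Y) → Δ [ h ]ᵛ ĝ [ m ]ᵛ ≡ sumBy (λ v → Δ (h ∷ a) g (m ∷ v)) Y
      tot m Y u sup = trans (cong₂ _-_ e₁ e₂) (trans (trans (minus-combination (sumBy (λ v → g (m ∷ v)) Z)
        (sumBy (λ v → g (m - h ∷ v ⊖ a)) Z)) (sym (trans (sumBy-cong Z (All.tabulate λ {v} _ → minus-combination (g (m ∷ v))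
        (g (m - h ∷ v ⊖ a)))) (sumBy-linear 1ℤ (- 1ℤ) (λ v → g (m ∷ v)) (λ v → g (m - h ∷ v ⊖ a)) Z))))
          (sym (sumBy-ext dec⊎ (λ v → Δ (h ∷ a) g (m ∷ v)) Y Z u uZ (λ v ne _ → ∈-dedup (fin m v ne)) (λ v ne _ → sup v ne))))
        where
        Z = dedup (X m)
        uZ = dedup-unique (X m)
        e₁ : ĝ [ m ]ᵛ ≡ sumBy (λ v → g (m ∷ v)) Z
        e₁ = total P m Z uZ λ v ne → ∈-dedup (∈-++⁺ˡ (finite P m v ne))
        e₂ : ĝ [ m - h ]ᵛ ≡ sumBy (λ v → g (m - h ∷ v ⊖ a)) Z
        e₂ = trans (total P (m - h) (List.map (_⊖ a) Z) (Unique.map⁺ (⊖-injective a) uZ) covers)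
                   (sumBy-map (_⊖ a) (λ v → g (m - h ∷ v)) Z)
          where
          covers : ∀ v → g (m - h ∷ v) ≢ 0ℤ → v ∈ List.map (_⊖ a) Z
          covers v ne = subst (_∈ List.map (_⊖ a) Z) (⊕-⊖ v a) (∈-map⁺ (_⊖ a)
            (∈-dedup (∈-++⁺ʳ (support P m) (∈-map⁺ (_⊕ a) (finite P (m - h) v ne)))))

    push-Δ* : ∀ as {g : Vec ℤ (suc n) → ℤ} {ĝ} → PushForward g ĝ → PushForward (Δ* as g) (Δ* (List.map ([_]ᵛ ∘ head) as) ĝ)
    push-Δ* [] P = P
    push-Δ* (a ∷ as) P = push-Δ a (push-Δ* as P)

    push-combine : ∀ c d {g k : Vec ℤ (suc n) → ℤ} {ĝ k̂} → PushForward g ĝ → PushForward k k̂ → PushForward (λ x → c * g x + d * k x)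
      (λ m → c * ĝ m + d * k̂ m)
    push-combine c d {g} {k} {ĝ} {k̂} P Q = record { support = λ m → support P m ++ support Q m ; finite = fin ; total = tot }
      where
      fin : ∀ m v → c * g (m ∷ v) + d * k (m ∷ v) ≢ 0ℤ → v ∈ support P m ++ support Q m
      fin m v ne with g (m ∷ v) ℤ.≟ 0ℤ | k (m ∷ v) ℤ.≟ 0ℤ
      ... | no p | _ = ∈-++⁺ˡ (finite P m v p)
      ... | yes _ | no q = ∈-++⁺ʳ (support P m) (finite Q m v q)
      ... | yes p | yes q = ⊥-elim (ne (trans (cong₂ (λ a b → c * a + d * b) p q) (zero-combination c d)))
      tot : ∀ m Y → Unique Y → (∀ v → c * g (m ∷ v) + d * k (m ∷ v) ≢ 0ℤ → v ∈ Y) → c * ĝ [ m ]ᵛ + d * k̂ [ m ]ᵛ ≡ sumBy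
        (λ v → c * g (m ∷ v) + d * k (m ∷ v)) Y
      tot m Y u sup = trans (cong₂ (λ a b → c * a + d * b) (total P m Z uZ λ v ne → ∈-dedup (∈-++⁺ˡ (finite P m v ne)))
        (total Q m Z uZ λ v ne → ∈-dedup (∈-++⁺ʳ (support P m) (finite Q m v ne))))
        (trans (sym (sumBy-linear c d (λ v → g (m ∷ v)) (λ v → k (m ∷ v)) Z))
          (sym (sumBy-ext dec⊎ _ Y Z u uZ (λ v ne _ → ∈-dedup (fin m v ne)) (λ v ne _ → sup v ne))))
        where
        Z = dedup (support P m ++ support Q m)
        uZ = dedup-unique (support P m ++ support Q m)

    -- Within one height `g` is periodic along `a` and has finite support. Each translation lowers a
    -- ∙ v by a ∙ a > 0, so it eventually leaves the support.
    horizontal-cancel : ∀ {g : Vec ℤ (suc n) → ℤ} {ĝ} a → 0ℤ ∷ a ≢ 𝟎 → PushForward g ĝ → (∀ x → Δ (0ℤ ∷ a) g x ≡ 0ℤ) → ∀ x → g x ≡ 0ℤ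
    horizontal-cancel {g} a a≢0 P inv (m ∷ v) with lowerBound a (support P m)
    ... | B , p = descend (λ v → g (m ∷ v)) (_⊖ a) (λ v → a ∙ v - B)
        (λ v → trans (ℤ.i-j≡0⇒i≡j (g (m ∷ v)) _ (inv (m ∷ v))) (cong (λ z → g (z ∷ v ⊖ a)) (ℤ.+-identityʳ m)))
        (λ v → subst (_< a ∙ v - B) (trans (lem (a ∙ v) (a ∙ a) B) (cong (_- B) (sym (∙-⊖ a v a))))
           (subst (a ∙ v - B - a ∙ a <_) (ℤ.+-identityʳ (a ∙ v - B)) (ℤ.+-monoʳ-< (a ∙ v - B)
             (ℤ.neg-mono-< (∙-square-pos a (λ e → a≢0 (cong (0ℤ ∷_) e)))))))
        out v
      where
      lem : ∀ p q b → p - b - q ≡ p - q - b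
      lem = solve-∀
      out : ∀ v → a ∙ v - B < 0ℤ → g (m ∷ v) ≡ 0ℤ
      out v lt with g (m ∷ v) ℤ.≟ 0ℤ
      ... | yes e = e
      ... | no ne = ⊥-elim (ℤ.<⇒≱ lt (ℤ.i≤j⇒0≤j-i (All.lookup p (finite P m v ne))))

    push-zero : ∀ {g : Vec ℤ (suc n) → ℤ} {ĝ} → PushForward g ĝ → (∀ x → g x ≡ 0ℤ) → ∀ x → ĝ x ≡ 0ℤ
    push-zero P e (m ∷ []) = total P m [] [] λ v ne → ⊥-elim (ne (e (m ∷ v)))

    -- A factor 1 - tᵃ of height h ≠ 0 is pushed to 1 - tʰ. A factor of height 0 would become the
    -- zero operator and carry no information, so it is cancelled before the push-forward.
    push-torsion : ∀ {g : Vec ℤ (suc n) → ℤ} {ĝ} → PushForward g ĝ → Torsion g → Torsion ĝ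
    push-torsion {g} {ĝ} P (as , ne , z) = go as ne P z
      where
      go : ∀ as {g : Vec ℤ (suc n) → ℤ} {ĝ} → All (_≢ 𝟎) as → PushForward g ĝ → (∀ x → Δ* as g x ≡ 0ℤ) → Torsion ĝ
      go [] _ P z = torsion-zero (push-zero P z)
      go ((h ∷ a) ∷ as) {g} {ĝ} (q ∷ qs) P z with h ℤ.≟ 0ℤ
      ... | yes refl = go as qs P (horizontal-cancel a q (push-Δ* as P) z)
      ... | no h≢0 with go as qs (push-Δ (h ∷ a) P) (λ x → trans (Δ*-Δ as (h ∷ a) g x) (z x))
      ... | hs , nz , e = [ h ]ᵛ ∷ hs , (λ eq → h≢0 (cong head eq)) ∷ nz , λ x → trans (sym (Δ*-Δ hs [ h ]ᵛ ĝ x)) (e x)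

  -- Power series in one variable

  minus-neg : ∀ {a b} → a < b → a - b < 0ℤ
  minus-neg {a} {b} lt = subst (a - b <_) (ℤ.+-inverseʳ b) (ℤ.+-monoˡ-< (- b) lt)

  minus-neg⁻ : ∀ {a b} → a - b < 0ℤ → a < b
  minus-neg⁻ {a} {b} lt = subst₂ _<_ (lem a b) (ℤ.+-identityˡ b) (ℤ.+-monoˡ-< b lt)
    where
    lem : ∀ a b → a - b + b ≡ a
    lem = solve-∀

  Σᶠ : ∀ {n} → (Fin n → ℤ) → ℤ
  Σᶠ = RawMonoid.sum ℤ.+-0-rawMonoid

  Σᶠ-cong : ∀ {n} {f g : Fin n → ℤ} → (∀ i → f i ≡ g i) → Σᶠ f ≡ Σᶠ g
  Σᶠ-cong {zero} e = refl
  Σᶠ-cong {suc n} e = cong₂ _+_ (e Fin.zero) (Σᶠ-cong (e ∘ Fin.suc))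

  Σᶠ-zero : ∀ {n} {f : Fin n → ℤ} → (∀ i → f i ≡ 0ℤ) → Σᶠ f ≡ 0ℤ
  Σᶠ-zero {zero} e = refl
  Σᶠ-zero {suc n} e = cong₂ _+_ (e Fin.zero) (Σᶠ-zero (e ∘ Fin.suc))

  Σᶠ-minus : ∀ {n} (f g : Fin n → ℤ) → Σᶠ (λ i → f i - g i) ≡ Σᶠ f - Σᶠ g
  Σᶠ-minus {zero} f g = refl
  Σᶠ-minus {suc n} f g = trans (+-congˡ (f Fin.zero - g Fin.zero) (Σᶠ-minus (f ∘ Fin.suc) (g ∘ Fin.suc)))
    (lem (f Fin.zero) (g Fin.zero) (Σᶠ (f ∘ Fin.suc)) (Σᶠ (g ∘ Fin.suc)))
    where
    lem : ∀ a b c d → a - b + (c - d) ≡ a + c - (b + d)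
    lem = solve-∀

  ∇ : PowerSeries → PowerSeries
  ∇ f zero = f zero
  ∇ f (suc k) = f (suc k) - f k

  ∇^ : ℕ → PowerSeries → PowerSeries
  ∇^ zero f = f
  ∇^ (suc k) f = ∇ (∇^ k f)

  ∇-cong : ∀ {f g : PowerSeries} → (∀ k → f k ≡ g k) → ∀ k → ∇ f k ≡ ∇ g k
  ∇-cong e zero = e zero
  ∇-cong e (suc k) = cong₂ _-_ (e (suc k)) (e k)

  ⊛-congˡ : ∀ {f g : PowerSeries} h → (∀ k → f k ≡ g k) → ∀ k → (f ⊛ h) k ≡ (g ⊛ h) k
  ⊛-congˡ h e k = Σᶠ-cong {suc k} λ i → cong (_* h (k ∸ toℕ i)) (e (toℕ i))

  one-⊛ : ∀ f k → (one ⊛ f) k ≡ f k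
  one-⊛ f k = trans (cong₂ _+_ (ℤ.*-identityˡ (f k)) (Σᶠ-zero {k} λ i → ℤ.*-zeroˡ (f (k ∸ suc (toℕ i))))) (ℤ.+-identityʳ (f k))

  1-t-⊛ : ∀ f k → (1-t ⊛ f) k ≡ ∇ f k
  1-t-⊛ f zero = trans (ℤ.+-identityʳ _) (ℤ.*-identityˡ (f zero))
  1-t-⊛ f (suc k) = trans (cong₂ (λ a b → a + (-[1+ 0 ] * f k + b)) (ℤ.*-identityˡ (f (suc k)))
    (Σᶠ-zero {k} λ i → ℤ.*-zeroˡ (f (k ∸ suc (toℕ i))))) (lem (f (suc k)) (f k))
    where
    lem : ∀ a b → a + (- 1ℤ * b + 0ℤ) ≡ a - b
    lem = solve-∀

  ∇-⊛ : ∀ f g k → (∇ f ⊛ g) k ≡ ∇ (f ⊛ g) k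
  ∇-⊛ f g zero = refl
  ∇-⊛ f g (suc k) = trans (+-congˡ (f 0 * g (suc k)) (trans (Σᶠ-cong {suc k} λ i → lem (f (suc (toℕ i))) (f (toℕ i)) (g (k ∸ toℕ i)))
    (Σᶠ-minus {suc k} (λ i → f (suc (toℕ i)) * g (k ∸ toℕ i)) (λ i → f (toℕ i) * g (k ∸ toℕ i)))))
    (sym (ℤ.+-assoc (f 0 * g (suc k)) (Σᶠ {suc k} λ i → f (suc (toℕ i)) * g (k ∸ toℕ i)) (- (f ⊛ g) k)))
    where
    lem : ∀ a b c → (a - b) * c ≡ a * c - b * c
    lem = solve-∀

  1-t^-⊛ : ∀ n f k → ((1-t ^ˢ n) ⊛ f) k ≡ ∇^ n f k
  1-t^-⊛ zero f k = one-⊛ f k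
  1-t^-⊛ (suc n) f k = trans (⊛-congˡ f (1-t-⊛ (1-t ^ˢ n)) k) (trans (∇-⊛ (1-t ^ˢ n) f k) (∇-cong (1-t^-⊛ n f) k))

  extend : PowerSeries → Seq
  extend f (+ k ∷ []) = f k
  extend f (-[1+ k ] ∷ []) = 0ℤ

  steps : ℕ → List (Vec ℤ 1)
  steps n = List.replicate n [ 1ℤ ]ᵛ

  Δ-extend : ∀ f x → Δ [ 1ℤ ]ᵛ (extend f) x ≡ extend (∇ f) x
  Δ-extend f (+ zero ∷ []) = ℤ.+-identityʳ (f 0)
  Δ-extend f (+ suc k ∷ []) = refl
  Δ-extend f (-[1+ k ] ∷ []) = refl

  Δ*-extend : ∀ n f x → Δ* (steps n) (extend f) x ≡ extend (∇^ n f) x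
  Δ*-extend zero f x = refl
  Δ*-extend (suc n) f x = trans (Δ*-cong ([ 1ℤ ]ᵛ ∷ []) (Δ*-extend n f) x) (Δ-extend (∇^ n f) x)

  shift : ℤ → Seq → Seq
  shift c g x = g (x ⊖ [ c ]ᵛ)

  Δ*-shift : ∀ as c g x → Δ* as (shift c g) x ≡ shift c (Δ* as g) x
  Δ*-shift [] c g x = refl
  Δ*-shift (a ∷ as) c g x = trans (cong₂ _-_ (Δ*-shift as c g x) (Δ*-shift as c g (x ⊖ a)))
    (cong (λ y → Δ* as g (x ⊖ [ c ]ᵛ) - Δ* as g y) (⊖-swap x a [ c ]ᵛ))

  reflect : Seq → Seq
  reflect g x = g (⊟ x)

  -- Sign and shift come from (1 - t)ⁿ = (-1)ⁿ tⁿ (1 - t⁻¹)ⁿ.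
  Δ*-reflect : ∀ n g x → Δ* (steps n) (reflect g) x ≡ -1^ n * Δ* (steps n) g ([ + n ]ᵛ ⊖ x)
  Δ*-reflect zero g (m ∷ []) = trans (cong (λ z → g [ z ]ᵛ) (sym (ℤ.+-identityˡ (- m)))) (sym (ℤ.*-identityˡ _))
  Δ*-reflect (suc n) g (m ∷ []) = trans (cong₂ _-_ (Δ*-reflect n g [ m ]ᵛ) (Δ*-reflect n g [ m - 1ℤ ]ᵛ))
    (trans (cong₂ (λ y z → -1^ n * G [ y ]ᵛ - -1^ n * G [ z ]ᵛ) (lem₁ (+ n) m) (lem₂ (+ n) m))
     (lem₃ (-1^ n) (G [ + suc n - m - 1ℤ ]ᵛ) (G [ + suc n - m ]ᵛ)))
    where
    G = Δ* (steps n) g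
    lem₁ : ∀ n m → n - m ≡ 1ℤ + n - m - 1ℤ
    lem₁ = solve-∀
    lem₂ : ∀ n m → n - (m - 1ℤ) ≡ 1ℤ + n - m
    lem₂ = solve-∀
    lem₃ : ∀ s a b → s * a - s * b ≡ - s * (b - a)
    lem₃ = solve-∀

  -1^-square : ∀ n → -1^ n * -1^ n ≡ 1ℤ
  -1^-square zero = refl
  -1^-square (suc n) = trans (lem (-1^ n)) (-1^-square n)
    where
    lem : ∀ s → - s * - s ≡ s * s
    lem = solve-∀

  BoundedAbove : Seq → Set
  BoundedAbove g = ∃[ B ] ∀ m → B < m → g [ m ]ᵛ ≡ 0ℤ

  bounded-Δ : ∀ a g → BoundedAbove g → BoundedAbove (Δ a g)
  bounded-Δ (h ∷ []) g (B , p) = B + + ∣ h ∣ , λ m lt → cong₂ _-_ (p m (ℤ.≤-<-trans (ℤ.i≤i+j B (+ ∣ h ∣)) lt))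
    (p (m - h) (subst (_< m - h) (lem B h) (ℤ.+-monoˡ-< (- h) (ℤ.≤-<-trans (ℤ.+-monoʳ-≤ B (≤∣∣ h)) lt))))
    where
    lem : ∀ b h → b + h + - h ≡ b
    lem = solve-∀

  bounded-Δ* : ∀ as g → BoundedAbove g → BoundedAbove (Δ* as g)
  bounded-Δ* [] g b = b
  bounded-Δ* (a ∷ as) g b = bounded-Δ a (Δ* as g) (bounded-Δ* as g b)

  bounded-combine : ∀ c d g h → BoundedAbove g → BoundedAbove h → BoundedAbove (λ x → c * g x + d * h x)
  bounded-combine c d g h (B , p) (C , q) = B ℤ.⊔ C , λ m lt → trans (cong₂ (λ a b → c * a + d * b) (p m (ℤ.≤-<-trans (ℤ.i≤i⊔j B C) lt))
    (q m (ℤ.≤-<-trans (ℤ.i≤j⊔i B C) lt))) (zero-combination c d)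

  -- Whatever the sign of the period, steps in the direction of growing exponents lead past the
  -- bound. In other words, 1 - tᵃ is not a zero divisor on Laurent series in t⁻¹.
  bounded-periodic : ∀ a → a ≢ 𝟎 → ∀ g → BoundedAbove g → (∀ x → Δ a g x ≡ 0ℤ) → ∀ x → g x ≡ 0ℤ
  bounded-periodic (h ∷ []) a≢0 g (B , p) inv with ℤ.<-cmp h 0ℤ
  ... | tri≈ _ refl _ = ⊥-elim (a≢0 refl)
  ... | tri< h<0 _ _ = descend g (_⊖ [ h ]ᵛ) (λ { (m ∷ []) → B - m })
    (λ x → ℤ.i-j≡0⇒i≡j (g x) _ (inv x))
    (λ { (m ∷ []) → ℤ.+-monoʳ-< B (ℤ.neg-mono-< (subst (_< m - h) (ℤ.+-identityʳ m) (ℤ.+-monoʳ-< m (ℤ.neg-mono-< h<0)))) })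
    (λ { (m ∷ []) lt → p m (minus-neg⁻ lt) })
  ... | tri> _ _ h>0 = descend g (_⊕ [ h ]ᵛ) (λ { (m ∷ []) → B - m })
    (λ { (m ∷ []) → trans (cong (λ z → g [ z ]ᵛ) (lem m h)) (sym (ℤ.i-j≡0⇒i≡j (g [ m + h ]ᵛ) _ (inv [ m + h ]ᵛ))) })
    (λ { (m ∷ []) → ℤ.+-monoʳ-< B (ℤ.neg-mono-< (subst (_< m + h) (ℤ.+-identityʳ m) (ℤ.+-monoʳ-< m h>0))) })
    (λ { (m ∷ []) lt → p m (minus-neg⁻ lt) })
    where
    lem : ∀ m h → m ≡ m + h - h
    lem = solve-∀

  bounded-torsion : ∀ g → BoundedAbove g → Torsion g → ∀ x → g x ≡ 0ℤ
  bounded-torsion g b (as , ne , e) = go as ne e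
    where
    go : ∀ as → All (_≢ 𝟎) as → (∀ x → Δ* as g x ≡ 0ℤ) → ∀ x → g x ≡ 0ℤ
    go [] _ e = e
    go (a ∷ as) (ne ∷ nes) e = go as nes (bounded-periodic a ne (Δ* as g) (bounded-Δ* as g b) e)

  bounded-below-torsion : ∀ n g B → (∀ m → m < B → g [ m ]ᵛ ≡ 0ℤ) → (∀ x → Δ* (steps n) g x ≡ 0ℤ) → ∀ x → g x ≡ 0ℤ
  bounded-below-torsion n g B p e (m ∷ []) = trans (cong (λ z → g [ z ]ᵛ) (sym (ℤ.neg-involutive m)))
    (bounded-torsion (reflect g) (- B , λ m lt → p (- m) (subst (- m <_) (ℤ.neg-involutive B) (ℤ.neg-mono-< lt)))
      (steps n , All.replicate⁺ n (λ ()) , λ x → trans (Δ*-reflect n g x) (trans (cong (-1^ n *_) (e _)) (ℤ.*-zeroʳ (-1^ n)))) [ - m ]ᵛ)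

  module _ {n d : ℕ} (L I h : PowerSeries) (L-series : ∀ k → ∇^ n L k ≡ h k) (degree : IsPolynomialOfDegree h d)
    (symmetric : ∀ i → i ℕ.≤ d → h i ≡ h (d ∸ i))
    (reciprocal : Torsion (λ x → 1ℤ * reflect (extend I) x + - (-1^ n) * extend L x)) where

    private
      s = -1^ n
      E = λ x → 1ℤ * reflect (extend I) x + - s * extend L x

      h-bounded : BoundedAbove (extend h)
      h-bounded = + d , λ { (+ k) (+<+ lt) → proj₂ degree k lt }

      I-bounded : BoundedAbove (reflect (extend I))
      I-bounded = 0ℤ , λ { +[1+ k ] _ → refl ; (+ 0) (+<+ ()) }

      ΔL : ∀ x → Δ* (steps n) (extend L) x ≡ extend h x
      ΔL (+ k ∷ []) = trans (Δ*-extend n L [ + k ]ᵛ) (L-series k)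
      ΔL (-[1+ k ] ∷ []) = Δ*-extend n L [ -[1+ k ] ]ᵛ

      ΔE : ∀ x → Δ* (steps n) E x ≡ 1ℤ * Δ* (steps n) (reflect (extend I)) x + - s * extend h x
      ΔE x = trans (Δ*-linear (steps n) 1ℤ (- s) (reflect (extend I)) (extend L) x)
        (cong (λ z → 1ℤ * Δ* (steps n) (reflect (extend I)) x + - s * z) (ΔL x))

      ΔE-torsion : Torsion (Δ* (steps n) E)
      ΔE-torsion = let as , ne , e = reciprocal in as , ne , λ x → trans (Δ*-comm as (steps n) E x) (Δ*-zero (steps n) e x)

      -- Here reciprocity becomes exact. `E` itself need not be bounded above, but (1 - t)ⁿ turns
      -- `L` into the polynomial `h`, and the reflected `I` vanishes at positive exponents; bounded
      -- torsion is zero.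
      ΔE-zero : ∀ x → 1ℤ * Δ* (steps n) (reflect (extend I)) x + - s * extend h x ≡ 0ℤ
      ΔE-zero = bounded-torsion _ (bounded-combine 1ℤ (- s) (Δ* (steps n) (reflect (extend I))) (extend h)
        (bounded-Δ* (steps n) (reflect (extend I)) I-bounded) h-bounded)
        (torsion-cong (λ x → sym (ΔE x)) ΔE-torsion)

      extend-symmetric : ∀ m → extend h [ + d - m ]ᵛ ≡ extend h [ m ]ᵛ
      extend-symmetric -[1+ k ] = proj₂ degree _ (ℕ.m<m+n d (s≤s z≤n))
      extend-symmetric (+ k) with k ℕ.≤? d
      ... | yes k≤d = trans (cong (λ z → extend h [ z ]ᵛ) (trans (ℤ.m-n≡m⊖n d k) (ℤ.⊖-≥ k≤d)) ) (sym (symmetric k k≤d))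
      ... | no k≰d = trans (neg (+ d - + k) (minus-neg (+<+ (ℕ.≰⇒> k≰d)))) (sym (proj₂ degree k (ℕ.≰⇒> k≰d)))
        where
        neg : ∀ z → z < 0ℤ → extend h [ z ]ᵛ ≡ 0ℤ
        neg -[1+ _ ] _ = refl
        neg (+ _) (+<+ ())

      r = + n - + d

      -- Reflecting `ΔE-zero` gives (1 - t)ⁿ I(t) = tⁿ h(t⁻¹), and the symmetry h(t⁻¹) = t⁻ᵈ h(t)
      -- turns the right side into tʳ h(t) with r = n - d.
      ΔI : ∀ m → Δ* (steps n) (extend I) [ m ]ᵛ ≡ extend h [ m - r ]ᵛ
      ΔI m = trans (Δ*-cong (steps n) {H = reflect (reflect (extend I))}
        (λ { (k ∷ []) → cong (λ z → extend I [ z ]ᵛ) (sym (ℤ.neg-involutive k)) }) [ m ]ᵛ)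
        (trans (Δ*-reflect n (reflect (extend I)) [ m ]ᵛ)
        (trans (lem₁ s (Δ* (steps n) (reflect (extend I)) [ + n - m ]ᵛ) (extend h [ + n - m ]ᵛ) (-1^-square n) (ΔE-zero [ + n - m ]ᵛ))
        (trans (sym (extend-symmetric (+ n - m))) (cong (λ z → extend h [ z ]ᵛ) (lem₂ (+ n) (+ d) m)))))
        where
        lem₁ : ∀ s a b → s * s ≡ 1ℤ → 1ℤ * a + - s * b ≡ 0ℤ → s * a ≡ b
        lem₁ s a b sq e = trans (p s a b) (trans (cong₂ (λ x y → s * x + y * b) e sq) (q s b))
          where
          p : ∀ s a b → s * a ≡ s * (1ℤ * a + - s * b) + s * s * b
          p = solve-∀
          q : ∀ s b → s * 0ℤ + 1ℤ * b ≡ b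
          q = solve-∀
        lem₂ : ∀ n d m → d - (n - m) ≡ m - (n - d)
        lem₂ = solve-∀

    interior-shift : ∀ m → extend I [ m ]ᵛ ≡ extend L [ m - r ]ᵛ
    interior-shift m = ℤ.i-j≡0⇒i≡j (extend I [ m ]ᵛ) _ (trans (minus-combination (extend I [ m ]ᵛ) (extend L [ m - r ]ᵛ))
      (bounded-below-torsion n
      -- Below the minimum of 0 and r both `I` and the shifted `L` vanish, so (1 - t)ⁿ may be
      -- cancelled.
      (λ x → 1ℤ * extend I x + - 1ℤ * shift r (extend L) x) (0ℤ ℤ.⊓ r)
      (λ m lt → cong₂ (λ a b → 1ℤ * a + - 1ℤ * b) (neg I m (ℤ.<-≤-trans lt (ℤ.i⊓j≤i 0ℤ r)))
        (neg L (m - r) (minus-neg (ℤ.<-≤-trans lt (ℤ.i⊓j≤j 0ℤ r)))))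
      (λ { (k ∷ []) → trans (Δ*-linear (steps n) 1ℤ (- 1ℤ) (extend I) (shift r (extend L)) [ k ]ᵛ)
        (trans (cong₂ (λ a b → 1ℤ * a + - 1ℤ * b) (ΔI k) (trans (Δ*-shift (steps n) r (extend L) [ k ]ᵛ) (ΔL [ k - r ]ᵛ)))
          (cancel (extend h [ k - r ]ᵛ))) })
      [ m ]ᵛ))
      where
      cancel : ∀ a → 1ℤ * a + - 1ℤ * a ≡ 0ℤ
      cancel = solve-∀
      neg : ∀ f z → z < 0ℤ → extend f [ z ]ᵛ ≡ 0ℤ
      neg f -[1+ _ ] _ = refl
      neg f (+ _) (+<+ ())

  -- Weighted combinations of functionals

  -- The identity is stated for the cofactors instead of `g`, so that it yields a matrix of
  -- determinant 1 even when a = b = 0.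
  record Bezout (a b : ℤ) : Set where
    field
      g a′ b′ p q : ℤ
      a≡ : a ≡ g * a′
      b≡ : b ≡ g * b′
      unit : p * a′ + q * b′ ≡ 1ℤ

  bezout : ∀ a b → Bezout a b
  bezout a b = go (suc ∣ b ∣) a b ℕ.≤-refl
    where
    step : ∀ a b .{{_ : ℤ.NonZero b}} → Bezout b (+ (a % b)) → Bezout a b
    step a b B = record
      { g = g ; a′ = b′ + t * a′ ; b′ = a′ ; p = q ; q = p - q * t
      ; a≡ = trans (a≡a%n+[a/n]*n a b) (trans (cong₂ (λ x y → x + t * y) b≡ a≡) (lem₁ g a′ b′ t))
      ; b≡ = a≡ ; unit = trans (lem₂ p q a′ b′ t) unit }
      where
      open Bezout B
      t = a / b
      lem₁ : ∀ g a b t → g * b + t * (g * a) ≡ g * (b + t * a)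
      lem₁ = solve-∀
      lem₂ : ∀ p q a b t → q * (b + t * a) + (p - q * t) * a ≡ p * a + q * b
      lem₂ = solve-∀
    go : ∀ k a b → ∣ b ∣ ℕ.< k → Bezout a b
    go (suc k) a +0 lt = record { g = a ; a′ = 1ℤ ; b′ = 0ℤ ; p = 1ℤ ; q = 0ℤ ; a≡ = sym (ℤ.*-identityʳ a) ; b≡ = sym (ℤ.*-zeroʳ a) ; unit =
      refl }
    go (suc k) a b@(+[1+ j ]) lt = step a b (go k b (+ (a % b)) (ℕ.<-≤-trans (n%d<d a b) (ℕ.s≤s⁻¹ lt)))
    go (suc k) a b@(-[1+ j ]) lt = step a b (go k b (+ (a % b)) (ℕ.<-≤-trans (n%d<d a b) (ℕ.s≤s⁻¹ lt)))

  ⊙-⊙ : ∀ {n} a b (x : Vec ℤ n) → a ⊙ b ⊙ x ≡ (a * b) ⊙ x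
  ⊙-⊙ a b [] = refl
  ⊙-⊙ a b (c ∷ x) = cong₂ _∷_ (sym (ℤ.*-assoc a b c)) (⊙-⊙ a b x)

  0⊙ : ∀ {n} (x : Vec ℤ n) → 0ℤ ⊙ x ≡ 𝟎
  0⊙ [] = refl
  0⊙ (a ∷ x) = cong₂ _∷_ (ℤ.*-zeroˡ a) (0⊙ x)

  -- `point` certifies that the coordinates of `part` are coprime; `facet` also needs it as a
  -- lattice point at distance 1.
  record Primitive {n} (f : Vec ℤ n) : Set where
    field
      content : ℤ
      part point : Vec ℤ n
      f≡ : f ≡ content ⊙ part
      unit : part ∙ point ≡ 1ℤ

  primitivePart : ∀ {n} (f : Vec ℤ (suc n)) → Primitive f
  primitivePart (a ∷ []) = record { content = a ; part = 1ℤ ∷ [] ; point = 1ℤ ∷ [] ; f≡ = cong (_∷ []) (sym (ℤ.*-identityʳ a)) ; unit =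
    refl }
  primitivePart (a ∷ f@(_ ∷ _)) = record
    { content = B.g ; part = B.a′ ∷ B.b′ ⊙ P.part ; point = B.p ∷ B.q ⊙ P.point
    ; f≡ = cong₂ _∷_ B.a≡ (trans P.f≡ (trans (cong (_⊙ P.part) B.b≡) (sym (⊙-⊙ B.g B.b′ P.part))))
    ; unit = trans (+-congˡ (B.a′ * B.p) (trans (∙-⊙ (B.b′ ⊙ P.part) B.q P.point)
      (cong (B.q *_) (trans (⊙-∙ B.b′ P.part P.point) (cong (B.b′ *_) P.unit)))))
        (trans (lem B.a′ B.b′ B.p B.q) B.unit) }
    where
    module P = Primitive (primitivePart f)
    module B = Bezout (bezout a P.content)
    lem : ∀ a b p q → a * p + q * (b * 1ℤ) ≡ p * a + q * b
    lem = solve-∀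

  positive-primitive : ∀ {n} (f : Vec ℤ n) → f ≢ 𝟎 → ∃[ P ] 0ℤ < Primitive.content {f = f} P
  positive-primitive [] ne = ⊥-elim (ne refl)
  positive-primitive f@(_ ∷ _) ne with primitivePart f
  ... | P@record { content = +[1+ k ] } = P , +<+ (s≤s z≤n)
  ... | P@record { content = +0 ; part = p ; f≡ = e } = ⊥-elim (ne (trans e (0⊙ p)))
  ... | record { content = -[1+ k ] ; part = p ; point = x ; f≡ = e ; unit = u } = record
    { content = +[1+ k ] ; part = - 1ℤ ⊙ p ; point = - 1ℤ ⊙ x
    ; f≡ = trans e (sym (trans (⊙-⊙ +[1+ k ] (- 1ℤ) p) (cong (_⊙ p) (ℤ.*-comm +[1+ k ] (- 1ℤ) ⟨trans⟩ ℤ.-1*i≡-i +[1+ k ]))))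
    ; unit = trans (⊙-∙ (- 1ℤ) p (- 1ℤ ⊙ x)) (trans (cong (- 1ℤ *_) (∙-⊙ p (- 1ℤ) x)) (cong (λ z → - 1ℤ * (- 1ℤ * z)) u)) } , +<+ (s≤s z≤n)
    where
    _⟨trans⟩_ = trans

  module _ {n : ℕ} where

    Weights : Set
    Weights = List (ℤ × Vec ℤ n)

    value : Weights → Vec ℤ n → ℤ
    value ws x = sumBy (λ w → proj₁ w * (proj₂ w ∙ x)) ws

    PosWeights : List (Vec ℤ n) → Weights → Set
    PosWeights V = All λ w → 0ℤ < proj₁ w × proj₂ w ∈ V

    Represents : ℤ → Vec ℤ n → Weights → Set
    Represents D h ws = ∀ x → D * (h ∙ x) ≡ value ws x

    -- The nested multipliers of `InCone` are merged into one common denominator, and generators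
    -- with coefficient 0 are left out.
    weights : ∀ (V : List (Vec ℤ n)) {h} → InCone V h → ∃[ D ] ∃[ ws ] 0ℤ < D × PosWeights V ws × Represents D h ws
    weights [] refl = 1ℤ , [] , 0<1 , [] , λ x → cong (1ℤ *_) (𝟎-∙ x)
    weights (v ∷ V) {h} (K , c , K>0 , c≥0 , r) with weights V r
    ... | D , ws , D>0 , pos , rep with 0ℤ <⊎≤ c
    ... | inj₁ c>0 = D * K , (D * c , v) ∷ ws , 0<* D>0 K>0 , (0<* D>0 c>0 , here refl) ∷ All.map (λ { (a , b) → a , there b }) pos , λ x →
      trans (trans (lem D K c (h ∙ x) (v ∙ x)) (cong (λ z → D * c * (v ∙ x) + D * z) (sym (eval x)))) (+-congˡ (D * c * (v ∙ x)) (rep x))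
      where
      lem : ∀ D K c a b → D * K * a ≡ D * c * b + D * (K * a - c * b)
      lem = solve-∀
      eval : ∀ x → (K ⊙ h ⊖ c ⊙ v) ∙ x ≡ K * (h ∙ x) - c * (v ∙ x)
      eval x = trans (⊖-∙ (K ⊙ h) (c ⊙ v) x) (cong₂ _-_ (⊙-∙ K h x) (⊙-∙ c v x))
    ... | inj₂ c≤0 = D * K , ws , 0<* D>0 K>0 , All.map (λ { (a , b) → a , there b }) pos , λ x →
      trans (trans (lem D K (h ∙ x) (v ∙ x)) (cong (λ z → D * (K * (h ∙ x) - z * (v ∙ x))) (sym c≡0)))
        (trans (cong (D *_) (sym (eval x))) (rep x))
      where
      c≡0 = ℤ.≤-antisym c≤0 c≥0
      lem : ∀ D K a b → D * K * a ≡ D * (K * a - 0ℤ * b)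
      lem = solve-∀
      eval : ∀ x → (K ⊙ h ⊖ c ⊙ v) ∙ x ≡ K * (h ∙ x) - c * (v ∙ x)
      eval x = trans (⊖-∙ (K ⊙ h) (c ⊙ v) x) (cong₂ _-_ (⊙-∙ K h x) (⊙-∙ c v x))

    drop-zeros : ∀ {V} (ws : Weights) → All (λ w → 0ℤ ≤ proj₁ w × proj₂ w ∈ V) ws →
      ∃[ us ] PosWeights V us × (∀ x → value us x ≡ value ws x) × length us ℕ.≤ length ws ×
        (∀ {w} → w ∈ ws → proj₁ w ≡ 0ℤ → length us ℕ.< length ws)
    drop-zeros [] [] = [] , [] , (λ _ → refl) , z≤n , λ ()
    drop-zeros ((c , f) ∷ ws) ((c≥0 , f∈) ∷ p) with drop-zeros ws p | 0ℤ <⊎≤ c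
    ... | us , pos , val , len , str | inj₁ c>0 = (c , f) ∷ us , (c>0 , f∈) ∷ pos , (λ x → +-congˡ (c * (f ∙ x)) (val x)) , s≤s len ,
      λ { (here refl) e → ⊥-elim (ℤ.<-irrefl (sym e) c>0) ; (there i) e → s≤s (str i e) }
    ... | us , pos , val , len , str | inj₂ c≤0 = us , pos , (λ x → trans (val x)
      (sym (trans (cong (λ z → z * (f ∙ x) + value ws x) (ℤ.≤-antisym c≤0 c≥0)) (ℤ.+-identityˡ (value ws x))))) , ℕ.m≤n⇒m≤1+n len , λ _ _ →
      s≤s len

    -- The ratio test of the simplex method: the chosen entry minimises c / e among those with e > 0.
    min-ratio : ∀ (ts : List (ℤ × ℤ × Vec ℤ n)) → All (λ t → 0ℤ < proj₁ (proj₂ t)) ts →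
      All (λ t → proj₁ t ≤ 0ℤ) ts ⊎ ∃[ t ] t ∈ ts × 0ℤ < proj₁ t × All (λ s → 0ℤ ≤ proj₁ t * proj₁ (proj₂ s) - proj₁ (proj₂ t) * proj₁ s) ts
    min-ratio [] [] = inj₁ []
    min-ratio ((e , c , f) ∷ ts) (c>0 ∷ p) with min-ratio ts p | 0ℤ <⊎≤ e
    ... | inj₁ all≤ | inj₂ e≤0 = inj₁ (e≤0 ∷ all≤)
    ... | inj₁ all≤ | inj₁ e>0 = inj₂ (_ , here refl , e>0 , ℤ.≤-reflexive (lem e c) ∷ All.zipWith
      (λ { {e₁ , c₁ , _} (le , c₁>0) → subst (0ℤ ≤_) (lem′ e c₁ c e₁) (0≤+ (0≤* (ℤ.<⇒≤ e>0) (ℤ.<⇒≤ c₁>0))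
      (0≤* (ℤ.<⇒≤ c>0) (ℤ.neg-mono-≤ le))) }) (all≤ , p))
      where
      lem : ∀ e c → 0ℤ ≡ e * c - c * e
      lem = solve-∀
      lem′ : ∀ e c₁ c e₁ → e * c₁ + c * - e₁ ≡ e * c₁ - c * e₁
      lem′ = solve-∀
    ... | inj₂ ((e₁ , c₁ , f₁) , i , e₁>0 , q) | _ with 0ℤ <⊎≤ (c₁ * e - e₁ * c)
    ... | inj₂ le = inj₂ (_ , there i , e₁>0 , subst (0ℤ ≤_) (lem c₁ e e₁ c) (ℤ.neg-mono-≤ le) ∷ q)
      where
      lem : ∀ c₁ e e₁ c → - (c₁ * e - e₁ * c) ≡ e₁ * c - c₁ * e
      lem = solve-∀
    ... | inj₁ lt = inj₂ (_ , here refl , e>0 , ℤ.≤-reflexive (lem₀ e c) ∷ All.zipWith (λ { {t} (a , b) → step t a b }) (q , p))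
      where
      c₁>0 = All.lookup p i
      lem₀ : ∀ e c → 0ℤ ≡ e * c - c * e
      lem₀ = solve-∀
      e>0 : 0ℤ < e
      e>0 = 0<-cancel c₁>0 (subst (0ℤ <_) (lem c₁ e e₁ c) (0<+ˡ lt (0≤* (ℤ.<⇒≤ e₁>0) (ℤ.<⇒≤ c>0))))
        where
        lem : ∀ c₁ e e₁ c → c₁ * e - e₁ * c + e₁ * c ≡ c₁ * e
        lem = solve-∀
      step : ∀ t → 0ℤ ≤ e₁ * proj₁ (proj₂ t) - c₁ * proj₁ t → 0ℤ < proj₁ (proj₂ t) → 0ℤ ≤ e * proj₁ (proj₂ t) - c * proj₁ t
      step (e₂ , c₂ , _) a b with 0ℤ <⊎≤ e₂
      ... | inj₂ le = subst (0ℤ ≤_) (lem e c₂ c e₂) (0≤+ (0≤* (ℤ.<⇒≤ e>0) (ℤ.<⇒≤ b)) (0≤* (ℤ.<⇒≤ c>0) (ℤ.neg-mono-≤ le)))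
        where
        lem : ∀ e c₁ c e₁ → e * c₁ + c * - e₁ ≡ e * c₁ - c * e₁
        lem = solve-∀
      ... | inj₁ e₂>0 = 0≤-cancel e₁>0 (subst (0ℤ ≤_) (lem e e₁ e₂ c c₁ c₂) (0≤+ (0≤* (ℤ.<⇒≤ e>0) a) (0≤* (ℤ.<⇒≤ e₂>0) (ℤ.<⇒≤ lt))))
        where
        lem : ∀ e e₁ e₂ c c₁ c₂ → e * (e₁ * c₂ - c₁ * e₂) + e₂ * (c₁ * e - e₁ * c) ≡ e₁ * (e * c₂ - c * e₂)
        lem = solve-∀

    -- While more than n functionals occur, a multiple of a linear dependency is subtracted, just
    -- large enough to make one weight vanish.
    caratheodory : ∀ {V D h} (ws : Weights) → 0ℤ < D → PosWeights V ws → Represents D h ws →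
      ∃[ D′ ] ∃[ us ] 0ℤ < D′ × PosWeights V us × Represents D′ h us × length us ℕ.≤ n
    caratheodory {V} {h = h} ws D>0 pos rep = go (length ws) ws ℕ.≤-refl D>0 pos rep
      where
      go : ∀ k {D} (ws : Weights) → length ws ℕ.≤ k → 0ℤ < D → PosWeights V ws → Represents D h ws →
        ∃[ D′ ] ∃[ us ] 0ℤ < D′ × PosWeights V us × Represents D′ h us × length us ℕ.≤ n
      go k ws len D>0 pos rep with length ws ℕ.≤? n
      ... | yes le = _ , ws , D>0 , pos , rep , le
      go zero [] len D>0 pos rep | no many = ⊥-elim (many z≤n)
      go (suc k) {D} ws len D>0 pos rep | no many with dependency proj₂ ws (ℕ.≰⇒> many)
      ... | ts , refl , nz , bal with pivot-entry
        where
        cpos : All (λ t → 0ℤ < proj₁ (proj₂ t)) ts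
        cpos = All.map (λ { (a , _) → a }) (All.map⁻ pos)
        neg = λ (t : ℤ × ℤ × Vec ℤ n) → - proj₁ t , proj₂ t
        bal⁻ : ∀ x → sumBy (λ t → proj₁ t * (proj₂ (proj₂ t) ∙ x)) (List.map neg ts) ≡ 0ℤ
        bal⁻ x = trans (sumBy-map _ _ ts) (trans (sumBy-cong ts (All.tabulate λ {t} _ → lem (proj₁ t) (proj₂ (proj₂ t) ∙ x)))
          (trans (sumBy-scale (- 1ℤ) (λ t → proj₁ t * (proj₂ (proj₂ t) ∙ x)) ts) (cong (- 1ℤ *_) (bal x))))
          where
          lem : ∀ a b → - a * b ≡ - 1ℤ * (a * b)
          lem = solve-∀
        pivot-entry : ∃[ us ] List.map proj₂ us ≡ List.map proj₂ ts × (∀ x → sumBy (λ t → proj₁ t * (proj₂ (proj₂ t) ∙ x)) us ≡ 0ℤ) ×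
          ∃[ t ] t ∈ us × 0ℤ < proj₁ t × All (λ s → 0ℤ ≤ proj₁ t * proj₁ (proj₂ s) - proj₁ (proj₂ t) * proj₁ s) us
        pivot-entry with min-ratio ts cpos
        ... | inj₂ r = ts , refl , bal , r
        -- A dependency without positive coefficient is negated; being nonzero, it then has one.
        ... | inj₁ le with min-ratio (List.map neg ts) (All.map⁺ cpos)
        ...   | inj₂ r = List.map neg ts , sym (List.map-∘ ts) , bal⁻ , r
        ...   | inj₁ ge = ⊥-elim (nz (All.zipWith (λ { {t} (a , b) → ℤ.≤-antisym a
          (subst (0ℤ ≤_) (ℤ.neg-involutive (proj₁ t)) (ℤ.neg-mono-≤ b)) }) (le , All.map⁻ ge)))
      -- The new common denominator is e · D. The ratio test keeps the new weights nonnegative, and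
      -- that of the chosen entry is e c - c e = 0.
      ... | us , eq , bal′ , (e , c , f) , i , e>0 , ratio
        with drop-zeros {V} (List.map (λ t → e * proj₁ (proj₂ t) - c * proj₁ t , proj₂ (proj₂ t)) us)
               (All.map⁺ (All.zipWith (λ { (a , _ , b) → a , b }) (ratio , All.map⁻ (subst (PosWeights V) (sym eq) pos))))
      ... | ws′ , pos′ , val , _ , str = go k ws′ (ℕ.s≤s⁻¹ (ℕ.≤-trans (ℕ.≤-trans (str (∈-map⁺ _ i) (lem₀ e c))
        (ℕ.≤-reflexive (trans (List.length-map _ us) (trans (sym (List.length-map proj₂ us)) (cong length eq))))) len))
          (0<* e>0 D>0) pos′ λ x → trans (ℤ.*-assoc e D (h ∙ x)) (sym (trans (val x) (trans (sumBy-map _ _ us)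
            (trans (sumBy-cong us (All.tabulate λ {t} _ → lem e c (proj₁ t) (proj₁ (proj₂ t)) (proj₂ (proj₂ t) ∙ x)))
            (trans (sumBy-linear e (- c) (λ t → proj₁ (proj₂ t) * (proj₂ (proj₂ t) ∙ x)) (λ t → proj₁ t * (proj₂ (proj₂ t) ∙ x)) us)
            (trans (cong₂ (λ a b → e * a + - c * b) (trans (sym (sumBy-map proj₂ (λ w → proj₁ w * (proj₂ w ∙ x)) us))
              (trans (cong (λ l → value l x) eq) (sym (rep x)))) (bal′ x)) (lem₁ (e * (D * (h ∙ x))) c)))))))
        where
        lem₀ : ∀ e c → e * c - c * e ≡ 0ℤ
        lem₀ = solve-∀
        lem : ∀ e c e₁ c₁ a → (e * c₁ - c * e₁) * a ≡ e * (c₁ * a) + - c * (e₁ * a)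
        lem = solve-∀
        lem₁ : ∀ a c → a + - c * 0ℤ ≡ a
        lem₁ = solve-∀

  -- Gorenstein cones

  ∑ᵛ : ∀ {n} → List (Vec ℤ n) → Vec ℤ n
  ∑ᵛ = List.foldr _⊕_ 𝟎

  ∙-∑ᵛ : ∀ {n} (f : Vec ℤ n) vs → f ∙ ∑ᵛ vs ≡ sumBy (f ∙_) vs
  ∙-∑ᵛ f [] = ∙-𝟎 f
  ∙-∑ᵛ f (v ∷ vs) = trans (∙-⊕ f v (∑ᵛ vs)) (+-congˡ (f ∙ v) (∙-∑ᵛ f vs))

  sumBy-length : ∀ {A : Set} {g : A → ℤ} {xs} → All (λ x → g x ≡ 1ℤ) xs → sumBy g xs ≡ + length xs
  sumBy-length [] = refl
  sumBy-length {xs = _ ∷ xs} (e ∷ es) = cong₂ _+_ e (sumBy-length es)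

  ⊟-involutive : ∀ {n} (x : Vec ℤ n) → ⊟ (⊟ x) ≡ x
  ⊟-involutive [] = refl
  ⊟-involutive (a ∷ x) = cong₂ _∷_ (ℤ.neg-involutive a) (⊟-involutive x)

  unique-⊆-length : ∀ {A : Set} {xs ys : List A} → Unique xs → Unique ys → All (_∈ ys) xs → length xs ℕ.≤ length ys
  unique-⊆-length [] _ _ = z≤n
  unique-⊆-length {xs = x ∷ xs} (p ∷ u) v (i ∷ is) with remove i v
  ... | zs , u′ , _ , _ , cov , _ , len = subst (suc (length xs) ℕ.≤_) (sym len)
    (s≤s (unique-⊆-length u u′ (All.zipWith (λ { (ne , j) → [ (λ e → ⊥-elim (ne (sym e))) , (λ k → k) ]′ (cov j) }) (p , is))))

  unique-⊆-full : ∀ {n} {xs ys : List (Vec ℤ n)} → Unique xs → Unique ys → All (_∈ ys) xs → length ys ℕ.≤ length xs → ∀ {y} → y ∈ ys → y ∈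
    xs
  unique-⊆-full {xs = xs} u v sub len {y} i with DecMembership._∈?_ _≟ᵛ_ y xs
  ... | yes j = j
  ... | no ∉ = ⊥-elim (ℕ.<⇒≱ (unique-⊆-length (All.tabulate (λ j e → ∉ (subst (_∈ xs) (sym e) j)) ∷ u) v (i ∷ sub)) len)

  length-pos : ∀ {A : Set} {x : A} {xs} → x ∈ xs → 0ℤ < + length xs
  length-pos (here _) = +<+ (s≤s z≤n)
  length-pos (there _) = +<+ (s≤s z≤n)

  pos-length : ∀ {A : Set} (xs : List A) → 0ℤ < + length xs → ∃[ x ] x ∈ xs
  pos-length [] (+<+ ())
  pos-length (x ∷ xs) _ = x , here refl

  height : ∀ {n} → Vec ℤ (suc n)
  height = 1ℤ ∷ 𝟎

  height-∙ : ∀ {n} m (v : Vec ℤ n) → height ∙ (m ∷ v) ≡ m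
  height-∙ m v = trans (cong₂ _+_ (ℤ.*-identityˡ m) (𝟎-∙ v)) (ℤ.+-identityʳ m)

  -- Nonnegative integral functionals with sum the height take at each vertex the value 1 once and 0
  -- otherwise. The index of the 1 tells to which Cayley summand the vertex belongs, and
  -- `summands-nonzero` makes every summand nonempty.
  record Decomposition {n} (d : ℕ) (V : List (Vec ℤ n)) : Set where
    field
      q s : ℕ
      n≡q+s : n ≡ q ℕ.+ s
      q≤2d-1 : q ℕ.≤ 2 ℕ.* d ∸ 1
      summands : List (Vec ℤ (suc n))
      count : length summands ≡ suc s
      summands-nonneg : All (λ e → All (λ v → 0ℤ ≤ e ∙ v) (List.map (1ℤ ∷_) V)) summands
      summands-nonzero : All (λ e → ∃[ v ] v ∈ V × 0ℤ < e ∙ (1ℤ ∷ v)) summands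
      summands-total : ∀ x → sumBy (_∙ x) summands ≡ height ∙ x

  module Gorenstein {n d : ℕ} (V : List (Vec ℤ n)) (L : ℕ → ℕ)
    (ehrhart : ∀ m → HasCardinality (λ v → InCone (List.map (1ℤ ∷_) V) (+ m ∷ v)) (L m))
    (spanning : ∀ f → All (λ v → f ∙ (1ℤ ∷ v) ≡ 0ℤ) V → f ≡ 𝟎)
    (h* : PowerSeries) (series : ∀ k → ((1-t ^ˢ suc n) ⊛ (λ m → + L m)) k ≡ h* k)
    (degree : IsPolynomialOfDegree h* d) (symmetric : ∀ i → i ℕ.≤ d → h* i ≡ h* (d ∸ i)) where

    V̂ : List (Vec ℤ (suc n))
    V̂ = List.map (1ℤ ∷_) V

    private
      F : HalfSpaces V̂
      F = weyl V̂

    abstract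
      K : List (Vec ℤ (suc n))
      K = proj₁ (irredundant (HalfSpaces.facets F))

      K-irredundant : Irredundant K K
      K-irredundant = proj₂ (proj₂ (proj₂ (irredundant (HalfSpaces.facets F))))

      private
        K⊆F : All (_∈ HalfSpaces.facets F) K
        K⊆F = proj₁ (proj₂ (proj₂ (irredundant (HalfSpaces.facets F))))

      to-nonneg : ∀ {x} → InCone V̂ x → Nonneg K x
      to-nonneg c = All.map (λ i → All.lookup (HalfSpaces.sound F c) i) K⊆F

      from-nonneg : ∀ {x} → Nonneg K x → InCone V̂ x
      from-nonneg p = HalfSpaces.complete F (proj₁ (proj₂ (irredundant (HalfSpaces.facets F))) p)

      K-nonneg : All (λ f → All (λ v → 0ℤ ≤ f ∙ v) V̂) K
      K-nonneg = All.map (All.lookup (HalfSpaces.nonneg F)) K⊆F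

    Interior : Vec ℤ (suc n) → Set
    Interior x = All (λ f → 0ℤ < f ∙ x) K

    K-nonzero : All (_≢ 𝟎) K
    K-nonzero = All.map (λ { (y , neg , _) refl → ℤ.<-irrefl (𝟎-∙ y) neg }) K-irredundant

    w₀ : Vec ℤ (suc n)
    w₀ = ∑ᵛ V̂

    -- If `f` were 0 on the sum of the generators, it would be 0 on each of them, and therefore zero
    -- because they span.
    w₀-interior : Interior w₀
    w₀-interior = All.zipWith (λ { {f} (nn , nz) → step f nn nz }) (K-nonneg , K-nonzero)
      where
      step : ∀ f → All (λ v → 0ℤ ≤ f ∙ v) V̂ → f ≢ 𝟎 → 0ℤ < f ∙ w₀
      step f nn nz with 0ℤ <⊎≤ (f ∙ w₀)
      ... | inj₁ p = p
      ... | inj₂ le = ⊥-elim (nz (spanning f (All.map⁻ (sumBy-nonneg-zero nn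
        (trans (sym (∙-∑ᵛ f V̂)) (ℤ.≤-antisym le (subst (0ℤ ≤_) (sym (∙-∑ᵛ f V̂)) (sumBy-nonneg nn))))))))

    height-nonneg : ∀ {m v} → Nonneg K (m ∷ v) → 0ℤ ≤ m
    height-nonneg {m} {v} p = subst (0ℤ ≤_) (height-∙ m v) (InCone-nonneg V̂ height
      (All.map⁺ (All.tabulate λ {v} _ → subst (0ℤ ≤_) (sym (height-∙ 1ℤ v)) (ℤ.<⇒≤ 0<1))) (from-nonneg p))

    points : ℤ → List (Vec ℤ n)
    points (+ m) = proj₁ (ehrhart m)
    points -[1+ m ] = []

    points-unique : ∀ m → Unique (points m)
    points-unique (+ m) = proj₁ (proj₂ (ehrhart m))
    points-unique -[1+ m ] = []

    ∈-points : ∀ m {v} → Nonneg K (m ∷ v) → v ∈ points m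
    ∈-points (+ m) {v} p = Equivalence.from (proj₁ (proj₂ (proj₂ (ehrhart m))) v) (from-nonneg p)
    ∈-points -[1+ m ] p with height-nonneg p
    ... | ()

    points-∈ : ∀ m {v} → v ∈ points m → Nonneg K (m ∷ v)
    points-∈ (+ m) {v} i = to-nonneg (Equivalence.to (proj₁ (proj₂ (proj₂ (ehrhart m))) v) i)

    points-length : ∀ m → extend (λ k → + L k) [ m ]ᵛ ≡ + length (points m)
    points-length (+ m) = cong +_ (sym (proj₂ (proj₂ (proj₂ (ehrhart m)))))
    points-length -[1+ m ] = refl

    interior? : ∀ x → Dec (Interior x)
    interior? x = All.all? (λ f → 0ℤ ℤ.<? f ∙ x) K

    interior-nonneg : ∀ {x} → Interior x → Nonneg K x
    interior-nonneg = All.map ℤ.<⇒≤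

    interior-points : ℤ → List (Vec ℤ n)
    interior-points m = filter (λ v → interior? (m ∷ v)) (points m)

    I : PowerSeries
    I m = + length (interior-points (+ m))

    interior-points-length : ∀ m → extend I [ m ]ᵛ ≡ + length (interior-points m)
    interior-points-length (+ m) = refl
    interior-points-length -[1+ m ] = refl

    interior-points-unique : ∀ m → Unique (interior-points m)
    interior-points-unique m = Unique.filter⁺ (λ v → interior? (m ∷ v)) (points-unique m)

    ∈-interior-points : ∀ m {v} → Interior (m ∷ v) → v ∈ interior-points m
    ∈-interior-points m p = ∈-filter⁺ (λ v → interior? (m ∷ v)) (∈-points m (interior-nonneg p)) p

    interior-points-∈ : ∀ m {v} → v ∈ interior-points m → Interior (m ∷ v)
    interior-points-∈ m i = proj₂ (∈-filter⁻ (λ v → interior? (m ∷ v)) {xs = points m} i)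

    private
      ∏-one : ∀ (l : List (Signed (suc n))) x → All (λ s → HasSign (proj₁ s) (proj₂ s ∙ x)) l → ∏ l x ≡ 1ℤ
      ∏-one [] x [] = refl
      ∏-one ((b , f) ∷ l) x (p ∷ ps) = cong₂ _*_ (indicator b (f ∙ x) p) (∏-one l x ps)
        where
        indicator : ∀ b z → HasSign b z → ⟦ b ⟧ z ≡ 1ℤ
        indicator true (+ _) _ = refl
        indicator false -[1+ _ ] _ = refl
        indicator false (+ _) (+<+ ())
        indicator true -[1+ _ ] ()

      ∏-nonzero : ∀ (l : List (Signed (suc n))) x → ∏ l x ≢ 0ℤ → All (λ s → HasSign (proj₁ s) (proj₂ s ∙ x)) l
      ∏-nonzero l x ne with ∏-value l x
      ... | inj₁ e = ⊥-elim (ne e)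
      ... | inj₂ p = p

      opposite : ∀ {x} → All (λ f → f ∙ x < 0ℤ) K → Interior (⊟ x)
      opposite {x} = All.map λ {f} p → subst (0ℤ <_) (sym (∙-⊟ f x)) (ℤ.neg-mono-< p)

      opposite⁻ : ∀ {x} → Interior (⊟ x) → All (λ f → f ∙ x < 0ℤ) K
      opposite⁻ {x} = All.map λ {f} p → subst (_< 0ℤ) (trans (cong -_ (∙-⊟ f x)) (ℤ.neg-involutive (f ∙ x))) (ℤ.neg-mono-< p)

    push-by-list : ∀ (l : List (Signed (suc n))) (P : ℤ → List (Vec ℤ n)) → (∀ m → Unique (P m)) →
      (∀ m v → All (λ s → HasSign (proj₁ s) (proj₂ s ∙ (m ∷ v))) l → v ∈ P m) →
      (∀ m v → v ∈ P m → All (λ s → HasSign (proj₁ s) (proj₂ s ∙ (m ∷ v))) l) →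
      (ĝ : Seq) → (∀ m → ĝ [ m ]ᵛ ≡ + length (P m)) → PushForward (∏ l) ĝ
    push-by-list l P u to from ĝ len = record
      { support = P
      ; finite = λ m v ne → to m v (∏-nonzero l _ ne)
      ; total = λ m X uX sup → trans (len m) (trans (sym (sumBy-length (All.tabulate λ {v} i → ∏-one l _ (from m v i))))
          (sumBy-ext dec⊎ _ (P m) X (u m) uX (λ v ne _ → sup v ne) (λ v ne _ → to m v (∏-nonzero l _ ne)))) }

    push-cone : PushForward (∏ (all true K)) (extend (λ k → + L k))
    push-cone = push-by-list _ points points-unique (λ m v p → ∈-points m (All.map⁻ p)) (λ m v i → All.map⁺ (points-∈ m i)) _ points-length

    -- All functionals are negative exactly at the opposites of interior points, whence the
    -- reflection.
    push-interior : PushForward (∏ (all false K)) (reflect (extend I))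
    push-interior = push-by-list _ (λ m → List.map ⊟_ (interior-points (- m)))
      (λ m → Unique.map⁺ ⊟-injective (interior-points-unique (- m)))
      (λ m v p → subst (_∈ _) (⊟-involutive v) (∈-map⁺ ⊟_ (∈-interior-points (- m) (opposite (All.map⁻ p)))))
      (λ m v i → let u , j , e = ∈-map⁻ ⊟_ i in All.map⁺ (opposite⁻ (subst (λ z → Interior (- m ∷ z)) (trans (sym (⊟-involutive u)) (cong ⊟_ (sym e))) (interior-points-∈ (- m) j))))
      _ (λ m → trans (interior-points-length (- m)) (cong +_ (sym (List.length-map ⊟_ (interior-points (- m))))))
      where
      ⊟-injective : ∀ {x y : Vec ℤ n} → ⊟ x ≡ ⊟ y → x ≡ y
      ⊟-injective {x} {y} e = trans (sym (⊟-involutive x)) (trans (cong ⊟_ e) (⊟-involutive y))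

    r : ℤ
    r = + suc n - + d

    -- Reciprocity for the facet functionals, pushed to heights and combined with the symmetry of
    -- `h*`. The cone has dimension n + 1, the exponent of the denominator.
    shifted : ∀ m → + length (interior-points m) ≡ + length (points (m - r))
    shifted m = trans (sym (interior-points-length m)) (trans
      (interior-shift {suc n} {d} (λ k → + L k) I h* (λ k → trans (sym (1-t^-⊛ (suc n) _ k)) (series k)) degree symmetric
        (push-torsion (push-combine 1ℤ (- (-1^ (suc n))) push-interior push-cone)
          (torsion-cong (λ x → lem (∏ (all false K) x) (∏ (all true K) x) (-1^ (suc n))) (reciprocity K w₀-interior))) m)
      (points-length (m - r)))
      where
      lem : ∀ a b s → 1ℤ * a + - s * b ≡ a - s * b
      lem = solve-∀

    -- Height r has as many interior points as height 0 has points of the cone, and the latter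
    -- contains the apex.
    interior-point : ∃[ u ] Interior (r ∷ u)
    interior-point = let u , i = pos-length (interior-points r) (subst (0ℤ <_) (sym (shifted r))
                                   (length-pos (∈-points (r - r) (subst (λ z → Nonneg K (z ∷ 𝟎)) (sym (ℤ.+-inverseʳ r)) (All.tabulate λ {f} _ → ℤ.≤-reflexive (sym (∙-𝟎 f)))))))
                     in u , interior-points-∈ r i

    abstract
      u : Vec ℤ n
      u = proj₁ interior-point

      u-interior : Interior (r ∷ u)
      u-interior = proj₂ interior-point

    û : Vec ℤ (suc n)
    û = r ∷ u

    û-interior : Interior û
    û-interior = u-interior

    -- Translation by û embeds the lattice points of the cone into the interior ones, and both have equally many in each height.
    interior-minus-û : ∀ {x} → Interior x → Nonneg K (x ⊖ û)
    interior-minus-û {m ∷ v} p = let v′ , i , e = ∈-map⁻ (_⊕ u) (unique-⊆-full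
                                        (Unique.map⁺ (λ {x} {y} → ⊕-injective u {x} {y}) (points-unique (m - r))) (interior-points-unique m)
                                        (All.map⁺ (All.tabulate λ {v′} i → ∈-interior-points m (add v′ (points-∈ (m - r) i))))
                                        (ℕ.≤-reflexive (trans (ℤ.+-injective (shifted m)) (sym (List.length-map (_⊕ u) (points (m - r))))))
                                        (∈-interior-points m p))
                                 in subst (λ z → Nonneg K (m - r ∷ z)) (trans (sym (⊕-⊖ v′ u)) (cong (_⊖ u) (sym e))) (points-∈ (m - r) i)
      where
      ⊕-injective : ∀ {k} (a : Vec ℤ k) {x y} → x ⊕ a ≡ y ⊕ a → x ≡ y
      ⊕-injective a {x} {y} e = trans (sym (⊕-⊖ x a)) (trans (cong (_⊖ a) e) (⊕-⊖ y a))
      lem : ∀ m r → m - r + r ≡ m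
      lem = solve-∀
      add : ∀ v′ → Nonneg K (m - r ∷ v′) → Interior (m ∷ v′ ⊕ u)
      add v′ q = subst (λ z → Interior (z ∷ v′ ⊕ u)) (lem m r) (All.zipWith (λ { {f} (a , b) → subst (0ℤ <_) (sym (∙-⊕ f (m - r ∷ v′) û)) (0<+ʳ a b) }) (q , û-interior))

    -- f attains its least positive value c at the interior point x₀ + M z, so subtracting û from that point shows f(û) = c.
    record Facet (f : Vec ℤ (suc n)) : Set where
      field
        multiplicity : ℤ
        normal : Vec ℤ (suc n)
        positive : 0ℤ < multiplicity
        f≡ : ∀ x → f ∙ x ≡ multiplicity * (normal ∙ x)
        distance : normal ∙ û ≡ 1ℤ

    facet : ∀ {f} → f ∈ K → Facet f
    facet {f} i with positive-primitive f (All.lookup K-nonzero i) | All.lookup K-irredundant i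
    ... | P , c>0 | y , fy<0 , others = record { multiplicity = c ; normal = p ; positive = c>0 ; f≡ = fx ; distance = ℤ.≤-antisym ≤1 ≥1 }
      where
      open Primitive P renaming (content to c; part to p; point to x₀)
      -- The point where the segment from `y` to `w₀` crosses f = 0, up to scaling: every functional
      -- of `K` other than `f` is positive there, so it lies inside the facet.
      z : Vec ℤ (suc n)
      z = f ∙ w₀ ⊙ y ⊖ f ∙ y ⊙ w₀
      fx : ∀ x → f ∙ x ≡ c * (p ∙ x)
      fx x = trans (cong (_∙ x) f≡) (⊙-∙ c p x)
      fw>0 = All.lookup w₀-interior i
      fz : f ∙ z ≡ 0ℤ
      fz = trans (∙-comb f (f ∙ w₀) y (f ∙ y) w₀) (lem (f ∙ w₀) (f ∙ y))
        where
        lem : ∀ a b → a * b - b * a ≡ 0ℤ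
        lem = solve-∀
      gz : ∀ g → 0ℤ < g ∙ w₀ → 0ℤ ≤ g ∙ y → 0ℤ < g ∙ z
      gz g gw gy = subst (0ℤ <_) (trans (lem (f ∙ w₀) (g ∙ y) (f ∙ y) (g ∙ w₀)) (sym (∙-comb g (f ∙ w₀) y (f ∙ y) w₀)))
        (0<+ʳ (0≤* (ℤ.<⇒≤ fw>0) gy) (0<* (ℤ.neg-mono-< fy<0) gw))
        where
        lem : ∀ a b c d → a * b + - c * d ≡ a * b - c * d
        lem = solve-∀
      B = proj₁ (lowerBound x₀ K)
      -- `B` bounds all values of `K` at `x₀` from below, and the other functionals are at least 1
      -- at `z`; hence M + B > 0 makes x₀ + M z interior while `f` keeps its value `c`.
      M = +[1+ ∣ B ∣ ]
      M+B>0 : ∀ b → 0ℤ < +[1+ ∣ b ∣ ] + b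
      M+B>0 (+ k) = +<+ (s≤s z≤n)
      M+B>0 -[1+ k ] = subst (0ℤ <_) (sym (trans (ℤ.⊖-≥ {suc (suc k)} {suc k} (ℕ.n≤1+n _)) (cong +_ (ℕ.m+n∸n≡m 1 (suc k))))) 0<1
      x : Vec ℤ (suc n)
      x = x₀ ⊕ M ⊙ z
      eval : ∀ g → g ∙ x ≡ g ∙ x₀ + M * (g ∙ z)
      eval g = trans (∙-⊕ g x₀ (M ⊙ z)) (+-congˡ (g ∙ x₀) (∙-⊙ g M z))
      fx≡c : f ∙ x ≡ c
      fx≡c = trans (eval f) (trans (cong₂ (λ a b → a + M * b) (trans (fx x₀) (cong (c *_) unit)) fz) (lem c M))
        where
        lem : ∀ c m → c * 1ℤ + m * 0ℤ ≡ c
        lem = solve-∀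
      x-interior : Interior x
      x-interior = All.tabulate λ {g} j → step g (All.lookup others j) (All.lookup w₀-interior j) (All.lookup (proj₂ (lowerBound x₀ K)) j)
        where
        step : ∀ g → g ≡ f ⊎ 0ℤ ≤ g ∙ y → 0ℤ < g ∙ w₀ → B ≤ x₀ ∙ g → 0ℤ < g ∙ x
        step g (inj₁ refl) _ _ = subst (0ℤ <_) (sym fx≡c) c>0
        step g (inj₂ gy) gw le = subst (0ℤ <_) (trans (ℤ.+-comm (M * (g ∙ z)) (g ∙ x₀)) (sym (eval g)))
          (ℤ.<-≤-trans (M+B>0 B) (ℤ.+-mono-≤ (subst (_≤ M * (g ∙ z)) (ℤ.*-identityʳ M) (ℤ.*-monoˡ-≤-nonNeg M (ℤ.i<j⇒suc[i]≤j (gz g gw gy))))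
            (subst (B ≤_) (∙-comm x₀ g) le)))
      ≥1 : 1ℤ ≤ p ∙ û
      ≥1 = ℤ.i<j⇒suc[i]≤j (0<-cancel c>0 (subst (0ℤ <_) (fx û) (All.lookup û-interior i)))
      ≤1 : p ∙ û ≤ 1ℤ
      ≤1 = ℤ.0≤i-j⇒j≤i (0≤-cancel c>0 (subst (0ℤ ≤_) (trans (∙-⊖ f x û) (trans (cong₂ _-_ fx≡c (fx û)) (lem c (p ∙ û))))
        (All.lookup (interior-minus-û x-interior) i)))
        where
        lem : ∀ c a → c - c * a ≡ c * (1ℤ - a)
        lem = solve-∀

    -- Coefficients ρ + q D of the expression of D · height through facet normals, divided with remainder by D.
    Term : Set
    Term = ℕ × ℕ × Vec ℤ (suc n)

    quot rem : Term → ℤ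
    quot t = + proj₁ t
    rem t = + proj₁ (proj₂ t)

    functional : Term → Vec ℤ (suc n)
    functional t = proj₂ (proj₂ t)

    Valid : ℤ → Term → Set
    Valid D t = rem t < D × functional t ∙ û ≡ 1ℤ × (∀ {x} → Nonneg K x → 0ℤ ≤ functional t ∙ x)

    -- Each functional is first replaced by its primitive normal, whose value at `û` is 1; its
    -- weight is multiplied by `multiplicity` before the division by D.
    terms : ∀ D → .{{_ : ℕ.NonZero D}} → (ws : Weights) → PosWeights K ws →
      ∃[ ts ] All (Valid (+ D)) ts × length ts ≡ length ws × (∀ x → value ws x ≡ sumBy (λ t → (rem t + quot t * + D) * (functional t ∙ x))
        ts)
    terms D [] [] = [] , [] , refl , λ _ → refl
    terms D ((c , f) ∷ ws) ((c>0 , i) ∷ pos) with terms D ws pos | facet i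
    ... | ts , valid , len , val | Φ = split-off (multiplicity * c) refl (0<* positive c>0)
      where
      open Facet Φ
      split-off : ∀ e → multiplicity * c ≡ e → 0ℤ < e → _
      split-off (+ k) eq _ = (k ℕ./ D , k ℕ.% D , normal) ∷ ts ,
        (+<+ (ℕ.m%n<n k D) , distance , λ {x} p → 0≤-cancel positive (subst (0ℤ ≤_) (f≡ x) (All.lookup p i))) ∷ valid , cong suc len ,
        λ x → cong₂ _+_ (trans (cong (c *_) (f≡ x)) (trans (lem c multiplicity (normal ∙ x))
          (cong (_* (normal ∙ x)) (trans eq (a≡a%ℕn+[a/ℕn]*n (+ k) D))))) (val x)
        where
        lem : ∀ c m a → c * (m * a) ≡ m * c * a
        lem = solve-∀
      split-off -[1+ k ] eq ()

    expand : List Term → List (Vec ℤ (suc n))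
    expand [] = []
    expand ((q , ρ , g) ∷ ts) = List.replicate q g ++ expand ts

    sumBy-expand : ∀ x ts → sumBy (_∙ x) (expand ts) ≡ sumBy (λ t → quot t * (functional t ∙ x)) ts
    sumBy-expand x [] = refl
    sumBy-expand x ((q , ρ , g) ∷ ts) = trans (rep q) (+-congˡ (+ q * (g ∙ x)) (sumBy-expand x ts))
      where
      lem : ∀ a q b → a + (q * a + b) ≡ (1ℤ + q) * a + b
      lem = solve-∀
      rep : ∀ q → sumBy (_∙ x) (List.replicate q g ++ expand ts) ≡ + q * (g ∙ x) + sumBy (_∙ x) (expand ts)
      rep zero = sym (trans (cong (_+ sumBy (_∙ x) (expand ts)) (ℤ.*-zeroˡ (g ∙ x))) (ℤ.+-identityˡ _))
      rep (suc q) = trans (+-congˡ (g ∙ x) (rep q)) (lem (g ∙ x) (+ q) (sumBy (_∙ x) (expand ts)))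

    All-expand : ∀ {P : Vec ℤ (suc n) → Set} {ts} → All (λ t → P (functional t)) ts → All P (expand ts)
    All-expand [] = []
    All-expand {ts = (q , _) ∷ _} (p ∷ ps) = All.++⁺ (All.replicate⁺ q p) (All-expand ps)

    nonzero-somewhere : ∀ e → e ≢ 𝟎 → All (λ v → 0ℤ ≤ e ∙ v) V̂ → ∃[ v ] v ∈ V × 0ℤ < e ∙ (1ℤ ∷ v)
    nonzero-somewhere e ne nn = go V (λ i → i) (All.map⁻ nn) λ z → ne (spanning e z)
      where
      go : ∀ W → (∀ {v} → v ∈ W → v ∈ V) → All (λ v → 0ℤ ≤ e ∙ (1ℤ ∷ v)) W → ¬ All (λ v → e ∙ (1ℤ ∷ v) ≡ 0ℤ) W → ∃[ v ] v ∈ V × 0ℤ < e ∙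
        (1ℤ ∷ v)
      go [] _ _ nz = ⊥-elim (nz [])
      go (v ∷ W) sub (p ∷ ps) nz with 0ℤ <⊎≤ (e ∙ (1ℤ ∷ v))
      ... | inj₁ lt = v , sub (here refl) , lt
      ... | inj₂ le = go W (sub ∘ there) ps λ z → nz (ℤ.≤-antisym le p ∷ z)

    module Assembly (D : ℤ) (D>0 : 0ℤ < D) (ts : List Term) (valid : All (Valid D) ts) (few : length ts ℕ.≤ suc n)
      (expr : ∀ x → D * (height ∙ x) ≡ sumBy (λ t → (rem t + quot t * D) * (functional t ∙ x)) ts) where

      h = height {n}
      Σρ : Vec ℤ (suc n) → ℤ
      Σρ x = sumBy (λ t → rem t * (functional t ∙ x)) ts
      Σq : Vec ℤ (suc n) → ℤ
      Σq x = sumBy (λ t → quot t * (functional t ∙ x)) ts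
      Dh : ∀ x → D * (h ∙ x) ≡ Σρ x + D * Σq x
      Dh x = trans (expr x) (trans (sumBy-cong ts (All.tabulate λ {t} _ → lem (rem t) (quot t) D (functional t ∙ x)))
        (trans (sumBy-linear 1ℤ D (λ t → rem t * (functional t ∙ x)) (λ t → quot t * (functional t ∙ x)) ts)
          (cong (_+ D * Σq x) (ℤ.*-identityˡ (Σρ x)))))
        where
        lem : ∀ ρ q D a → (ρ + q * D) * a ≡ 1ℤ * (ρ * a) + D * (q * a)
        lem = solve-∀
      -- As a difference of integral vectors `φ` is integral by construction; `Dφ` then shows that
      -- it is the sum of the fractional parts.
      φ = h ⊖ ∑ᵛ (expand ts)
      φ-∙ : ∀ x → φ ∙ x ≡ h ∙ x - Σq x
      φ-∙ x = trans (⊖-∙ h (∑ᵛ (expand ts)) x) (cong (λ z → h ∙ x - z) (trans (∙-comm _ x)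
        (trans (∙-∑ᵛ x (expand ts)) (trans (sumBy-cong (expand ts) (All.tabulate λ {e} _ → ∙-comm x e)) (sumBy-expand x ts)))))
      Dφ : ∀ x → D * (φ ∙ x) ≡ Σρ x
      Dφ x = trans (cong (D *_) (φ-∙ x)) (trans (lem D (h ∙ x) (Σq x)) (trans (cong (_- D * Σq x) (Dh x)) (lem′ (Σρ x) (D * Σq x))))
        where
        lem : ∀ D a b → D * (a - b) ≡ D * a - D * b
        lem = solve-∀
        lem′ : ∀ a b → a + b - b ≡ a
        lem′ = solve-∀
      on-V : ∀ {v} → v ∈ V̂ → Nonneg K v
      on-V i = All.map (λ p → All.lookup p i) K-nonneg
      φ-nonneg : All (λ v → 0ℤ ≤ φ ∙ v) V̂
      φ-nonneg = All.tabulate λ {v} i → 0≤-cancel D>0 (subst (0ℤ ≤_) (sym (Dφ v))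
        (sumBy-nonneg (All.map (λ { {t} (_ , _ , nn) → 0≤* {rem t} (+≤+ z≤n) (nn (on-V i)) }) valid)))
      total : Vec ℤ (suc n)
      total = ∑ᵛ (List.map functional ts)
      total-∙ : ∀ x → total ∙ x ≡ sumBy (λ t → functional t ∙ x) ts
      total-∙ x = trans (∙-comm total x) (trans (∙-∑ᵛ x (List.map functional ts))
        (trans (sumBy-map functional (x ∙_) ts) (sumBy-cong ts (All.tabulate λ {t} _ → ∙-comm x (functional t)))))
      -- D · (total − φ) = Σ (D − ρ) g with all D − ρ positive, so total − φ is positive on the polytope, hence at least 1.
      y = total ⊖ φ ⊖ h
      y-∙ : ∀ x → y ∙ x ≡ total ∙ x - φ ∙ x - h ∙ x
      y-∙ x = trans (⊖-∙ (total ⊖ φ) h x) (cong (_- h ∙ x) (⊖-∙ total φ x))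
      y-nonneg : All (λ v → 0ℤ ≤ y ∙ v) V̂
      y-nonneg = All.map⁺ (All.tabulate λ {v} i → subst (0ℤ ≤_) (sym (trans (y-∙ (1ℤ ∷ v))
        (cong (λ z → total ∙ (1ℤ ∷ v) - φ ∙ (1ℤ ∷ v) - z) (height-∙ 1ℤ v))))
        (ℤ.i≤j⇒0≤j-i (ℤ.i<j⇒suc[i]≤j (gap (1ℤ ∷ v) (on-V (∈-map⁺ (1ℤ ∷_) i)) (height-∙ 1ℤ v)))))
        where
        -- Otherwise all the nonnegative terms (D - ρ) g(x) are 0, so every g(x) is 0, and `expr`
        -- would give height 0 instead of 1.
        gap : ∀ x → Nonneg K x → h ∙ x ≡ 1ℤ → 0ℤ < total ∙ x - φ ∙ x
        gap x p hx with 0ℤ <⊎≤ (total ∙ x - φ ∙ x)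
        ... | inj₁ lt = lt
        ... | inj₂ le = ⊥-elim (ℤ.<-irrefl (trans (sym (vanish (λ t → rem t + quot t * D)))
          (trans (sym (expr x)) (trans (cong (D *_) hx) (ℤ.*-identityʳ D)))) D>0)
          where
          D-gap : D * (total ∙ x - φ ∙ x) ≡ sumBy (λ t → (D - rem t) * (functional t ∙ x)) ts
          D-gap = trans (lem₁ D (total ∙ x) (φ ∙ x)) (trans (cong₂ (λ a b → D * a + - 1ℤ * b) (total-∙ x) (Dφ x))
            (trans (cong (_+ - 1ℤ * Σρ x) (sym (sumBy-scale D (λ t → functional t ∙ x) ts)))
            (trans (lem₂ (sumBy (λ t → D * (functional t ∙ x)) ts) (Σρ x))
              (trans (sym (sumBy-linear 1ℤ (- 1ℤ) (λ t → D * (functional t ∙ x)) (λ t → rem t * (functional t ∙ x)) ts))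
            (sumBy-cong ts (All.tabulate λ {t} _ → lem₃ D (rem t) (functional t ∙ x)))))))
            where
            lem₁ : ∀ D a b → D * (a - b) ≡ D * a + - 1ℤ * (D * b)
            lem₁ = solve-∀
            lem₂ : ∀ a b → a + - 1ℤ * b ≡ 1ℤ * a + - 1ℤ * b
            lem₂ = solve-∀
            lem₃ : ∀ D ρ a → 1ℤ * (D * a) + - 1ℤ * (ρ * a) ≡ (D - ρ) * a
            lem₃ = solve-∀
          positive : ∀ {ρ} → ρ < D → 0ℤ < D - ρ
          positive {ρ} lt = subst (_< D - ρ) (ℤ.+-inverseʳ ρ) (ℤ.+-monoˡ-< (- ρ) lt)
          entries : All (λ t → 0ℤ ≤ (D - rem t) * (functional t ∙ x)) ts
          entries = All.map (λ { {t} (lt , _ , nn) → 0≤* (ℤ.<⇒≤ (positive lt)) (nn p) }) valid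
          zeros : All (λ t → functional t ∙ x ≡ 0ℤ) ts
          zeros = All.zipWith (λ { {t} ((lt , _) , e) → cancel (D - rem t) (functional t ∙ x) (positive lt) e })
            (valid , sumBy-nonneg-zero entries (ℤ.≤-antisym
              (subst (_≤ 0ℤ) D-gap (subst (_≤ 0ℤ) (lem₄ D (total ∙ x - φ ∙ x)) (ℤ.neg-mono-≤ (0≤* (ℤ.<⇒≤ D>0) (ℤ.neg-mono-≤ le)))))
                (sumBy-nonneg entries)))
            where
            lem₄ : ∀ D a → - (D * - a) ≡ D * a
            lem₄ = solve-∀
            cancel : ∀ a b → 0ℤ < a → a * b ≡ 0ℤ → b ≡ 0ℤ
            cancel a b a>0 e with ℤ.i*j≡0⇒i≡0∨j≡0 a e
            ... | inj₁ z = ⊥-elim (ℤ.<-irrefl (sym z) a>0)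
            ... | inj₂ z = z
          vanish : ∀ (c : Term → ℤ) → sumBy (λ t → c t * (functional t ∙ x)) ts ≡ 0ℤ
          vanish c = sumBy-zero ts (All.map (λ {t} e → trans (cong (c t *_) e) (ℤ.*-zeroʳ (c t))) zeros)
      û-cone = from-nonneg (interior-nonneg û-interior)
      hû : h ∙ û ≡ r
      hû = height-∙ r u
      total-û : total ∙ û ≡ + length ts
      total-û = trans (total-∙ û) (sumBy-length (All.map (λ { (_ , e , _) → e }) valid))
      -- Every normal is 1 at `û`, so `total` counts the terms there, and Carathéodory bounds that
      -- count by n + 1.
      φû≤d : φ ∙ û ≤ + d
      φû≤d = ℤ.0≤i-j⇒j≤i (subst (0ℤ ≤_) (lem (+ length ts) (+ suc n) (+ d) (φ ∙ û))
        (0≤+ (subst (0ℤ ≤_) (trans (y-∙ û) (cong₂ (λ a b → a - φ ∙ û - b) total-û hû)) (InCone-nonneg V̂ y y-nonneg û-cone))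
          (ℤ.i≤j⇒0≤j-i (+≤+ few))))
        where
        lem : ∀ k N d φ → k - φ - (N - d) + (N - k) ≡ d - φ
        lem = solve-∀
      -- The normals, repeated by their integral parts, sum to h - φ; evaluation at `û`, where each
      -- is 1, counts them.
      length-expand : + length (expand ts) ≡ r - φ ∙ û
      length-expand = trans (sym (sumBy-length (All-expand (All.map (λ { (_ , e , _) → e }) valid))))
        (trans (sumBy-expand û ts) (trans (lem (h ∙ û) (Σq û)) (cong₂ _-_ hû (sym (φ-∙ û)))))
        where
        lem : ∀ a b → b ≡ a - (a - b)
        lem = solve-∀
      -- D · φ(û) is the sum of the remainders. If it is not positive, all remainders are 0, so `φ`
      -- vanishes everywhere, in particular at its own coefficient vector, and φ ∙ φ = 0 forces φ =
      -- 0.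
      φû≥1 : φ ≢ 𝟎 → 0ℤ < φ ∙ û
      φû≥1 φ≢0 with 0ℤ <⊎≤ (φ ∙ û)
      ... | inj₁ lt = lt
      ... | inj₂ le = ⊥-elim (φ≢0 (nonzero-square (D-cancel φ (trans (Dφ φ)
        (sumBy-zero ts (All.map (λ {t} e → trans (cong (_* (functional t ∙ φ)) e) (ℤ.*-zeroˡ (functional t ∙ φ))) rems-zero))))))
        where
        D-cancel : ∀ x → D * (φ ∙ x) ≡ 0ℤ → φ ∙ x ≡ 0ℤ
        D-cancel x e with ℤ.i*j≡0⇒i≡0∨j≡0 D e
        ... | inj₁ z = ⊥-elim (ℤ.<-irrefl (sym z) D>0)
        ... | inj₂ z = z
        nonzero-square : φ ∙ φ ≡ 0ℤ → φ ≡ 𝟎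
        nonzero-square e with φ ≟ᵛ 𝟎
        ... | yes z = z
        ... | no nz = ⊥-elim (ℤ.<-irrefl (sym e) (∙-square-pos φ nz))
        rems : Σρ û ≡ sumBy rem ts
        rems = sumBy-cong ts (All.map (λ { {t} (_ , e , _) → trans (cong (rem t *_) e) (ℤ.*-identityʳ (rem t)) }) valid)
        Dφû≤0 : D * (φ ∙ û) ≤ 0ℤ
        Dφû≤0 = subst (_≤ 0ℤ) (lem D (φ ∙ û)) (ℤ.neg-mono-≤ (0≤* (ℤ.<⇒≤ D>0) (ℤ.neg-mono-≤ le)))
          where
          lem : ∀ D a → - (D * - a) ≡ D * a
          lem = solve-∀
        rems-nonneg : All (λ t → 0ℤ ≤ rem t) ts
        rems-nonneg = All.tabulate λ _ → +≤+ z≤n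
        rems-zero : All (λ t → rem t ≡ 0ℤ) ts
        rems-zero = sumBy-nonneg-zero rems-nonneg (ℤ.≤-antisym (subst (_≤ 0ℤ) (trans (Dφ û) rems) Dφû≤0) (sumBy-nonneg rems-nonneg))

      expand-nonneg : All (λ e → All (λ v → 0ℤ ≤ e ∙ v) V̂) (expand ts)
      expand-nonneg = All-expand (All.map (λ { (_ , _ , nn) → All.tabulate (nn ∘ on-V) }) valid)

      expand-nonzero : All (λ e → ∃[ v ] v ∈ V × 0ℤ < e ∙ (1ℤ ∷ v)) (expand ts)
      expand-nonzero = All.zipWith (λ { {e} (ne , nn) → nonzero-somewhere e ne nn })
        (All-expand (All.map (λ { {t} (_ , e , _) z → 0≢1 (trans (sym (trans (cong (_∙ û) z) (𝟎-∙ û))) e) }) valid) , expand-nonneg)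
        where
        0≢1 : 0ℤ ≢ 1ℤ
        0≢1 ()

      expand-total : ∀ x → φ ∙ x + sumBy (_∙ x) (expand ts) ≡ h ∙ x
      expand-total x = trans (cong₂ _+_ (φ-∙ x) (sumBy-expand x ts)) (lem (h ∙ x) (Σq x))
        where
        lem : ∀ a b → a - b + b ≡ a
        lem = solve-∀

      decompose : ∀ {v₀} → v₀ ∈ V → Decomposition d V
      decompose {v₀} v₀∈V with φ ≟ᵛ 𝟎
      -- There are r summands, so q = d. The bound d ≤ 2d - 1 also covers d = 0, where the truncated
      -- difference is 0.
      ... | yes φ≡0 = without-rest (expand ts) expand-nonneg expand-nonzero exact
          (trans length-expand (trans (cong (λ f → r - f ∙ û) φ≡0) (trans (cong (λ z → r - z) (𝟎-∙ û)) (ℤ.+-identityʳ r))))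
        where
        exact : ∀ x → sumBy (_∙ x) (expand ts) ≡ h ∙ x
        exact x = trans (sym (trans (cong (λ f → f ∙ x + sumBy (_∙ x) (expand ts)) φ≡0)
          (trans (cong (_+ sumBy (_∙ x) (expand ts)) (𝟎-∙ x)) (ℤ.+-identityˡ _)))) (expand-total x)
        d≤2d-1 : ∀ d → d ℕ.≤ 2 ℕ.* d ∸ 1
        d≤2d-1 zero = z≤n
        d≤2d-1 (suc d) = subst (suc d ℕ.≤_) (sym (ℕ.+-suc d (d ℕ.+ 0))) (s≤s (ℕ.m≤m+n d (d ℕ.+ 0)))
        without-rest : ∀ es → All (λ e → All (λ v → 0ℤ ≤ e ∙ v) V̂) es → All (λ e → ∃[ v ] v ∈ V × 0ℤ < e ∙ (1ℤ ∷ v)) es →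
          (∀ x → sumBy (_∙ x) es ≡ h ∙ x) → + length es ≡ r → Decomposition d V
        without-rest [] _ _ tot _ with () ← trans (tot (1ℤ ∷ v₀)) (height-∙ 1ℤ v₀)
        without-rest es@(_ ∷ es′) nn nz tot len = record
          { q = d ; s = length es′ ; n≡q+s = ℕ.suc-injective (ℤ.+-injective
            (trans (lem (+ suc n) (+ d)) (trans (cong (λ z → + d + z) (sym len)) (cong +_ (ℕ.+-suc d (length es′)))))) ; q≤2d-1 = d≤2d-1 d
          ; summands = es ; count = refl ; summands-nonneg = nn ; summands-nonzero = nz ; summands-total = tot }
          where
          lem : ∀ a b → a ≡ b + (a - b)
          lem = solve-∀
      ... | no φ≢0 = with-rest (φ ∙ û) refl (φû≥1 φ≢0)
        where
        with-rest : ∀ p → φ ∙ û ≡ p → 0ℤ < p → Decomposition d V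
        -- `φ` is the additional summand, so `s` is the full number of normals, and φ(û) = p + 1
        -- gives q = d + p.
        with-rest +[1+ p ] e _ = record
          { q = d ℕ.+ p ; s = length (expand ts)
          ; n≡q+s = ℤ.+-injective (trans (lem (+ n) (+ d) (+ p)) (cong (λ z → + d + + p + z)
            (sym (trans length-expand (cong (λ z → r - z) e)))))
          ; q≤2d-1 = bound d p (ℤ.drop‿+≤+ (subst (_≤ + d) e φû≤d))
          ; summands = φ ∷ expand ts ; count = refl ; summands-nonneg = φ-nonneg ∷ expand-nonneg
          ; summands-nonzero = nonzero-somewhere φ φ≢0 φ-nonneg ∷ expand-nonzero ; summands-total = expand-total }
          where
          lem : ∀ n d p → n ≡ d + p + (1ℤ + n - d - (1ℤ + p))
          lem = solve-∀
          bound : ∀ d p → suc p ℕ.≤ d → d ℕ.+ p ℕ.≤ 2 ℕ.* d ∸ 1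
          bound (suc d) p (s≤s le) = subst (suc d ℕ.+ p ℕ.≤_) (sym (ℕ.+-suc d (d ℕ.+ 0))) (s≤s (ℕ.+-monoʳ-≤ d (ℕ.≤-trans le (ℕ.m≤m+n d 0))))
        with-rest (+ 0) _ (+<+ ())

    private
      -- By Farkas the only alternative is a point of the cone with negative height.
      height-InCone : InCone K height
      height-InCone with farkas K height
      ... | inj₁ p = p
      ... | inj₂ ((m ∷ v) , neg , p) = ⊥-elim (ℤ.<⇒≱ (subst (_< 0ℤ) (height-∙ m v) neg) (height-nonneg p))

    decomposition : ∀ {v₀} → v₀ ∈ V → Decomposition d V
    decomposition v₀∈V with weights K height-InCone
    ... | _ , ws₀ , D₀>0 , pos₀ , rep₀ with caratheodory {h = height} ws₀ D₀>0 pos₀ rep₀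
    ... | + 0 , _ , +<+ () , _
    ... | +[1+ D-1 ] , ws , D>0 , pos , rep , few with terms (suc D-1) ws pos
    ... | ts , valid , len , val = Assembly.decompose +[1+ D-1 ] D>0 ts valid (subst (ℕ._≤ suc n) (sym len) few)
      (λ x → trans (rep x) (val x)) v₀∈V

  -- Unimodular completion

  -- Functionals are kept as functions, because `complete` restricts them to kernels by composition;
  -- `represent` recovers the coefficients.
  record IsFunctional {n} (φ : Vec ℤ n → ℤ) : Set where
    field
      add : ∀ x y → φ (x ⊕ y) ≡ φ x + φ y
      scale : ∀ c x → φ (c ⊙ x) ≡ c * φ x

  record IsLinear {m n} (f : Vec ℤ m → Vec ℤ n) : Set where
    field
      add : ∀ x y → f (x ⊕ y) ≡ f x ⊕ f y
      scale : ∀ c x → f (c ⊙ x) ≡ c ⊙ f x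

  ∙-functional : ∀ {n} (f : Vec ℤ n) → IsFunctional (f ∙_)
  ∙-functional f = record { add = ∙-⊕ f ; scale = ∙-⊙ f }

  ∘-functional : ∀ {m n} {φ : Vec ℤ n → ℤ} {f : Vec ℤ m → Vec ℤ n} → IsFunctional φ → IsLinear f → IsFunctional (φ ∘ f)
  ∘-functional {φ = φ} {f} Φ F = record
    { add = λ x y → trans (cong φ (IsLinear.add F x y)) (IsFunctional.add Φ (f x) (f y))
    ; scale = λ c x → trans (cong φ (IsLinear.scale F c x)) (IsFunctional.scale Φ c (f x)) }

  ⊕-identityˡ : ∀ {n} (x : Vec ℤ n) → 𝟎 ⊕ x ≡ x
  ⊕-identityˡ [] = refl
  ⊕-identityˡ (a ∷ x) = cong₂ _∷_ (ℤ.+-identityˡ a) (⊕-identityˡ x)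

  ⊙-𝟎 : ∀ {n} c → c ⊙ 𝟎 {n} ≡ 𝟎
  ⊙-𝟎 {zero} c = refl
  ⊙-𝟎 {suc n} c = cong₂ _∷_ (ℤ.*-zeroʳ c) (⊙-𝟎 c)

  head-split : ∀ {n} a (x : Vec ℤ n) → a ∷ x ≡ a ⊙ (1ℤ ∷ 𝟎) ⊕ (0ℤ ∷ x)
  head-split a x = cong₂ _∷_ (lem a) (sym (trans (cong (_⊕ x) (⊙-𝟎 a)) (⊕-identityˡ x)))
    where
    lem : ∀ a → a ≡ a * 1ℤ + 0ℤ
    lem = solve-∀

  0∷-linear : ∀ {n} → IsLinear {n} (0ℤ ∷_)
  0∷-linear = record { add = λ x y → refl ; scale = λ c x → cong (_∷ c ⊙ x) (sym (ℤ.*-zeroʳ c)) }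

  functional-head : ∀ {n} {φ : Vec ℤ (suc n) → ℤ} → IsFunctional φ → ∀ a x → φ (a ∷ x) ≡ a * φ (1ℤ ∷ 𝟎) + φ (0ℤ ∷ x)
  functional-head {φ = φ} Φ a x = trans (cong φ (head-split a x)) (trans (IsFunctional.add Φ _ _)
    (cong (_+ φ (0ℤ ∷ x)) (IsFunctional.scale Φ a _)))

  functional-𝟎 : ∀ {n} {φ : Vec ℤ n → ℤ} → IsFunctional φ → φ 𝟎 ≡ 0ℤ
  functional-𝟎 {φ = φ} Φ = trans (cong φ (sym (0⊙ 𝟎))) (trans (IsFunctional.scale Φ 0ℤ 𝟎) (ℤ.*-zeroˡ (φ 𝟎)))

  represent : ∀ {n} → (Vec ℤ n → ℤ) → Vec ℤ n
  represent {zero} φ = []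
  represent {suc n} φ = φ (1ℤ ∷ 𝟎) ∷ represent (φ ∘ (0ℤ ∷_))

  represent-∙ : ∀ {n} {φ : Vec ℤ n → ℤ} → IsFunctional φ → ∀ x → represent φ ∙ x ≡ φ x
  represent-∙ Φ [] = sym (functional-𝟎 Φ)
  represent-∙ {φ = φ} Φ (a ∷ x) = sym (trans (functional-head Φ a x) (cong₂ _+_ (ℤ.*-comm a (φ (1ℤ ∷ 𝟎)))
    (sym (represent-∙ (∘-functional Φ 0∷-linear) x))))

  record Automorphism n : Set where
    field
      to from : Vec ℤ n → Vec ℤ n
      to-linear : IsLinear to
      from-linear : IsLinear from
      to-from : ∀ x → to (from x) ≡ x
      from-to : ∀ x → from (to x) ≡ x

  -- Hermite normal form of one row. The tail is reduced first; the two remaining coefficients g α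
  -- and g γ are merged by the matrix with rows (α, γ) and (-q, p), of determinant p α + q γ = 1.
  hermite : ∀ {n} {φ : Vec ℤ (suc n) → ℤ} → IsFunctional φ → ∃[ A ] ∃[ g ] ∀ x → φ x ≡ g * head (Automorphism.to A x)
  hermite {zero} {φ} Φ = record
    { to = λ x → x ; from = λ x → x
    ; to-linear = record { add = λ _ _ → refl ; scale = λ _ _ → refl } ; from-linear = record { add = λ _ _ → refl ; scale = λ _ _ → refl }
    ; to-from = λ _ → refl ; from-to = λ _ → refl } ,
    φ (1ℤ ∷ []) , λ { (a ∷ []) → trans (functional-head Φ a []) (trans (+-congˡ (a * φ (1ℤ ∷ [])) (functional-𝟎 Φ))
      (trans (ℤ.+-identityʳ _) (ℤ.*-comm a _))) }
  hermite {suc n} {φ} Φ with hermite (∘-functional Φ 0∷-linear)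
  ... | A , g₁ , eq with bezout (φ (1ℤ ∷ 𝟎)) g₁
  ... | record { g = g ; a′ = α ; b′ = γ ; p = p ; q = q ; a≡ = a≡ ; b≡ = b≡ ; unit = unit } = record
    { to = λ { (a ∷ x) → mix α γ (- q) p a (A.to x) } ; from = λ z → unmix (head z) (tail z)
    ; to-linear = record { add = λ { (a ∷ x) (b ∷ y) → trans (cong (mix α γ (- q) p (a + b)) (IsLinear.add A.to-linear x y))
      (mix-add α γ (- q) p a b (A.to x) (A.to y)) }
                         ; scale = λ { c (a ∷ x) → trans (cong (mix α γ (- q) p (c * a)) (IsLinear.scale A.to-linear c x))
                           (mix-scale α γ (- q) p c a (A.to x)) } }
    ; from-linear = record { add = λ { (a ∷ x) (b ∷ y) → unmix-add a b x y } ; scale = λ { c (a ∷ x) → unmix-scale c a x } }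
    ; to-from = λ { (a ∷ b ∷ y) → trans (cong (mix α γ (- q) p (p * a + - γ * b)) (A.to-from (q * a + α * b ∷ y)))
      (cong₂ (λ s t → s ∷ t ∷ y) (trans (lem₁ p q α γ a b) (by-unit a)) (trans (lem₂ p q α γ a b) (by-unit b))) }
    ; from-to = λ { (a ∷ x) → cancel a x (A.to x) refl } } ,
    g , λ { (a ∷ x) → trans (functional-head Φ a x) (trans (cong₂ (λ s t → a * s + t) a≡ (trans (eq x) (cong (_* head (A.to x)) b≡)))
      (final a (A.to x))) }
    where
    module A = Automorphism A
    mix : ∀ (α γ q p a : ℤ) → Vec ℤ (suc n) → Vec ℤ (suc (suc n))
    mix α γ q p a (t ∷ y) = α * a + γ * t ∷ q * a + p * t ∷ y
    unmix : ℤ → Vec ℤ (suc n) → Vec ℤ (suc (suc n))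
    unmix a (b ∷ y) = p * a + - γ * b ∷ A.from (q * a + α * b ∷ y)
    lin-add : ∀ α γ a b t u → α * (a + b) + γ * (t + u) ≡ α * a + γ * t + (α * b + γ * u)
    lin-add = solve-∀
    lin-scale : ∀ α γ c a t → α * (c * a) + γ * (c * t) ≡ c * (α * a + γ * t)
    lin-scale = solve-∀
    mix-add : ∀ α γ q p a b x y → mix α γ q p (a + b) (x ⊕ y) ≡ mix α γ q p a x ⊕ mix α γ q p b y
    mix-add α γ q p a b (t ∷ x) (u ∷ y) = cong₂ (λ r s → r ∷ s ∷ x ⊕ y) (lin-add α γ a b t u) (lin-add q p a b t u)
    mix-scale : ∀ α γ q p c a x → mix α γ q p (c * a) (c ⊙ x) ≡ c ⊙ mix α γ q p a x
    mix-scale α γ q p c a (t ∷ x) = cong₂ (λ r s → r ∷ s ∷ c ⊙ x) (lin-scale α γ c a t) (lin-scale q p c a t)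
    unmix-add : ∀ a b x y → unmix (a + b) (x ⊕ y) ≡ unmix a x ⊕ unmix b y
    unmix-add a b (t ∷ x) (u ∷ y) = cong₂ _∷_ (lin-add p (- γ) a b t u)
      (trans (cong (λ z → A.from (z ∷ x ⊕ y)) (lin-add q α a b t u)) (IsLinear.add A.from-linear (q * a + α * t ∷ x) (q * b + α * u ∷ y)))
    unmix-scale : ∀ c a x → unmix (c * a) (c ⊙ x) ≡ c ⊙ unmix a x
    unmix-scale c a (t ∷ x) = cong₂ _∷_ (lin-scale p (- γ) c a t) (trans (cong (λ z → A.from (z ∷ c ⊙ x)) (lin-scale q α c a t))
      (IsLinear.scale A.from-linear c (q * a + α * t ∷ x)))
    by-unit : ∀ a → (p * α + q * γ) * a ≡ a
    by-unit a = trans (cong (_* a) unit) (ℤ.*-identityˡ a)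
    lem₁ : ∀ p q α γ a b → α * (p * a + - γ * b) + γ * (q * a + α * b) ≡ (p * α + q * γ) * a
    lem₁ = solve-∀
    lem₂ : ∀ p q α γ a b → - q * (p * a + - γ * b) + p * (q * a + α * b) ≡ (p * α + q * γ) * b
    lem₂ = solve-∀
    lem₃ : ∀ p q α γ a t → p * (α * a + γ * t) + - γ * (- q * a + p * t) ≡ (p * α + q * γ) * a
    lem₃ = solve-∀
    lem₄ : ∀ p q α γ a t → q * (α * a + γ * t) + α * (- q * a + p * t) ≡ (p * α + q * γ) * t
    lem₄ = solve-∀
    cancel : ∀ a x y → A.to x ≡ y → unmix (head (mix α γ (- q) p a y)) (tail (mix α γ (- q) p a y)) ≡ a ∷ x
    cancel a x (t ∷ y) e = cong₂ _∷_ (trans (lem₃ p q α γ a t) (by-unit a))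
      (trans (cong (λ z → A.from (z ∷ y)) (trans (lem₄ p q α γ a t) (by-unit t))) (trans (cong A.from (sym e)) (A.from-to x)))
    final : ∀ a y → a * (g * α) + g * γ * head y ≡ g * head (mix α γ (- q) p a y)
    final a (t ∷ y) = lem a g α γ t
      where
      lem : ∀ a g α γ t → a * (g * α) + g * γ * t ≡ g * (α * a + γ * t)
      lem = solve-∀

  -- The lattice as the direct sum of ker φ and ℤ d: `rest` projects along `d`, and `back 0ℤ` embeds
  -- the kernel.
  record Splitting {n} (φ : Vec ℤ (suc n) → ℤ) (d : Vec ℤ (suc n)) : Set where
    field
      rest : Vec ℤ (suc n) → Vec ℤ n
      back : ℤ → Vec ℤ n → Vec ℤ (suc n)
      rest-linear : IsLinear rest
      back-linear : IsLinear (back 0ℤ)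
      rest-d : rest d ≡ 𝟎
      φ-back : ∀ a y → φ (back a y) ≡ a
      rest-back : ∀ a y → rest (back a y) ≡ y
      back-rest : ∀ x → back (φ x) (rest x) ≡ x

  ⊖-self : ∀ {n} (x : Vec ℤ n) → x ⊖ 1ℤ ⊙ x ≡ 𝟎
  ⊖-self [] = refl
  ⊖-self (a ∷ x) = cong₂ _∷_ (lem a) (⊖-self x)
    where
    lem : ∀ a → a - 1ℤ * a ≡ 0ℤ
    lem = solve-∀

  head-∷-tail : ∀ {n} (x : Vec ℤ (suc n)) → head x ∷ tail x ≡ x
  head-∷-tail (_ ∷ _) = refl

  splitting : ∀ {n} {φ : Vec ℤ (suc n) → ℤ} → IsFunctional φ → ∀ d → φ d ≡ 1ℤ → Splitting φ d
  splitting {n} {φ} Φ d φd≡1 with hermite Φ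
  ... | A , g , eq = record
    { rest = rest ; back = back
    ; rest-linear = record
      { add = λ x y → trans (cong₂ (λ s t → tail s ⊖ t ⊙ c) (IsLinear.add A.to-linear x y) (IsFunctional.add Φ x y))
        (trans (cong (_⊖ (φ x + φ y) ⊙ c) (tail-⊕ (A.to x) (A.to y))) (lem-add (tail (A.to x)) (tail (A.to y)) (φ x) (φ y) c))
      ; scale = λ k x → trans (cong₂ (λ s t → tail s ⊖ t ⊙ c) (IsLinear.scale A.to-linear k x) (IsFunctional.scale Φ k x))
        (trans (cong (_⊖ (k * φ x) ⊙ c) (tail-⊙ k (A.to x))) (lem-scale k (tail (A.to x)) (φ x) c)) }
    ; back-linear = record
      { add = λ x y → trans (cong (λ z → A.from z) (cong₂ _∷_ (lem₀ g) (lem-back-add x y c))) (IsLinear.add A.from-linear _ _)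
      ; scale = λ k x → trans (cong A.from (cong₂ _∷_ (lem₀′ g k) (lem-back-scale k x c))) (IsLinear.scale A.from-linear k _) }
    ; rest-d = trans (cong (λ z → c ⊖ z ⊙ c) φd≡1) (⊖-self c)
    ; φ-back = φ-back
    ; rest-back = λ a y → trans (cong₂ (λ s t → tail s ⊖ t ⊙ c) (A.to-from (g * a ∷ y ⊕ a ⊙ c)) (φ-back a y)) (lem-cancel y a c)
    ; back-rest = λ x → trans (cong A.from (trans (cong₂ _∷_ (trans (cong (g *_) (eq x))
      (trans (sym (ℤ.*-assoc g g _)) (trans (cong (_* head (A.to x)) g²≡1) (ℤ.*-identityˡ _)))) (lem-cancel′ (tail (A.to x)) (φ x) c))
      (head-∷-tail (A.to x)))) (A.from-to x) }
    where
    module A = Automorphism A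
    c : Vec ℤ n
    c = tail (A.to d)
    rest : Vec ℤ (suc n) → Vec ℤ n
    rest x = tail (A.to x) ⊖ φ x ⊙ c
    back : ℤ → Vec ℤ n → Vec ℤ (suc n)
    back a y = A.from (g * a ∷ y ⊕ a ⊙ c)
    -- `g` divides φ(d) = 1, so it is 1 or -1 and its own inverse; `back` uses it in that role.
    g²≡1 : g * g ≡ 1ℤ
    g²≡1 = unit g (head (A.to d)) (trans (sym (eq d)) φd≡1)
      where
      unit : ∀ g t → g * t ≡ 1ℤ → g * g ≡ 1ℤ
      unit g t e with ℕ.m*n≡1⇒m≡1 (ℤ.∣ g ∣) (ℤ.∣ t ∣) (trans (sym (ℤ.∣i*j∣≡∣i∣*∣j∣ g t)) (cong ℤ.∣_∣ e))
      unit (+ 1) t e | refl = refl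
      unit -[1+ 0 ] t e | refl = refl
    φ-back : ∀ a y → φ (back a y) ≡ a
    φ-back a y = trans (eq (back a y)) (trans (cong (λ z → g * head z) (A.to-from (g * a ∷ y ⊕ a ⊙ c)))
      (trans (sym (ℤ.*-assoc g g a)) (trans (cong (_* a) g²≡1) (ℤ.*-identityˡ a))))
    tail-⊕ : ∀ (x y : Vec ℤ (suc n)) → tail (x ⊕ y) ≡ tail x ⊕ tail y
    tail-⊕ (_ ∷ _) (_ ∷ _) = refl
    tail-⊙ : ∀ k (x : Vec ℤ (suc n)) → tail (k ⊙ x) ≡ k ⊙ tail x
    tail-⊙ k (_ ∷ _) = refl
    lem-add : ∀ {m} (x y : Vec ℤ m) a b c → x ⊕ y ⊖ (a + b) ⊙ c ≡ (x ⊖ a ⊙ c) ⊕ (y ⊖ b ⊙ c)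
    lem-add [] [] a b [] = refl
    lem-add (x ∷ xs) (y ∷ ys) a b (c ∷ cs) = cong₂ _∷_ (lem x y a b c) (lem-add xs ys a b cs)
      where
      lem : ∀ x y a b c → x + y - (a + b) * c ≡ x - a * c + (y - b * c)
      lem = solve-∀
    lem-scale : ∀ {m} k (x : Vec ℤ m) a c → k ⊙ x ⊖ (k * a) ⊙ c ≡ k ⊙ (x ⊖ a ⊙ c)
    lem-scale k [] a [] = refl
    lem-scale k (x ∷ xs) a (c ∷ cs) = cong₂ _∷_ (lem k x a c) (lem-scale k xs a cs)
      where
      lem : ∀ k x a c → k * x - k * a * c ≡ k * (x - a * c)
      lem = solve-∀
    lem₀ : ∀ g → g * 0ℤ ≡ g * 0ℤ + g * 0ℤ
    lem₀ = solve-∀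
    lem₀′ : ∀ g k → g * 0ℤ ≡ k * (g * 0ℤ)
    lem₀′ = solve-∀
    lem-back-add : ∀ {m} (x y c : Vec ℤ m) → x ⊕ y ⊕ 0ℤ ⊙ c ≡ (x ⊕ 0ℤ ⊙ c) ⊕ (y ⊕ 0ℤ ⊙ c)
    lem-back-add [] [] [] = refl
    lem-back-add (x ∷ xs) (y ∷ ys) (c ∷ cs) = cong₂ _∷_ (lem x y c) (lem-back-add xs ys cs)
      where
      lem : ∀ x y c → x + y + 0ℤ * c ≡ x + 0ℤ * c + (y + 0ℤ * c)
      lem = solve-∀
    lem-back-scale : ∀ {m} k (x c : Vec ℤ m) → k ⊙ x ⊕ 0ℤ ⊙ c ≡ k ⊙ (x ⊕ 0ℤ ⊙ c)
    lem-back-scale k [] [] = refl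
    lem-back-scale k (x ∷ xs) (c ∷ cs) = cong₂ _∷_ (lem k x c) (lem-back-scale k xs cs)
      where
      lem : ∀ k x c → k * x + 0ℤ * c ≡ k * (x + 0ℤ * c)
      lem = solve-∀
    lem-cancel : ∀ {m} (y : Vec ℤ m) a c → y ⊕ a ⊙ c ⊖ a ⊙ c ≡ y
    lem-cancel [] a [] = refl
    lem-cancel (y ∷ ys) a (c ∷ cs) = cong₂ _∷_ (lem y a c) (lem-cancel ys a cs)
      where
      lem : ∀ y a c → y + a * c - a * c ≡ y
      lem = solve-∀
    lem-cancel′ : ∀ {m} (y : Vec ℤ m) a c → (y ⊖ a ⊙ c) ⊕ a ⊙ c ≡ y
    lem-cancel′ [] a [] = refl
    lem-cancel′ (y ∷ ys) a (c ∷ cs) = cong₂ _∷_ (lem y a c) (lem-cancel′ ys a cs)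
      where
      lem : ∀ y a c → y - a * c + a * c ≡ y
      lem = solve-∀

  record Completion {n} (q s : ℕ) (φ : Fin s → Vec ℤ n → ℤ) : Set where
    field
      rest : Vec ℤ n → Vec ℤ q
      back : Vec ℤ q → Vec ℤ s → Vec ℤ n
      rest-linear : IsLinear rest
      φ-back : ∀ y t j → φ j (back y t) ≡ lookup t j
      rest-back : ∀ y t → rest (back y t) ≡ y
      back-rest : ∀ x → back (rest x) (tabulate λ j → φ j x) ≡ x

  -- One dual pair is split off at a time. The other functionals vanish at the first `d`, so they
  -- factor through the projection along it, and the projected points remain dual to them.
  complete : ∀ s q {n} (φ : Fin s → Vec ℤ n → ℤ) (d : Fin s → Vec ℤ n) → n ≡ s ℕ.+ q → (∀ j → IsFunctional (φ j)) →
    (∀ i → φ i (d i) ≡ 1ℤ) → (∀ i j → i ≢ j → φ i (d j) ≡ 0ℤ) → Completion q s φ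
  complete zero q φ d refl Φ one zero′ = record
    { rest = λ x → x ; back = λ y _ → y ; rest-linear = record { add = λ _ _ → refl ; scale = λ _ _ → refl }
    ; φ-back = λ _ _ () ; rest-back = λ _ _ → refl ; back-rest = λ _ → refl }
  complete (suc s) q φ d refl Φ one zero′ = record
    { rest = C.rest ∘ S.rest
    ; back = λ { y (a ∷ t) → S.back a (C.back y t) }
    ; rest-linear = record { add = λ x y → trans (cong C.rest (IsLinear.add S.rest-linear x y)) (IsLinear.add C.rest-linear _ _)
                           ; scale = λ c x → trans (cong C.rest (IsLinear.scale S.rest-linear c x)) (IsLinear.scale C.rest-linear c _) }
    ; φ-back = λ { y (a ∷ t) Fin.zero → S.φ-back a (C.back y t)
                 ; y (a ∷ t) (Fin.suc j) → trans (through-rest j (S.back a (C.back y t)))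
                   (trans (cong (φ′ j) (S.rest-back a (C.back y t))) (C.φ-back y t j)) }
    ; rest-back = λ { y (a ∷ t) → trans (cong C.rest (S.rest-back a (C.back y t))) (C.rest-back y t) }
    ; back-rest = λ x → trans (cong (λ t → S.back (φ Fin.zero x) (C.back (C.rest (S.rest x)) t)) (Vec.tabulate-cong λ j → through-rest j x))
        (trans (cong (S.back (φ Fin.zero x)) (C.back-rest (S.rest x))) (S.back-rest x)) }
    where
    d₀ = d Fin.zero
    φ₀ = φ Fin.zero
    module S = Splitting (splitting (Φ Fin.zero) d₀ (one Fin.zero))
    φ′ : Fin s → Vec ℤ (s ℕ.+ q) → ℤ
    φ′ j = φ (Fin.suc j) ∘ S.back 0ℤ
    through-rest : ∀ j x → φ (Fin.suc j) x ≡ φ′ j (S.rest x)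
    through-rest j x = trans (sym value′) (cong (φ (Fin.suc j)) (sym x′≡))
      where
      k = - φ₀ x
      x′ = x ⊕ k ⊙ d₀
      lem : ∀ a → a + - a * 1ℤ ≡ 0ℤ
      lem = solve-∀
      along-d : ∀ i → φ i x′ ≡ φ i x + k * φ i d₀
      along-d i = trans (IsFunctional.add (Φ i) x (k ⊙ d₀)) (+-congˡ (φ i x) (IsFunctional.scale (Φ i) k d₀))
      value′ : φ (Fin.suc j) x′ ≡ φ (Fin.suc j) x
      value′ = trans (along-d (Fin.suc j)) (trans (cong (λ z → φ (Fin.suc j) x + k * z) (zero′ (Fin.suc j) Fin.zero λ ())) (trans
        (+-congˡ (φ (Fin.suc j) x) (ℤ.*-zeroʳ k)) (ℤ.+-identityʳ _)))
      φ₀x′ : φ₀ x′ ≡ 0ℤ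
      φ₀x′ = trans (along-d Fin.zero) (trans (cong (λ z → φ₀ x + k * z) (one Fin.zero)) (lem (φ₀ x)))
      ⊕-identityʳ : ∀ {m} (y : Vec ℤ m) → y ⊕ 𝟎 ≡ y
      ⊕-identityʳ [] = refl
      ⊕-identityʳ (a ∷ y) = cong₂ _∷_ (ℤ.+-identityʳ a) (⊕-identityʳ y)
      rest-x′ : S.rest x′ ≡ S.rest x
      rest-x′ = trans (IsLinear.add S.rest-linear x (k ⊙ d₀)) (trans (cong (S.rest x ⊕_)
        (trans (IsLinear.scale S.rest-linear k d₀) (trans (cong (k ⊙_) S.rest-d) (⊙-𝟎 k)))) (⊕-identityʳ (S.rest x)))
      x′≡ : S.back 0ℤ (S.rest x) ≡ x′
      x′≡ = trans (cong₂ S.back (sym φ₀x′) (sym rest-x′)) (S.back-rest x′)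
    reduced : Completion q s φ′
    reduced = complete s q φ′ (λ j → S.rest (d (Fin.suc j))) refl (λ j → ∘-functional (Φ (Fin.suc j)) S.back-linear)
      (λ i → trans (sym (through-rest i (d (Fin.suc i)))) (one (Fin.suc i)))
      (λ i j i≢j → trans (sym (through-rest i (d (Fin.suc j)))) (zero′ (Fin.suc i) (Fin.suc j) λ { refl → i≢j refl }))
    module C = Completion reduced

  apply : ∀ {m n} → (Fin n → Vec ℤ m) → Vec ℤ m → Vec ℤ n
  apply U x = tabulate λ a → U a ∙ x

  -- Both directions are given by integral rows, since the same matrices must later act on real
  -- points.
  record Unimodular (m n : ℕ) : Set where
    field
      U : Fin n → Vec ℤ m
      R : Fin m → Vec ℤ n
      RU : ∀ x → apply R (apply U x) ≡ x
      UR : ∀ y → apply U (apply R y) ≡ y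

  lookup-⊕ : ∀ {n} (a : Fin n) (x y : Vec ℤ n) → lookup (x ⊕ y) a ≡ lookup x a + lookup y a
  lookup-⊕ a x y = Vec.lookup-zipWith _+_ a x y

  lookup-⊙ : ∀ {n} (a : Fin n) c (x : Vec ℤ n) → lookup (c ⊙ x) a ≡ c * lookup x a
  lookup-⊙ a c x = Vec.lookup-map a (c *_) x

  matrix : ∀ {m n} → (Vec ℤ m → Vec ℤ n) → Fin n → Vec ℤ m
  matrix f a = represent λ x → lookup (f x) a

  apply-matrix : ∀ {m n} {f : Vec ℤ m → Vec ℤ n} → IsLinear f → ∀ x → apply (matrix f) x ≡ f x
  apply-matrix {f = f} F x = trans (Vec.tabulate-cong λ a → represent-∙ (record
    { add = λ x y → trans (cong (λ z → lookup z a) (IsLinear.add F x y)) (lookup-⊕ a (f x) (f y))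
    ; scale = λ c x → trans (cong (λ z → lookup z a) (IsLinear.scale F c x)) (lookup-⊙ a c (f x)) }) x) (Vec.tabulate∘lookup (f x))

  unimodular : ∀ {n q s} (φ : Fin s → Vec ℤ n → ℤ) → (∀ j → IsFunctional (φ j)) → Completion q s φ →
    ∃[ M ] ∀ j x → Unimodular.U {n} {q ℕ.+ s} M (q ↑ʳ j) ∙ x ≡ φ j x
  unimodular {n} {q} {s} φ Φ C = record
    { U = matrix to ; R = matrix from
    ; RU = λ x → trans (apply-matrix from-linear (apply (matrix to) x)) (trans (cong from (apply-matrix to-linear x)) (from-to x))
    ; UR = λ y → trans (apply-matrix to-linear (apply (matrix from) y)) (trans (cong to (apply-matrix from-linear y)) (to-from y)) } ,
    λ j x → trans (sym (Vec.lookup∘tabulate (λ a → matrix to a ∙ x) (q ↑ʳ j)))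
      (trans (cong (λ z → lookup z (q ↑ʳ j)) (apply-matrix to-linear x))
      (trans (Vec.lookup-++ʳ (rest x) (tabulate λ j → φ j x) j) (Vec.lookup∘tabulate (λ j → φ j x) j)))
    where
    open Completion C
    to : Vec ℤ n → Vec ℤ (q ℕ.+ s)
    to x = rest x Vec.++ tabulate λ j → φ j x
    from : Vec ℤ (q ℕ.+ s) → Vec ℤ n
    from z = back (Vec.take q z) (Vec.drop q z)
    to-from : ∀ z → to (from z) ≡ z
    to-from z = trans (cong₂ Vec._++_ (rest-back _ _) (trans (Vec.tabulate-cong (φ-back _ _)) (Vec.tabulate∘lookup (Vec.drop q z))))
      (Vec.take++drop≡id q z)
    from-to : ∀ x → from (to x) ≡ x
    from-to x = let e₁ , e₂ = Vec.++-injective (Vec.take q (to x)) (rest x) (Vec.take++drop≡id q (to x)) in trans (cong₂ back e₁ e₂) (back-rest x)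
    ++-⊕ : ∀ {k l} (x x′ : Vec ℤ k) (y y′ : Vec ℤ l) → (x ⊕ x′) Vec.++ (y ⊕ y′) ≡ (x Vec.++ y) ⊕ (x′ Vec.++ y′)
    ++-⊕ [] [] y y′ = refl
    ++-⊕ (a ∷ x) (b ∷ x′) y y′ = cong (a + b ∷_) (++-⊕ x x′ y y′)
    tabulate-⊕ : ∀ {k} (f g : Fin k → ℤ) → tabulate (λ j → f j + g j) ≡ tabulate f ⊕ tabulate g
    tabulate-⊕ {zero} f g = refl
    tabulate-⊕ {suc k} f g = cong (f Fin.zero + g Fin.zero ∷_) (tabulate-⊕ (f ∘ Fin.suc) (g ∘ Fin.suc))
    to-linear : IsLinear to
    to-linear = record
      { add = λ x y → trans (cong₂ Vec._++_ (IsLinear.add rest-linear x y)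
        (trans (Vec.tabulate-cong λ j → IsFunctional.add (Φ j) x y) (tabulate-⊕ (λ j → φ j x) (λ j → φ j y))))
          (++-⊕ (rest x) (rest y) (tabulate λ j → φ j x) (tabulate λ j → φ j y))
      ; scale = λ c x → trans (cong₂ Vec._++_ (IsLinear.scale rest-linear c x)
        (trans (Vec.tabulate-cong λ j → IsFunctional.scale (Φ j) c x) (Vec.tabulate-∘ (c *_) (λ j → φ j x))))
          (sym (Vec.map-++ (c *_) (rest x) (tabulate λ j → φ j x))) }
    from-linear : IsLinear from
    from-linear = record
      { add = λ x y → trans (cong from (trans (cong₂ _⊕_ (sym (to-from x)) (sym (to-from y)))
        (sym (IsLinear.add to-linear (from x) (from y))))) (from-to (from x ⊕ from y))
      ; scale = λ c x → trans (cong from (trans (cong (c ⊙_) (sym (to-from x))) (sym (IsLinear.scale to-linear c (from x)))))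
        (from-to (c ⊙ from x)) }

-- Ordered-field arithmetic and integral functionals on real points

module RealPolytopes where

  open LatticeCones
    using ( _∙_; _⊕_; _⊖_; _⊙_; ⊟_; 𝟎; ∙-⊖; ∙-⊟; ∙-𝟎; InCone; weyl; module HalfSpaces; InCone-nonneg
          ; sumBy; sumBy-nonneg; sumBy-nonneg-zero; value; weights; _≟ᵛ_; ∙-square-pos
          ; Unimodular; apply; unimodular; complete; ∙-functional; height; height-∙ )
  open import Defs using (RealNumbers; module RealNumbers; module Polytopes)
  open import Algebra.Bundles using (CommutativeRing)
  import Algebra.Properties.CommutativeMonoid.Sum as MonoidSum
  import Algebra.Properties.CommutativeSemigroup as CommutativeSemigroup
  import Algebra.Properties.Ring as RingProperties
  import Algebra.Properties.Semiring.Mult as Mult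
  import Algebra.Properties.Semiring.Sum as SemiringSum
  open import Data.Fin.Base using (zero; suc)
  open import Data.Vec.Functional as Functional using (Vector)
  import Relation.Binary.Reasoning.Setoid as SetoidReasoning
  open import Relation.Binary.Structures using (IsStrictPartialOrder)

  module Reals (ℝ : RealNumbers) where

    open RealNumbers ℝ hiding (zero; refl; sym; trans)
    open Polytopes ℝ
    private
      module CR = CommutativeRing commutativeRing
      module Ring = RingProperties CR.ring
      module O = IsStrictPartialOrder isStrictPartialOrder
      module M = Mult CR.semiring
    open SetoidReasoning CR.setoid
    open MonoidSum CR.+-commutativeMonoid using (sum-cong-≋; ∑-distrib-+; ∑-comm; sum-replicate-zero)
    open SemiringSum CR.semiring using (*-distribˡ-sum; *-distribʳ-sum)
    open CommutativeSemigroup CR.+-commutativeSemigroup using () renaming (interchange to +-interchange)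
    open CommutativeSemigroup CR.*-commutativeSemigroup using () renaming (x∙yz≈y∙xz to *-swap)

    <-resp : ∀ {a b c d} → a ≈ b → c ≈ d → a < c → b < d
    <-resp p q lt = proj₂ O.<-resp-≈ p (proj₁ O.<-resp-≈ q lt)

    +-monoʳ-< : ∀ z {x y} → x < y → z + x < z + y
    +-monoʳ-< z lt = <-resp (CR.+-comm _ z) (CR.+-comm _ z) (+-monoˡ-< z lt)

    0<+0< : ∀ {a b} → 0# < a → 0# < b → 0# < a + b
    0<+0< {a} {b} p q = O.trans p (<-resp (CR.+-identityʳ a) CR.refl (+-monoʳ-< a q))

    neg-pos : ∀ {a} → a < 0# → 0# < - a
    neg-pos {a} p = <-resp (CR.-‿inverseʳ a) (CR.+-identityˡ (- a)) (+-monoˡ-< (- a) p)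

    pos-neg : ∀ {a} → 0# < a → - a < 0#
    pos-neg {a} p = <-resp (CR.+-identityˡ (- a)) (CR.-‿inverseʳ a) (+-monoˡ-< (- a) p)

    -- 1 is apart from 0 because 1 - 0 is invertible, and 1 < 0 would make (-1)(-1) = 1 positive.
    0<1 : 0# < 1#
    0<1 with Equivalence.to #⇔<⊎> (invertible⇒# {1#} {0#} (1# , CR.trans (CR.*-identityˡ _) 1-0 , CR.trans (CR.*-identityʳ _) 1-0))
      where
      1-0 : 1# + - 0# ≈ 1#
      1-0 = CR.trans (CR.+-congˡ Ring.-0#≈0#) (CR.+-identityʳ 1#)
    ... | inj₂ p = p
    ... | inj₁ p = ⊥-elim (O.asym p (<-resp CR.refl (CR.trans (Ring.-1*x≈-x (- 1#)) (Ring.-‿involutive 1#))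
      (*-pos (neg-pos p) (neg-pos p))))

    -- The order `≤` is a negation, so while proving a contradiction one may split into equality and
    -- strict inequality; tightness of apartness supplies the equality.
    0≤-cases : ∀ {a} → 0# ≤ a → (a ≈ 0# → ⊥) → (0# < a → ⊥) → ⊥
    0≤-cases {a} p z q = z (proj₁ (tight a 0#) λ a#0 → [ p , q ]′ (Equivalence.to #⇔<⊎> a#0))

    <⇒≤ : ∀ {a b} → a < b → a ≤ b
    <⇒≤ = O.asym

    ≤-resp : ∀ {a b} → a ≈ b → 0# ≤ a → 0# ≤ b
    ≤-resp e p b<0 = p (<-resp (CR.sym e) CR.refl b<0)

    ≈⇒0≤ : ∀ {a} → a ≈ 0# → 0# ≤ a
    ≈⇒0≤ e a<0 = O.irrefl e a<0

    0≤-+ : ∀ {a b} → 0# ≤ a → 0# ≤ b → 0# ≤ a + b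
    0≤-+ p q s = 0≤-cases p (λ e → q (<-resp (CR.trans (CR.+-congʳ e) (CR.+-identityˡ _)) CR.refl s))
      λ 0<a → 0≤-cases q (λ e → p (<-resp (CR.trans (CR.+-congˡ e) (CR.+-identityʳ _)) CR.refl s)) λ 0<b → O.asym s (0<+0< 0<a 0<b)

    0≤-* : ∀ {a b} → 0# ≤ a → 0# ≤ b → 0# ≤ a * b
    0≤-* {a} {b} p q s = 0≤-cases p (λ e → O.irrefl (CR.trans (CR.*-congʳ e) (CR.zeroˡ b)) s)
      λ 0<a → 0≤-cases q (λ e → O.irrefl (CR.trans (CR.*-congˡ e) (CR.zeroʳ a)) s) λ 0<b → O.asym s (*-pos 0<a 0<b)

    0≤-sum : ∀ {k} {c : Vector Carrier k} → (∀ i → 0# ≤ c i) → 0# ≤ sum c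
    0≤-sum {zero} p = ≈⇒0≤ CR.refl
    0≤-sum {suc k} p = 0≤-+ (p zero) (0≤-sum (p ∘ suc))

    0≤-inverse : ∀ {a i} → 0# < a → a * i ≈ 1# → 0# ≤ i
    0≤-inverse {a} {i} p e i<0 = O.asym 0<1 (<-resp CR.refl CR.refl (<-resp
      (CR.trans (CR.-‿cong (CR.trans (CR.sym (Ring.-‿distribʳ-* a i)) (CR.-‿cong e))) (Ring.-‿involutive 1#)) CR.refl
      (pos-neg (*-pos p (neg-pos i<0)))))

    fromℕ-pos : ∀ n → 0# < fromℕ (suc n)
    fromℕ-pos zero = <-resp CR.refl (CR.sym (CR.+-identityʳ 1#)) 0<1
    fromℕ-pos (suc n) = 0<+0< 0<1 (fromℕ-pos n)

    fromℕ-+ : ∀ m n → fromℕ (m ℕ.+ n) ≈ fromℕ m + fromℕ n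
    fromℕ-+ = M.×-homo-+ 1#

    fromℤ-cong : ∀ {a b} → a ≡ b → fromℤ a ≈ fromℤ b
    fromℤ-cong ≡.refl = CR.refl

    fromℤ-neg : ∀ a → fromℤ (ℤ.- a) ≈ - fromℤ a
    fromℤ-neg (+ zero) = CR.sym Ring.-0#≈0#
    fromℤ-neg +[1+ n ] = CR.refl
    fromℤ-neg -[1+ n ] = CR.sym (Ring.-‿involutive _)

    fromℤ-⊖ : ∀ m n → fromℤ (m ℤ.⊖ n) ≈ fromℕ m + - fromℕ n
    fromℤ-⊖ m zero = CR.sym (CR.trans (CR.+-congˡ Ring.-0#≈0#) (CR.+-identityʳ _))
    fromℤ-⊖ zero (suc n) = CR.sym (CR.+-identityˡ _)
    fromℤ-⊖ (suc m) (suc n) = begin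
      fromℤ (suc m ℤ.⊖ suc n) ≈⟨ fromℤ-cong (ℤ.[1+m]⊖[1+n]≡m⊖n m n) ⟩
      fromℤ (m ℤ.⊖ n) ≈⟨ fromℤ-⊖ m n ⟩
      fromℕ m + - fromℕ n ≈⟨ CR.sym (CR.+-identityˡ _) ⟩
      0# + (fromℕ m + - fromℕ n) ≈⟨ CR.+-congʳ (CR.sym (CR.-‿inverseʳ 1#)) ⟩
      1# + - 1# + (fromℕ m + - fromℕ n) ≈⟨ +-interchange 1# (- 1#) (fromℕ m) (- fromℕ n) ⟩
      1# + fromℕ m + (- 1# + - fromℕ n) ≈⟨ CR.+-congˡ (Ring.-‿+-comm 1# (fromℕ n)) ⟩
      1# + fromℕ m + - (1# + fromℕ n) ∎

    fromℤ-+ : ∀ a b → fromℤ (a ℤ.+ b) ≈ fromℤ a + fromℤ b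
    fromℤ-+ (+ m) (+ n) = fromℕ-+ m n
    fromℤ-+ (+ m) -[1+ n ] = fromℤ-⊖ m (suc n)
    fromℤ-+ -[1+ m ] (+ n) = CR.trans (fromℤ-⊖ n (suc m)) (CR.+-comm _ _)
    fromℤ-+ -[1+ m ] -[1+ n ] = CR.trans (CR.-‿cong (CR.trans (M.×-congˡ (≡.cong suc (≡.sym (ℕ.+-suc m n)))) (fromℕ-+ (suc m) (suc n))))
      (CR.sym (Ring.-‿+-comm _ _))

    fromℤ-*⁺ : ∀ m b → fromℤ (+ m ℤ.* b) ≈ fromℕ m * fromℤ b
    fromℤ-*⁺ zero b = CR.trans (fromℤ-cong (ℤ.*-zeroˡ b)) (CR.sym (CR.zeroˡ _))
    fromℤ-*⁺ (suc m) b = begin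
      fromℤ (+ suc m ℤ.* b) ≈⟨ fromℤ-cong (ℤ.suc-* (+ m) b) ⟩
      fromℤ (b ℤ.+ + m ℤ.* b) ≈⟨ fromℤ-+ b (+ m ℤ.* b) ⟩
      fromℤ b + fromℤ (+ m ℤ.* b) ≈⟨ CR.+-cong (CR.sym (CR.*-identityˡ _)) (fromℤ-*⁺ m b) ⟩
      1# * fromℤ b + fromℕ m * fromℤ b ≈⟨ CR.sym (CR.distribʳ _ _ _) ⟩
      (1# + fromℕ m) * fromℤ b ∎

    fromℤ-* : ∀ a b → fromℤ (a ℤ.* b) ≈ fromℤ a * fromℤ b
    fromℤ-* (+ m) b = fromℤ-*⁺ m b
    fromℤ-* -[1+ m ] b = begin
      fromℤ (-[1+ m ] ℤ.* b) ≈⟨ fromℤ-cong (≡.sym (ℤ.neg-distribˡ-* +[1+ m ] b)) ⟩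
      fromℤ (ℤ.- (+[1+ m ] ℤ.* b)) ≈⟨ fromℤ-neg (+[1+ m ] ℤ.* b) ⟩
      - fromℤ (+[1+ m ] ℤ.* b) ≈⟨ CR.-‿cong (fromℤ-*⁺ (suc m) b) ⟩
      - (fromℕ (suc m) * fromℤ b) ≈⟨ Ring.-‿distribˡ-* _ _ ⟩
      - fromℕ (suc m) * fromℤ b ∎

    fromℤ-1 : fromℤ 1ℤ ≈ 1#
    fromℤ-1 = CR.+-identityʳ 1#

    fromℤ-nonneg : ∀ {a} → 0ℤ ℤ.≤ a → 0# ≤ fromℤ a
    fromℤ-nonneg {+ zero} _ = ≈⇒0≤ CR.refl
    fromℤ-nonneg {+[1+ n ]} _ = <⇒≤ (fromℕ-pos n)

    nonneg-fromℤ : ∀ a → 0# ≤ fromℤ a → 0ℤ ℤ.≤ a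
    nonneg-fromℤ (+ n) _ = +≤+ z≤n
    nonneg-fromℤ -[1+ n ] p = ⊥-elim (p (pos-neg (fromℕ-pos n)))

    fromℤ-≈0 : ∀ a → fromℤ a ≈ 0# → a ≡ 0ℤ
    fromℤ-≈0 (+ zero) _ = ≡.refl
    fromℤ-≈0 +[1+ n ] e = ⊥-elim (O.irrefl (CR.sym e) (fromℕ-pos n))
    fromℤ-≈0 -[1+ n ] e = ⊥-elim (O.irrefl e (pos-neg (fromℕ-pos n)))

    sum-cong : ∀ {k} {f g : Vector Carrier k} → (∀ i → f i ≈ g i) → sum f ≈ sum g
    sum-cong = sum-cong-≋

    sum-zero : ∀ {k} {f : Vector Carrier k} → (∀ i → f i ≈ 0#) → sum f ≈ 0#
    sum-zero {k} e = CR.trans (sum-cong e) (sum-replicate-zero k)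

    dot : ∀ {n} → Vec ℤ n → Point n → Carrier
    dot f x = sum λ j → fromℤ (lookup f j) * x j

    dot-cong : ∀ {n} (f : Vec ℤ n) {x y} → x ≋ y → dot f x ≈ dot f y
    dot-cong f e = sum-cong λ j → CR.*-congˡ (e j)

    dot-ι : ∀ {n} (f v : Vec ℤ n) → dot f (ι v) ≈ fromℤ (f ∙ v)
    dot-ι [] [] = CR.refl
    dot-ι (a ∷ f) (b ∷ v) = CR.trans (CR.+-cong (CR.sym (fromℤ-* a b)) (dot-ι f v)) (CR.sym (fromℤ-+ (a ℤ.* b) (f ∙ v)))

    dot-combination : ∀ {n k} (f : Vec ℤ n) (c : Vector Carrier k) p → dot f (combination c p) ≈ sum λ i → c i * dot f (p i)
    dot-combination f c p = begin
      (sum λ j → fromℤ (lookup f j) * sum λ i → c i * p i j) ≈⟨ sum-cong (λ j → *-distribˡ-sum (fromℤ (lookup f j)) (λ i → c i * p i j)) ⟩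
      (sum λ j → sum λ i → fromℤ (lookup f j) * (c i * p i j)) ≈⟨ ∑-comm (λ j i → fromℤ (lookup f j) * (c i * p i j)) ⟩
      (sum λ i → sum λ j → fromℤ (lookup f j) * (c i * p i j)) ≈⟨ sum-cong
        (λ i → CR.trans (sum-cong (λ j → *-swap (fromℤ (lookup f j)) (c i) (p i j)))
        (CR.sym (*-distribˡ-sum (c i) (λ j → fromℤ (lookup f j) * p i j)))) ⟩
      (sum λ i → c i * dot f (p i)) ∎

    dot-add : ∀ {n} (f : Vec ℤ n) x y → dot f (λ j → x j + y j) ≈ dot f x + dot f y
    dot-add {n} f x y = CR.trans (sum-cong {n} λ j → CR.distribˡ (fromℤ (lookup f j)) (x j) (y j))
      (∑-distrib-+ (λ j → fromℤ (lookup f j) * x j) (λ j → fromℤ (lookup f j) * y j))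

    dot-scale : ∀ {n} (f : Vec ℤ n) m x → dot f (λ j → m * x j) ≈ m * dot f x
    dot-scale f m x = CR.trans (sum-cong λ j → *-swap (fromℤ (lookup f j)) m (x j))
      (CR.sym (*-distribˡ-sum m (λ j → fromℤ (lookup f j) * x j)))

    -- The value of a functional on the homogenised point (1, x).
    affine-value : ∀ {n} → Vec ℤ (suc n) → Point n → Carrier
    affine-value (a ∷ f) x = fromℤ a + dot f x

    affine-value-cong : ∀ {n} (f : Vec ℤ (suc n)) {x y} → x ≋ y → affine-value f x ≈ affine-value f y
    affine-value-cong (a ∷ f) e = CR.+-congˡ (dot-cong f e)

    affine-value-ι : ∀ {n} (f : Vec ℤ (suc n)) v → affine-value f (ι v) ≈ fromℤ (f ∙ (1ℤ ∷ v))
    affine-value-ι (a ∷ f) v = CR.trans (CR.+-cong (fromℤ-cong (≡.sym (ℤ.*-identityʳ a))) (dot-ι f v)) (CR.sym (fromℤ-+ (a ℤ.* 1ℤ) (f ∙ v)))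

    affine-value-combination : ∀ {n k} (f : Vec ℤ (suc n)) (c : Vector Carrier k) p → sum c ≈ 1# → affine-value f (combination c p) ≈ sum
      λ i → c i * affine-value f (p i)
    affine-value-combination {k = k} (a ∷ f) c p e = begin
      fromℤ a + dot f (combination c p) ≈⟨ CR.+-cong (CR.trans (CR.sym (CR.*-identityˡ (fromℤ a)))
        (CR.trans (CR.*-congʳ (CR.sym e)) (*-distribʳ-sum (fromℤ a) c))) (dot-combination f c p) ⟩
      (sum λ i → c i * fromℤ a) + (sum λ i → c i * dot f (p i)) ≈⟨ CR.sym (∑-distrib-+ (λ i → c i * fromℤ a) (λ i → c i * dot f (p i))) ⟩
      (sum λ i → c i * fromℤ a + c i * dot f (p i)) ≈⟨ sum-cong {k} (λ i → CR.sym (CR.distribˡ (c i) (fromℤ a) (dot f (p i)))) ⟩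
      (sum λ i → c i * (fromℤ a + dot f (p i))) ∎

    fromℤ-pos : ∀ {a} → 0ℤ ℤ.< a → 0# < fromℤ a
    fromℤ-pos {+[1+ n ]} _ = fromℕ-pos n
    fromℤ-pos {+ zero} (+<+ ())

    inverse-of : ∀ {a} → 0# < a → ∃[ i ] a * i ≈ 1#
    inverse-of {a} p with #⇒invertible (Equivalence.from #⇔<⊎> (inj₂ p))
    ... | i , _ , e = i , CR.trans (CR.*-congʳ (CR.sym (CR.trans (CR.+-congˡ Ring.-0#≈0#) (CR.+-identityʳ a)))) e

    sum-lookup : ∀ {A : Set} (g : A → ℤ) ws → (sum λ i → fromℤ (g (List.lookup ws i))) ≈ fromℤ (sumBy g ws)
    sum-lookup g [] = CR.refl
    sum-lookup g (w ∷ ws) = CR.trans (CR.+-congˡ (sum-lookup g ws)) (CR.sym (fromℤ-+ (g w) (sumBy g ws)))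

    unit : ∀ {n} → Fin n → Vec ℤ n
    unit zero = 1ℤ ∷ 𝟎
    unit (suc j) = 0ℤ ∷ unit j

    ∙-unit : ∀ {n} (v : Vec ℤ n) j → v ∙ unit j ≡ lookup v j
    ∙-unit (a ∷ v) zero = ≡.trans (≡.cong₂ ℤ._+_ (ℤ.*-identityʳ a) (∙-𝟎 v)) (ℤ.+-identityʳ a)
    ∙-unit (a ∷ v) (suc j) = ≡.trans (≡.cong₂ ℤ._+_ (ℤ.*-zeroʳ a) (∙-unit v j)) (ℤ.+-identityˡ _)

    -- Dilates of the polytope as slices of the integral cone

    LatticePoints : ∀ {n} → List⁺ (Vec ℤ n) → Subset n
    LatticePoints V x = ∃[ v ] v ∈ toList V × x ≋ ι v

    conv-point : ∀ {n} {S : Subset n} {x} → S x → conv S x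
    conv-point {x = x} s = 1 , (λ _ → 1#) , (λ _ → x) , (λ _ → s) , (λ _ → <⇒≤ 0<1) , CR.+-identityʳ 1# , λ j → CR.sym
      (CR.trans (CR.+-identityʳ _) (CR.*-identityˡ (x j)))

    module _ {n : ℕ} {P : Subset n} (V : List⁺ (Vec ℤ n)) (P→ : ∀ {x} → P x → conv (LatticePoints V) x)
      (→P : ∀ {x} → conv (LatticePoints V) x → P x) where

      private
        V̂ = List.map (1ℤ ∷_) (toList V)

      conv-nonneg : ∀ f → All (λ v → 0ℤ ℤ.≤ f ∙ v) V̂ → ∀ {x} → conv (LatticePoints V) x → 0# ≤ affine-value f x
      conv-nonneg f nn (k , c , p , S , c≥0 , c1 , e) = ≤-resp (CR.sym (CR.trans (affine-value-cong f e)
        (affine-value-combination f c p c1)))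
        (0≤-sum λ i → let v , v∈ , pv = S i in 0≤-* (c≥0 i) (≤-resp (CR.sym (CR.trans (affine-value-cong f pv) (affine-value-ι f v))) (fromℤ-nonneg (All.lookup nn (∈-map⁺ (1ℤ ∷_) v∈)))))

      -- Real convex coefficients give no rational ones directly. Instead the integral half-spaces
      -- of `weyl` are checked over the reals; at a lattice point their values are integers, whose
      -- sign can be read back.
      dilate⇒InCone : ∀ m v → dilate m P (ι v) → InCone V̂ (+ m ∷ v)
      dilate⇒InCone m v (x , Px , e) = HalfSpaces.complete (weyl V̂) (All.map
        (λ {f} nn → nonneg-fromℤ (f ∙ (+ m ∷ v)) (≤-resp (CR.sym (scaled f))
        (0≤-* (fromℤ-nonneg {+ m} (+≤+ z≤n)) (conv-nonneg f nn (P→ Px))))) (HalfSpaces.nonneg (weyl V̂)))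
        where
        scaled : ∀ f → fromℤ (f ∙ (+ m ∷ v)) ≈ fromℕ m * affine-value f x
        scaled (a ∷ f) = begin
          fromℤ (a ℤ.* + m ℤ.+ f ∙ v) ≈⟨ fromℤ-+ (a ℤ.* + m) (f ∙ v) ⟩
          fromℤ (a ℤ.* + m) + fromℤ (f ∙ v) ≈⟨ CR.+-cong (CR.trans (fromℤ-* a (+ m)) (CR.*-comm _ _))
            (CR.trans (CR.sym (dot-ι f v)) (CR.trans (dot-cong f e) (dot-scale f (fromℕ m) x))) ⟩
          fromℕ m * fromℤ a + fromℕ m * dot f x ≈⟨ CR.sym (CR.distribˡ _ _ _) ⟩
          fromℕ m * (fromℤ a + dot f x) ∎

      InCone⇒dilate : ∀ m v → InCone V̂ (+ m ∷ v) → dilate m P (ι v)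
      InCone⇒dilate m v r with weights V̂ r
      ... | D , ws , D>0 , pos , rep = go m rep
        where
        C = λ (w : ℤ × Vec ℤ (suc n)) → proj₁ w
        T = λ (w : ℤ × Vec ℤ (suc n)) → Vec.tail (proj₂ w)
        hat : ∀ {w} → proj₂ w ∈ V̂ → proj₂ w ≡ 1ℤ ∷ T w × T w ∈ toList V
        hat i with ∈-map⁻ (1ℤ ∷_) i
        ... | v′ , v′∈ , e = ≡.trans e (≡.cong (1ℤ ∷_) (≡.sym (≡.cong Vec.tail e))) , ≡.subst (_∈ toList V) (≡.sym (≡.cong Vec.tail e)) v′∈
        entries : All (λ w → 0ℤ ℤ.< C w × proj₂ w ≡ 1ℤ ∷ T w × T w ∈ toList V) ws
        entries = All.map (λ { {w} (a , b) → a , hat {w} b }) pos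
        height-sum : ∀ {ws} → All (λ w → 0ℤ ℤ.< C w × proj₂ w ≡ 1ℤ ∷ T w × T w ∈ toList V) ws → value ws (1ℤ ∷ 𝟎) ≡ sumBy C ws
        height-sum [] = ≡.refl
        height-sum {w ∷ _} ((_ , e , _) ∷ es) = ≡.cong₂ ℤ._+_ (≡.trans (≡.cong (λ g → C w ℤ.* (g ∙ (1ℤ ∷ 𝟎))) e)
          (≡.trans (≡.cong (λ z → C w ℤ.* (1ℤ ℤ.+ z)) (∙-𝟎 (T w))) (ℤ.*-identityʳ (C w)))) (height-sum es)
        coordinate-sum : ∀ {ws} j → All (λ w → 0ℤ ℤ.< C w × proj₂ w ≡ 1ℤ ∷ T w × T w ∈ toList V) ws → value ws (0ℤ ∷ unit j) ≡ sumBy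
          (λ w → C w ℤ.* lookup (T w) j) ws
        coordinate-sum j [] = ≡.refl
        coordinate-sum {w ∷ _} j ((_ , e , _) ∷ es) = ≡.cong₂ ℤ._+_ (≡.cong (C w ℤ.*_)
          (≡.trans (≡.cong (λ g → g ∙ (0ℤ ∷ unit j)) e) (≡.trans (ℤ.+-identityˡ _) (∙-unit (T w) j)))) (coordinate-sum j es)
        go : ∀ m → (∀ x → D ℤ.* ((+ m ∷ v) ∙ x) ≡ value ws x) → dilate m P (ι v)
        -- At height 0 the positive weights have sum 0, so there are none and v = 0. Any point of P
        -- serves as witness, here the first vertex.
        go zero rep = ι (List⁺.head V) , →P (conv-point {S = LatticePoints V} (List⁺.head V , here ≡.refl , λ _ → CR.refl)) , λ j → CR.trans
          (fromℤ-cong (v≡0 j)) (CR.sym (CR.zeroˡ _))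
          where
          D-sum : D ℤ.* 0ℤ ≡ sumBy C ws
          D-sum = ≡.trans (≡.cong (D ℤ.*_) (≡.sym (≡.trans (ℤ.+-identityˡ _) (∙-𝟎 v)))) (≡.trans (rep (1ℤ ∷ 𝟎)) (height-sum entries))
          empty : ∀ {ws} → All (λ w → 0ℤ ℤ.< C w × proj₂ w ≡ 1ℤ ∷ T w × T w ∈ toList V) ws → 0ℤ ≡ sumBy C ws → ws ≡ []
          empty [] _ = ≡.refl
          empty {w ∷ ws} ((p , _) ∷ ps) e = ⊥-elim (ℤ.<-irrefl e (ℤ.+-mono-<-≤ p (nn ps)))
            where
            nn : ∀ {ws} → All (λ w → 0ℤ ℤ.< C w × proj₂ w ≡ 1ℤ ∷ T w × T w ∈ toList V) ws → 0ℤ ℤ.≤ sumBy C ws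
            nn [] = ℤ.≤-refl
            nn ((p , _) ∷ ps) = ℤ.+-mono-≤ (ℤ.<⇒≤ p) (nn ps)
          v≡0 : ∀ j → lookup v j ≡ 0ℤ
          v≡0 j with ℤ.i*j≡0⇒i≡0∨j≡0 D (≡.trans (≡.cong (D ℤ.*_) (≡.sym (≡.trans (ℤ.+-identityˡ _) (∙-unit v j))))
            (≡.trans (rep (0ℤ ∷ unit j)) (≡.cong (λ l → value l (0ℤ ∷ unit j)) (empty entries (≡.trans (≡.sym (ℤ.*-zeroʳ D)) D-sum)))))
          ... | inj₁ z = ⊥-elim (ℤ.<-irrefl (≡.sym z) D>0)
          ... | inj₂ z = z
        -- Dividing the weights by D m gives convex coefficients: the height coordinate of `rep`
        -- says that they sum to 1.
        go m@(suc m-1) rep = x , →P (length ws , γ , (λ i → ι (T (List.lookup ws i))) ,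
          (λ i → T (List.lookup ws i) , proj₂ (proj₂ (All.lookup entries (∈-lookup i))) , λ _ → CR.refl) ,
            (λ i → 0≤-* (fromℤ-nonneg (ℤ.<⇒≤ (proj₁ (All.lookup entries (∈-lookup i))))) (0≤-inverse Dm>0 inv-eq)) , γ-sum , λ _ →
              CR.refl) , λ j → CR.sym (eval j)
          where
          Dm>0 : 0# < fromℤ D * fromℕ m
          Dm>0 = *-pos (fromℤ-pos D>0) (fromℕ-pos m-1)
          inv = proj₁ (inverse-of Dm>0)
          inv-eq = proj₂ (inverse-of Dm>0)
          γ : Vector Carrier (length ws)
          γ i = fromℤ (C (List.lookup ws i)) * inv
          x : Point n
          x = combination γ λ i → ι (T (List.lookup ws i))
          γ-sum : sum γ ≈ 1#
          γ-sum = begin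
            sum γ ≈⟨ CR.sym (*-distribʳ-sum inv (λ i → fromℤ (C (List.lookup ws i)))) ⟩
            (sum λ i → fromℤ (C (List.lookup ws i))) * inv ≈⟨ CR.*-congʳ
              (CR.trans (sum-lookup C ws) (fromℤ-cong (≡.trans (≡.sym (height-sum entries))
              (≡.trans (≡.sym (rep (1ℤ ∷ 𝟎))) (≡.cong (D ℤ.*_) (≡.trans (≡.cong₂ ℤ._+_ (ℤ.*-identityʳ (+ m)) (∙-𝟎 v))
              (ℤ.+-identityʳ (+ m)))))))) ⟩
            fromℤ (D ℤ.* + m) * inv ≈⟨ CR.*-congʳ (fromℤ-* D (+ m)) ⟩
            fromℤ D * fromℕ m * inv ≈⟨ inv-eq ⟩
            1# ∎
          eval : ∀ j → fromℕ m * x j ≈ fromℤ (lookup v j)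
          eval j = begin
            fromℕ m * (sum λ i → fromℤ (C (List.lookup ws i)) * inv * fromℤ (lookup (T (List.lookup ws i)) j)) ≈⟨ CR.*-congˡ
              (sum-cong {length ws} λ i → shuffle (fromℤ (C (List.lookup ws i))) inv (fromℤ (lookup (T (List.lookup ws i)) j))) ⟩
            fromℕ m * (sum λ i → inv * (fromℤ (C (List.lookup ws i)) * fromℤ (lookup (T (List.lookup ws i)) j))) ≈⟨ CR.*-congˡ
              (CR.sym (*-distribˡ-sum inv λ i → fromℤ (C (List.lookup ws i)) * fromℤ (lookup (T (List.lookup ws i)) j))) ⟩
            fromℕ m * (inv * sum λ i → fromℤ (C (List.lookup ws i)) * fromℤ (lookup (T (List.lookup ws i)) j)) ≈⟨ CR.*-congˡ
              (CR.*-congˡ (CR.trans (sum-cong {length ws} λ i → CR.sym (fromℤ-* (C (List.lookup ws i)) (lookup (T (List.lookup ws i)) j)))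
              (sum-lookup (λ w → C w ℤ.* lookup (T w) j) ws))) ⟩
            fromℕ m * (inv * fromℤ (sumBy (λ w → C w ℤ.* lookup (T w) j) ws)) ≈⟨ CR.*-congˡ
              (CR.*-congˡ (fromℤ-cong (≡.trans (≡.sym (coordinate-sum j entries))
              (≡.trans (≡.sym (rep (0ℤ ∷ unit j))) (≡.cong (D ℤ.*_) (≡.trans (≡.cong₂ ℤ._+_ (ℤ.*-zeroʳ (+ m)) (∙-unit v j))
              (ℤ.+-identityˡ _))))))) ⟩
            fromℕ m * (inv * fromℤ (D ℤ.* lookup v j)) ≈⟨ CR.*-congˡ (CR.*-congˡ (fromℤ-* D (lookup v j))) ⟩
            fromℕ m * (inv * (fromℤ D * fromℤ (lookup v j))) ≈⟨ gather (fromℕ m) inv (fromℤ D) (fromℤ (lookup v j)) ⟩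
            fromℤ D * fromℕ m * inv * fromℤ (lookup v j) ≈⟨ CR.*-congʳ inv-eq ⟩
            1# * fromℤ (lookup v j) ≈⟨ CR.*-identityˡ _ ⟩
            fromℤ (lookup v j) ∎
            where
            shuffle : ∀ a b c → a * b * c ≈ b * (a * c)
            shuffle a b c = CR.trans (CR.*-congʳ (CR.*-comm a b)) (CR.*-assoc b a c)
            gather : ∀ m i D a → m * (i * (D * a)) ≈ D * m * i * a
            gather m i D a = begin
              m * (i * (D * a)) ≈⟨ CR.*-congˡ (*-swap i D a) ⟩
              m * (D * (i * a)) ≈⟨ *-swap m D (i * a) ⟩
              D * (m * (i * a)) ≈⟨ CR.sym (CR.*-assoc D m (i * a)) ⟩
              D * m * (i * a) ≈⟨ CR.sym (CR.*-assoc (D * m) i a) ⟩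
              D * m * i * a ∎

      -- Vanishing passes from the vertices to P and to its affine hull, hence to all lattice
      -- points. The origin kills the constant term, and the linear part evaluated at itself is a
      -- sum of squares.
      spanning : IsFullDimensional P → ∀ f → All (λ v → f ∙ (1ℤ ∷ v) ≡ 0ℤ) (toList V) → f ≡ 𝟎
      spanning full f zeros = conclude f λ v → fromℤ-≈0 (f ∙ (1ℤ ∷ v)) (CR.trans (CR.sym (affine-value-ι f v)) (vanish-aff (full (ι v))))
        where
        vanish : ∀ {k} (c : Vector Carrier k) p → sum c ≈ 1# → (∀ i → affine-value f (p i) ≈ 0#) → affine-value f (combination c p) ≈ 0#
        vanish c p c1 z = CR.trans (affine-value-combination f c p c1) (sum-zero λ i → CR.trans (CR.*-congˡ (z i)) (CR.zeroʳ (c i)))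
        vanish-conv : ∀ {x} → conv (LatticePoints V) x → affine-value f x ≈ 0#
        vanish-conv (k , c , p , S , _ , c1 , e) = CR.trans (affine-value-cong f e) (vanish c p c1 λ i → let v , v∈ , pv = S i in
          CR.trans (affine-value-cong f pv) (CR.trans (affine-value-ι f v) (fromℤ-cong (All.lookup zeros v∈))))
        vanish-aff : ∀ {x} → aff P x → affine-value f x ≈ 0#
        vanish-aff (k , c , p , S , c1 , e) = CR.trans (affine-value-cong f e) (vanish c p c1 λ i → vanish-conv (P→ (S i)))
        conclude : ∀ f → (∀ v → f ∙ (1ℤ ∷ v) ≡ 0ℤ) → f ≡ 𝟎
        conclude (a ∷ f) z = ≡.cong₂ _∷_ a≡0 f≡0
          where
          at : ∀ v → a ℤ.+ f ∙ v ≡ 0ℤ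
          at v = ≡.trans (≡.cong (ℤ._+ f ∙ v) (≡.sym (ℤ.*-identityʳ a))) (z v)
          a≡0 : a ≡ 0ℤ
          a≡0 = ≡.trans (≡.sym (≡.trans (≡.cong (λ t → a ℤ.+ t) (∙-𝟎 f)) (ℤ.+-identityʳ a))) (at 𝟎)
          f≡0 : f ≡ 𝟎
          f≡0 with f ≟ᵛ 𝟎
          ... | yes e = e
          ... | no ne = ⊥-elim (ℤ.<-irrefl (≡.sym (≡.trans (≡.sym (≡.trans (≡.cong (ℤ._+ f ∙ f) a≡0) (ℤ.+-identityˡ _))) (at f)))
            (∙-square-pos f ne))

  one-hot : ∀ {A : Set} (g : A → ℤ) as → All (λ a → 0ℤ ℤ.≤ g a) as → sumBy g as ≡ 1ℤ →
    ∃[ i ] g (List.lookup as i) ≡ 1ℤ × (∀ j → j ≢ i → g (List.lookup as j) ≡ 0ℤ)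
  one-hot g (a ∷ as) (p ∷ ps) e with g a ℤ.≟ 0ℤ
  ... | yes z = let i , one , others = one-hot g as ps (≡.trans (≡.sym (≡.trans (≡.cong (ℤ._+ sumBy g as) z) (ℤ.+-identityˡ _))) e)
                in suc i , one , λ { zero _ → z ; (suc j) ne → others j λ { ≡.refl → ne ≡.refl } }
  ... | no nz = zero , one , λ { zero ne → ⊥-elim (ne ≡.refl) ; (suc j) _ → All.lookup (sumBy-nonneg-zero ps rest≡0) (∈-lookup j) }
    where
    rest≥0 : 0ℤ ℤ.≤ sumBy g as
    rest≥0 = sumBy-nonneg ps
    ga≥1 : 1ℤ ℤ.≤ g a
    ga≥1 = ℤ.i<j⇒suc[i]≤j (ℤ.≤∧≢⇒< p (nz ∘ ≡.sym))
    rest≡0 : sumBy g as ≡ 0ℤ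
    rest≡0 = ℤ.≤-antisym (ℤ.0≤i-j⇒j≤i (≡.subst (0ℤ ℤ.≤_) (lem (sumBy g as))
      (ℤ.i≤j⇒0≤j-i (ℤ.≤-trans (ℤ.+-monoˡ-≤ (sumBy g as) ga≥1) (ℤ.≤-reflexive e))))) rest≥0
      where
      lem : ∀ r → 1ℤ ℤ.- (1ℤ ℤ.+ r) ≡ 0ℤ ℤ.- r
      lem = solve-∀
    one : g a ≡ 1ℤ
    one = ≡.trans (≡.sym (≡.trans (≡.cong (λ z → g a ℤ.+ z) rest≡0) (ℤ.+-identityʳ (g a)))) e

  tail-difference : ∀ {n} (e : Vec ℤ (suc n)) v w → Vec.tail e ∙ (v ⊖ w) ≡ e ∙ (1ℤ ∷ v) ℤ.- e ∙ (1ℤ ∷ w)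
  tail-difference (a ∷ f) v w = ≡.trans (∙-⊖ f v w) (lem (a ℤ.* 1ℤ) (f ∙ v) (f ∙ w))
    where
    lem : ∀ a b c → b ℤ.- c ≡ a ℤ.+ b ℤ.- (a ℤ.+ c)
    lem = solve-∀

  -- From functionals summing to the height to a Cayley sum

  module Cayley (ℝ : RealNumbers) where

    open RealNumbers ℝ hiding (zero; refl; sym; trans; complete)
    open Polytopes ℝ
    open Reals ℝ
    private
      module CR = CommutativeRing commutativeRing
      module Ring = RingProperties CR.ring
    open SetoidReasoning CR.setoid
    open SemiringSum CR.semiring using (*-distribˡ-sum; *-distribʳ-sum)

    unit-sym : ∀ {n} (a b : Fin n) → lookup (unit b) a ≡ lookup (unit a) b
    unit-sym zero zero = ≡.refl
    unit-sym zero (suc b) = ≡.sym (Vec.lookup-replicate b 0ℤ)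
    unit-sym (suc a) zero = Vec.lookup-replicate a 0ℤ
    unit-sym (suc a) (suc b) = unit-sym a b

    sum-unit : ∀ {n} (y : Point n) a → (sum λ b → y b * fromℤ (lookup (unit a) b)) ≈ y a
    sum-unit y zero = CR.trans (CR.+-cong (CR.trans (CR.*-congˡ fromℤ-1) (CR.*-identityʳ (y zero)))
      (sum-zero λ b → CR.trans (CR.*-congˡ (fromℤ-cong (Vec.lookup-replicate b 0ℤ))) (CR.zeroʳ (y (suc b))))) (CR.+-identityʳ (y zero))
    sum-unit y (suc a) = CR.trans (CR.+-cong (CR.zeroʳ (y zero)) (sum-unit (y ∘ suc) a)) (CR.+-identityˡ _)

    -- The hypothesis concerns lattice points only; its instances at the unit vectors give the
    -- matrix entries, and real points follow by linearity.
    matrix-inverse : ∀ {k l} (A : Fin k → Vec ℤ l) (B : Fin l → Vec ℤ k) → (∀ y → apply A (apply B y) ≡ y) → ∀ y a → dot (A a)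
      (λ b → dot (B b) y) ≈ y a
    matrix-inverse {k} A B inv y a = begin
      dot (A a) (λ b → dot (B b) y) ≈⟨ dot-cong (A a) (λ b → sum-cong {k} λ j → CR.*-comm _ _) ⟩
      dot (A a) (combination y λ j b → fromℤ (lookup (B b) j)) ≈⟨ dot-combination (A a) y (λ j b → fromℤ (lookup (B b) j)) ⟩
      (sum λ j → y j * dot (A a) (λ b → fromℤ (lookup (B b) j))) ≈⟨ sum-cong {k} (λ j → CR.*-congˡ (entry j)) ⟩
      (sum λ j → y j * fromℤ (lookup (unit a) j)) ≈⟨ sum-unit y a ⟩
      y a ∎
      where
      entry : ∀ j → dot (A a) (λ b → fromℤ (lookup (B b) j)) ≈ fromℤ (lookup (unit a) j)
      entry j = begin
        dot (A a) (λ b → fromℤ (lookup (B b) j)) ≈⟨ dot-cong (A a) (λ b → fromℤ-cong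
          (≡.sym (≡.trans (Vec.lookup∘tabulate (λ b → B b ∙ unit j) b) (∙-unit (B b) j)))) ⟩
        dot (A a) (ι (apply B (unit j))) ≈⟨ dot-ι (A a) (apply B (unit j)) ⟩
        fromℤ (A a ∙ apply B (unit j)) ≈⟨ fromℤ-cong (≡.trans (≡.sym (Vec.lookup∘tabulate (λ a → A a ∙ apply B (unit j)) a))
          (≡.trans (≡.cong (λ z → lookup z a) (inv (unit j))) (unit-sym a j))) ⟩
        fromℤ (lookup (unit a) j) ∎

    sum-split : ∀ m {n} (f : Vector Carrier (m ℕ.+ n)) → sum f ≈ (sum λ i → f (i ↑ˡ n)) + (sum λ j → f (m ↑ʳ j))
    sum-split zero f = CR.sym (CR.+-identityˡ _)
    sum-split (suc m) f = CR.trans (CR.+-congˡ (sum-split m (f ∘ suc))) (CR.sym (CR.+-assoc _ _ _))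

    module _ {A : Set} {m n : ℕ} (x : Vector A m) (z : Vector A n) where

      ++-↑ˡ : ∀ i → (x Functional.++ z) (i ↑ˡ n) ≡ x i
      ++-↑ˡ i rewrite Fin.splitAt-↑ˡ m i n = ≡.refl

      ++-↑ʳ : ∀ j → (x Functional.++ z) (m ↑ʳ j) ≡ z j
      ++-↑ʳ j rewrite Fin.splitAt-↑ʳ m n j = ≡.refl

      ++-all : ∀ {Q : A → Set} → (∀ i → Q (x i)) → (∀ j → Q (z j)) → ∀ a → Q ((x Functional.++ z) a)
      ++-all p q a with splitAt m a
      ... | inj₁ i = p i
      ... | inj₂ j = q j

    ≋-++ : ∀ {m n} {y : Point (m ℕ.+ n)} {x : Point m} {z : Point n} → (∀ i → y (i ↑ˡ n) ≈ x i) → (∀ j → y (m ↑ʳ j) ≈ z j) → y ≋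
      (x Functional.++ z)
    ≋-++ {m} {n} {y} p q a with splitAt m a in eq
    ... | inj₁ i = ≡.subst (λ a → y a ≈ _) (Fin.splitAt⁻¹-↑ˡ eq) (p i)
    ... | inj₂ j = ≡.subst (λ a → y a ≈ _) (Fin.splitAt⁻¹-↑ʳ eq) (q j)

    conv-combination : ∀ {n k} {S : Subset n} (c : Vector Carrier k) X → (∀ i → conv S (X i)) → (∀ i → 0# ≤ c i) → sum c ≈ 1# → conv S
      (combination c X)
    conv-combination {n} {S = S} c X XS c≥0 c1 = let k , c′ , p , pS , c′≥0 , e , eq = go c X XS c≥0 in k , c′ , p , pS , c′≥0 , CR.trans e c1 , eq
      where
      -- The total weight is arbitrary here, since a convex combination without its first term no
      -- longer has weight 1.
      go : ∀ {k} (c : Vector Carrier k) (X : Fin k → Point n) → (∀ i → conv S (X i)) → (∀ i → 0# ≤ c i) →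
        ∃[ l ] ∃[ c′ ] ∃[ p ] (∀ i → S (p i)) × (∀ i → 0# ≤ c′ i) × sum {l} c′ ≈ sum c × combination c X ≋ combination c′ p
      go {zero} c X _ _ = 0 , (λ ()) , (λ ()) , (λ ()) , (λ ()) , CR.refl , λ _ → CR.refl
      go {suc k} c X XS c≥0 with XS zero | go (c ∘ suc) (X ∘ suc) (XS ∘ suc) (c≥0 ∘ suc)
      ... | l₁ , c₁ , p₁ , S₁ , c₁≥0 , e₁ , eq₁ | l₂ , c₂ , p₂ , S₂ , c₂≥0 , e₂ , eq₂ =
        l₁ ℕ.+ l₂ , (c₁′ Functional.++ c₂) , (p₁ Functional.++ p₂) , ++-all p₁ p₂ {S} S₁ S₂ , ++-all c₁′ c₂ {0# ≤_} (λ i → 0≤-* (c≥0 zero) (c₁≥0 i)) c₂≥0 ,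
        CR.trans (sum-split l₁ (c₁′ Functional.++ c₂)) (CR.+-cong
          (CR.trans (sum-cong {l₁} λ i → CR.reflexive (++-↑ˡ c₁′ c₂ i)) (CR.trans (CR.sym (*-distribˡ-sum (c zero) c₁)) (CR.trans (CR.*-congˡ e₁) (CR.*-identityʳ (c zero)))))
          (CR.trans (sum-cong {l₂} λ j → CR.reflexive (++-↑ʳ c₁′ c₂ j)) e₂)) ,
        λ j → CR.sym (CR.trans (sum-split l₁ (λ a → (c₁′ Functional.++ c₂) a * (p₁ Functional.++ p₂) a j)) (CR.+-cong
          (CR.trans (sum-cong {l₁} λ i → CR.trans (CR.reflexive (≡.cong₂ (λ a b → a * b j) (++-↑ˡ c₁′ c₂ i) (++-↑ˡ p₁ p₂ i))) (CR.*-assoc (c zero) (c₁ i) (p₁ i j)))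
            (CR.trans (CR.sym (*-distribˡ-sum (c zero) (λ i → c₁ i * p₁ i j))) (CR.*-congˡ (CR.sym (eq₁ j)))))
          (CR.trans (sum-cong {l₂} λ i → CR.reflexive (≡.cong₂ (λ a b → a * b j) (++-↑ʳ c₁′ c₂ i) (++-↑ʳ p₁ p₂ i))) (CR.sym (eq₂ j)))))
        where
        c₁′ : Vector Carrier l₁
        c₁′ i = c zero * c₁ i

    module _ {n : ℕ} {P : Subset n} (V : List⁺ (Vec ℤ n)) (P→ : ∀ {x} → P x → conv (LatticePoints V) x)
      (→P : ∀ {x} → conv (LatticePoints V) x → P x)
      (q : ℕ) (e₀ : Vec ℤ (suc n)) (es : List (Vec ℤ (suc n))) (n≡q+s : n ≡ q ℕ.+ length es)
      (nonneg : All (λ e → All (λ v → 0ℤ ℤ.≤ e ∙ v) (List.map (1ℤ ∷_) (toList V))) (e₀ ∷ es))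
      (nonzero : All (λ e → ∃[ v ] v ∈ toList V × 0ℤ ℤ.< e ∙ (1ℤ ∷ v)) (e₀ ∷ es))
      (total : ∀ x → sumBy (_∙ x) (e₀ ∷ es) ≡ height ∙ x) where

      private
        s = length es

        e : Fin (suc s) → Vec ℤ (suc n)
        e = List.lookup (e₀ ∷ es)

        OnFace : Fin (suc s) → Vec ℤ n → Set
        OnFace i v = e i ∙ (1ℤ ∷ v) ≡ 1ℤ × (∀ j → j ≢ i → e j ∙ (1ℤ ∷ v) ≡ 0ℤ)

        face : ∀ {v} → v ∈ toList V → ∃[ i ] OnFace i v
        face {v} v∈ = one-hot (_∙ (1ℤ ∷ v)) (e₀ ∷ es) (All.map (λ nn → All.lookup nn (∈-map⁺ (1ℤ ∷_) v∈)) nonneg)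
          (≡.trans (total (1ℤ ∷ v)) (height-∙ 1ℤ v))

        on-face : ∀ {v i} → v ∈ toList V → 0ℤ ℤ.< e i ∙ (1ℤ ∷ v) → OnFace i v
        on-face {v} {i} v∈ pos with face v∈
        ... | i′ , p@(_ , others) with i Fin.≟ i′
        ... | yes ≡.refl = p
        ... | no ne = ⊥-elim (ℤ.<-irrefl (≡.sym (others i ne)) pos)

        -- One vertex on each face. The differences from `ν₀` form the system dual to the linear
        -- parts `φ`, as `complete` requires.
        ν : Fin (suc s) → Vec ℤ n
        ν i = proj₁ (All.lookup nonzero (∈-lookup i))

        ν∈V : ∀ i → ν i ∈ toList V
        ν∈V i = proj₁ (proj₂ (All.lookup nonzero (∈-lookup i)))

        ν-face : ∀ i → OnFace i (ν i)
        ν-face i = on-face (ν∈V i) (proj₂ (proj₂ (All.lookup nonzero (∈-lookup i))))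

        ν₀ : Vec ℤ n
        ν₀ = ν zero

        φ : Fin s → Vec ℤ n → ℤ
        φ j x = Vec.tail (e (suc j)) ∙ x

        φ-face : ∀ j v → φ j (v ⊖ ν₀) ≡ e (suc j) ∙ (1ℤ ∷ v)
        φ-face j v = ≡.trans (tail-difference (e (suc j)) v ν₀) (≡.trans
          (≡.cong (λ z → e (suc j) ∙ (1ℤ ∷ v) ℤ.- z) (proj₂ (ν-face zero) (suc j) λ ())) (ℤ.+-identityʳ _))

        basis : ∃[ M ] ∀ j x → Unimodular.U {n} {q ℕ.+ s} M (q ↑ʳ j) ∙ x ≡ φ j x
        basis = unimodular φ (λ j → ∙-functional (Vec.tail (e (suc j))))
          (complete s q φ (λ j → ν (suc j) ⊖ ν₀) (≡.trans n≡q+s (ℕ.+-comm q s)) (λ j → ∙-functional (Vec.tail (e (suc j))))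
          (λ i → ≡.trans (φ-face i (ν (suc i))) (proj₁ (ν-face (suc i))))
          (λ i j i≢j → ≡.trans (φ-face i (ν (suc j))) (proj₂ (ν-face (suc j)) (suc i) λ { ≡.refl → i≢j ≡.refl })))

        abstract
          U : Fin (q ℕ.+ s) → Vec ℤ n
          U = Unimodular.U (proj₁ basis)

          R : Fin n → Vec ℤ (q ℕ.+ s)
          R = Unimodular.R (proj₁ basis)

          RU : ∀ x → apply R (apply U x) ≡ x
          RU = Unimodular.RU (proj₁ basis)

          UR : ∀ y → apply U (apply R y) ≡ y
          UR = Unimodular.UR (proj₁ basis)

          U-φ : ∀ j x → U (q ↑ʳ j) ∙ x ≡ φ j x
          U-φ = proj₂ basis

        -- The affine map x ↦ U (x - ν₀): the base vertex of face zero goes to the origin.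
        T : Point n → Point (q ℕ.+ s)
        T x a = affine-value (ℤ.- (U a ∙ ν₀) ∷ U a) x

        F : Point (q ℕ.+ s) → Point n
        F y k = affine-value (lookup ν₀ k ∷ R k) y

        T-cong : ∀ {x y} → x ≋ y → T x ≋ T y
        T-cong eq a = affine-value-cong (ℤ.- (U a ∙ ν₀) ∷ U a) eq

        F-cong : ∀ {x y} → x ≋ y → F x ≋ F y
        F-cong eq k = affine-value-cong (lookup ν₀ k ∷ R k) eq

        T-combination : ∀ {k} (c : Vector Carrier k) p → sum c ≈ 1# → T (combination c p) ≋ combination c (T ∘ p)
        T-combination c p c1 a = affine-value-combination (ℤ.- (U a ∙ ν₀) ∷ U a) c p c1

        T-F : ∀ y → T (F y) ≋ y
        T-F y a = begin
          fromℤ (ℤ.- (U a ∙ ν₀)) + dot (U a) (λ k → ι ν₀ k + dot (R k) y) ≈⟨ CR.+-cong (fromℤ-neg (U a ∙ ν₀))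
            (CR.trans (dot-add (U a) (ι ν₀) (λ k → dot (R k) y)) (CR.+-cong (dot-ι (U a) ν₀) (matrix-inverse U R UR y a))) ⟩
          - fromℤ (U a ∙ ν₀) + (fromℤ (U a ∙ ν₀) + y a) ≈⟨ CR.sym (CR.+-assoc _ _ _) ⟩
          - fromℤ (U a ∙ ν₀) + fromℤ (U a ∙ ν₀) + y a ≈⟨ CR.trans (CR.+-congʳ (CR.-‿inverseˡ _)) (CR.+-identityˡ (y a)) ⟩
          y a ∎

        F-T : ∀ x → F (T x) ≋ x
        F-T x k = begin
          fromℤ (lookup ν₀ k) + dot (R k) (λ a → fromℤ (ℤ.- (U a ∙ ν₀)) + dot (U a) x) ≈⟨ CR.+-congˡ
            (CR.trans (dot-add (R k) (λ a → fromℤ (ℤ.- (U a ∙ ν₀))) (λ a → dot (U a) x)) (CR.+-cong shift (matrix-inverse R U RU x k))) ⟩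
          fromℤ (lookup ν₀ k) + (- fromℤ (lookup ν₀ k) + x k) ≈⟨ CR.sym (CR.+-assoc _ _ _) ⟩
          fromℤ (lookup ν₀ k) + - fromℤ (lookup ν₀ k) + x k ≈⟨ CR.trans (CR.+-congʳ (CR.-‿inverseʳ _)) (CR.+-identityˡ (x k)) ⟩
          x k ∎
          where
          shift : dot (R k) (λ a → fromℤ (ℤ.- (U a ∙ ν₀))) ≈ - fromℤ (lookup ν₀ k)
          shift = begin
            dot (R k) (λ a → fromℤ (ℤ.- (U a ∙ ν₀))) ≈⟨ dot-cong (R k) (λ a → fromℤ-cong
              (≡.sym (≡.trans (Vec.lookup∘tabulate (λ a → U a ∙ (⊟ ν₀)) a) (∙-⊟ (U a) ν₀)))) ⟩
            dot (R k) (ι (apply U (⊟ ν₀))) ≈⟨ dot-ι (R k) (apply U (⊟ ν₀)) ⟩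
            fromℤ (R k ∙ apply U (⊟ ν₀)) ≈⟨ fromℤ-cong (≡.trans (≡.sym (Vec.lookup∘tabulate (λ k → R k ∙ apply U (⊟ ν₀)) k))
              (≡.trans (≡.cong (λ z → lookup z k) (RU (⊟ ν₀))) (Vec.lookup-map k _ ν₀))) ⟩
            fromℤ (ℤ.- lookup ν₀ k) ≈⟨ fromℤ-neg (lookup ν₀ k) ⟩
            - fromℤ (lookup ν₀ k) ∎

        τ : Vec ℤ n → Vec ℤ (q ℕ.+ s)
        τ v = apply U (v ⊖ ν₀)

        T-ι : ∀ v → T (ι v) ≋ ι (τ v)
        T-ι v a = CR.trans (affine-value-ι (ℤ.- (U a ∙ ν₀) ∷ U a) v) (fromℤ-cong
          (≡.trans (≡.trans (lem (U a ∙ ν₀) (U a ∙ v)) (≡.sym (∙-⊖ (U a) v ν₀))) (≡.sym (Vec.lookup∘tabulate (λ a → U a ∙ (v ⊖ ν₀)) a))))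
          where
          lem : ∀ a b → ℤ.- a ℤ.* 1ℤ ℤ.+ b ≡ b ℤ.- a
          lem = solve-∀

        F-ι : ∀ w → F (ι w) ≋ ι (ν₀ ⊕ apply R w)
        F-ι w k = CR.trans (CR.+-congˡ (dot-ι (R k) w)) (CR.trans (CR.sym (fromℤ-+ (lookup ν₀ k) (R k ∙ w)))
          (fromℤ-cong (≡.sym (≡.trans (Vec.lookup-zipWith ℤ._+_ k ν₀ (apply R w))
            (≡.cong (λ z → lookup ν₀ k ℤ.+ z) (Vec.lookup∘tabulate (λ k → R k ∙ w) k))))))

        isomorphism : AffineIsomorphism n (q ℕ.+ s)
        isomorphism = record
          { inverse = record { to = T ; from = F ; to-cong = T-cong ; from-cong = F-cong
                             ; inverse = (λ {y} eq a → CR.trans (T-cong eq a) (T-F y a)) , λ {x} eq k → CR.trans (F-cong eq k) (F-T x k) }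
          ; affine = T-combination }

        π : Vec ℤ n → Vec ℤ q
        π v = tabulate λ k → lookup (τ v) (k ↑ˡ s)

        -- By the choice of `U` the last s coordinates are the values of `e (suc j)` at the vertex,
        -- so face i lies over the i-th vertex of the standard simplex.
        T-face : ∀ {i} v → OnFace i v → T (ι v) ≋ (ι (π v) Functional.++ vertex i)
        T-face {i} v (one , others) = ≋-++ (λ k → CR.trans (T-ι v (k ↑ˡ s))
          (fromℤ-cong (≡.sym (Vec.lookup∘tabulate (λ k → lookup (τ v) (k ↑ˡ s)) k))))
          λ j → CR.trans (T-ι v (q ↑ʳ j)) (CR.trans (fromℤ-cong (≡.trans (Vec.lookup∘tabulate (λ a → U a ∙ (v ⊖ ν₀)) (q ↑ʳ j))
            (≡.trans (U-φ j (v ⊖ ν₀)) (φ-face j v)))) (coordinate i j one others))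
          where
          coordinate : ∀ i j → e i ∙ (1ℤ ∷ v) ≡ 1ℤ → (∀ j → j ≢ i → e j ∙ (1ℤ ∷ v) ≡ 0ℤ) → fromℤ (e (suc j) ∙ (1ℤ ∷ v)) ≈ vertex i j
          coordinate zero j _ others = fromℤ-cong (others (suc j) λ ())
          coordinate (suc i) j one others with i Fin.≟ j
          ... | yes ≡.refl = CR.trans (fromℤ-cong one) fromℤ-1
          ... | no ne = fromℤ-cong (others (suc j) λ { ≡.refl → ne ≡.refl })

        on-face? : ∀ i (v : Vec ℤ n) → _
        on-face? i v = e i ∙ (1ℤ ∷ v) ℤ.≟ 1ℤ

        vertices : Fin (suc s) → List⁺ (Vec ℤ q)
        -- Putting `ν i` in front exhibits the list as nonempty.
        vertices i = π (ν i) ∷ List.map π (filter (on-face? i) (toList V))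

        ∈-vertices : ∀ {i v} → v ∈ toList V → OnFace i v → π v ∈ toList (vertices i)
        ∈-vertices {i} v∈ (one , _) = there (∈-map⁺ π (∈-filter⁺ (on-face? i) v∈ one))

        vertices-∈ : ∀ {i w} → w ∈ toList (vertices i) → ∃[ v ] v ∈ toList V × OnFace i v × w ≡ π v
        vertices-∈ {i} (here eq) = ν i , ν∈V i , ν-face i , eq
        vertices-∈ {i} (there w∈) with ∈-map⁻ π w∈
        ... | v , v∈ , eq with ∈-filter⁻ (on-face? i) {xs = toList V} v∈
        ... | v∈V , one = v , v∈V , on-face v∈V (≡.subst (0ℤ ℤ.<_) (≡.sym one) (+<+ (s≤s z≤n))) , eq

        summand : Fin (suc s) → Subset q
        summand i = conv (LatticePoints (vertices i))

        to-cayley : ∀ {x} → conv (LatticePoints V) x → CayleySum summand (T x)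
        to-cayley (k , c , p , S , c≥0 , c1 , eq) = k , c , T ∘ p , point , c≥0 , c1 , λ a → CR.trans (T-cong eq a) (T-combination c p c1 a)
          where
          point : ∀ i → _
          point i with S i
          ... | v , v∈ , pv with face v∈
          ... | f , onF = f , ι (π v) , conv-point {S = LatticePoints (vertices f)} (π v , ∈-vertices v∈ onF , λ _ → CR.refl) , λ a →
            CR.trans (T-cong pv a) (T-face v onF a)

        -- The same coefficients are applied to vertices of P on face i. Their images share the last
        -- s coordinates `vertex i`, which the combination preserves because the coefficients sum to
        -- 1.
        lift : ∀ {i x} → summand i x → ∃[ x′ ] conv (LatticePoints V) x′ × T x′ ≋ (x Functional.++ vertex i)
        lift {i} {x} (l , c , p , S , c≥0 , c1 , eq) = combination c (ι ∘ v) ,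
          (l , c , ι ∘ v , (λ m → v m , proj₁ (proj₂ (origin m)) , λ _ → CR.refl) , c≥0 , c1 , λ _ → CR.refl) ,
          ≋-++ (λ k → CR.trans (expand (k ↑ˡ s)) (CR.trans (sum-cong {l} λ m → CR.*-congˡ
            (CR.trans (CR.reflexive (++-↑ˡ (ι (π (v m))) (vertex i) k)) (CR.sym (matches m k)))) (CR.sym (eq k))))
               (λ j → CR.trans (expand (q ↑ʳ j)) (CR.trans (sum-cong {l} λ m → CR.*-congˡ (CR.reflexive (++-↑ʳ (ι (π (v m))) (vertex i) j)))
                 (CR.trans (CR.sym (*-distribʳ-sum (vertex i j) c)) (CR.trans (CR.*-congʳ c1) (CR.*-identityˡ _)))))
          where
          origin : ∀ m → ∃[ v ] v ∈ toList V × OnFace i v × proj₁ (S m) ≡ π v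
          origin m = vertices-∈ (proj₁ (proj₂ (S m)))
          v : Fin l → Vec ℤ n
          v m = proj₁ (origin m)
          matches : ∀ m → p m ≋ ι (π (v m))
          matches m k = CR.trans (proj₂ (proj₂ (S m)) k) (CR.reflexive (≡.cong (λ w → ι w k) (proj₂ (proj₂ (proj₂ (origin m))))))
          expand : ∀ a → T (combination c (ι ∘ v)) a ≈ sum λ m → c m * (ι (π (v m)) Functional.++ vertex i) a
          expand a = CR.trans (T-combination c (ι ∘ v) c1 a) (sum-cong {l} λ m → CR.*-congˡ
            (T-face (v m) (proj₁ (proj₂ (proj₂ (origin m)))) a))

        from-cayley : ∀ {y} → CayleySum summand y → ∃[ x ] conv (LatticePoints V) x × y ≋ T x
        from-cayley {y} (k , c , Y , S , c≥0 , c1 , eq) = combination c X , conv-combination {S = LatticePoints V} c X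
          (λ i → proj₁ (proj₂ (lifted i))) c≥0 c1 ,
          λ a → CR.trans (eq a) (CR.trans (sum-cong {k} λ i → CR.*-congˡ
            (CR.trans (proj₂ (proj₂ (proj₂ (S i))) a) (CR.sym (proj₂ (proj₂ (lifted i)) a)))) (CR.sym (T-combination c X c1 a)))
          where
          lifted : ∀ i → _
          lifted i = lift {proj₁ (S i)} (proj₁ (proj₂ (proj₂ (S i))))
          X : Fin k → Point n
          X i = proj₁ (lifted i)

      cayley-decomposition : DecomposesAsCayleySum P q
      cayley-decomposition = record
        { s = s ; summand = summand ; isLatticePolytope = λ i → vertices i , (λ p → p) , (λ p → p) ; φ = isomorphism
        ; lattice-onto = (λ { (x , (v , xv) , yx) → τ v , λ a → CR.trans (yx a) (CR.trans (T-cong xv a) (T-ι v a)) })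
            , λ { {y} (w , yw) → F y , (ν₀ ⊕ apply R w , λ k → CR.trans (F-cong yw k) (F-ι w k)) , λ a → CR.sym (T-F y a) }
        ; cayley = (λ { (x , Px , yx) → let k , c , p , S , c≥0 , c1 , eq = to-cayley (P→ Px) in k , c , p , S , c≥0 , c1 , λ a → CR.trans (yx a) (eq a) })
            , λ y → let x , cx , eq = from-cayley y in x , →P cx , eq }

-- The theorem

open LatticeCones using (InCone; Decomposition; module Decomposition; module Gorenstein)
open RealPolytopes using (module Reals; module Cayley)

open import Defs
open import Data.Nat using (ℕ; _*_; _∸_; _≤_)
open import Data.Product using (_×_; ∃-syntax)

theorem3p1 : (ℝ : RealNumbers) → let open Polytopes ℝ in
    (n d : ℕ) (P : Subset n) →
    IsLatticePolytope P → IsFullDimensional P → IsGorensteinOfDegree P d →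
    ∃[ q ] (q ≤ 2 * d ∸ 1) × DecomposesAsCayleySum P q
theorem3p1 ℝ n d P (V , P→ , →P) full gorenstein = conclude (G.decomposition (here refl))
  where
  open Polytopes ℝ
  open IsGorensteinOfDegree gorenstein
  open Reals ℝ using (InCone⇒dilate; dilate⇒InCone; spanning)

  L : ℕ → ℕ
  L = proj₁ isHStar

  cone-cardinality : ∀ m → HasCardinality (λ v → InCone (List.map (1ℤ ∷_) (toList V)) (+ m ∷ v)) (L m)
  cone-cardinality m = let xs , unique , members , size = proj₁ (proj₂ isHStar) m in xs , unique ,
    (λ v → mk⇔ (λ i → dilate⇒InCone V P→ →P m v (Equivalence.to (members v) i))
               (λ c → Equivalence.from (members v) (InCone⇒dilate V P→ →P m v c))) , size

  module G = Gorenstein {n} {d} (toList V) L cone-cardinality (spanning V P→ →P full) h* (proj₂ (proj₂ isHStar)) degree symmetric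

  conclude : Decomposition d (toList V) → ∃[ q ] (q ≤ 2 * d ∸ 1) × DecomposesAsCayleySum P q
  conclude record { q = q ; n≡q+s = n≡q+s ; q≤2d-1 = q≤2d-1 ; summands = e₀ ∷ es ; count = refl ; summands-nonneg = nonneg ;
    summands-nonzero = nonzero ; summands-total = total } =
    q , q≤2d-1 , Cayley.cayley-decomposition ℝ V P→ →P q e₀ es n≡q+s nonneg nonzero total
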